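{- For all $k\ge 0$ and $r\ge 4$, the group $\tilde H_{k-1+r}(\mathsf{M}_{2k+1+3r};\mathbb{Z})$ contains a subgroup isomorphic to $(\mathbb{Z}_3)^{\binom{2k}{k}}$. For all $k\ge 0$, the group $\tilde H_{k+2}(\mathsf{M}_{2k+10};\mathbb{Z})$ contains a subgroup isomorphic to $(\mathbb{Z}_3)^{\binom{k+1}{\lfloor (k+1)/2\rfloor}}$. In particular, $\tilde H_{k-1+r}(\mathsf{M}_{2k+1+3r};\mathbb{Z})$ contains an element of order $3$ whenever $k\ge 0$ and $r\ge 3$.
   Context: $\mathsf{M}_n$ is the matching complex of the complete graph $K_n$ on vertex set $[n]=\{1,\dots,n\}$: the simplicial complex whose vertices are the edges of $K_n$ and whose faces are the matchings. $\tilde H$ denotes reduced simplicial homology. -}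

module Defs where

open import Data.Bool using (Bool; true; false; _∧_; _∨_; not; if_then_else_)
open import Data.Nat using (ℕ; zero; suc; _+_; _*_; _<ᵇ_; _≡ᵇ_)
open import Data.Nat.DivMod using (_mod_)
open import Data.Fin using (Fin; toℕ)
open import Data.Fin.Properties using () renaming (_≟_ to _≟ᶠ_)
open import Data.Integer using (ℤ; -_) renaming (_+_ to _+ℤ_; 0ℤ to 0ℤ)
open import Data.List using (List; []; _∷_; _++_; length; map; concatMap)
open import Data.List.Properties using (≡-dec)
open import Data.Product using (_×_; _,_; Σ; ∃)
open import Data.Product.Properties using () renaming (≡-dec to ×-≡-dec)
open import Data.Vec using (Vec; zipWith)
open import Relation.Binary.PropositionalEquality using (_≡_)
open import Relation.Nullary using (¬_; does)

-- An edge {i,j} of K_n is recorded as an ordered pair (i , j) with i < j.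
Edge : ℕ → Set
Edge n = Fin n × Fin n

_=ᶠ_ : ∀ {n} → Fin n → Fin n → Bool
a =ᶠ b = toℕ a ≡ᵇ toℕ b

edgeOK : ∀ {n} → Edge n → Bool
edgeOK (i , j) = toℕ i <ᵇ toℕ j

-- strict lexicographic order on edges (a fixed total order on the vertices of M_n)
lexLt : ∀ {n} → Edge n → Edge n → Bool
lexLt (i , j) (i' , j') = (toℕ i <ᵇ toℕ i') ∨ ((i =ᶠ i') ∧ (toℕ j <ᵇ toℕ j'))

disjointE : ∀ {n} → Edge n → Edge n → Bool
disjointE (i , j) (i' , j') = not ((i =ᶠ i') ∨ (i =ᶠ j') ∨ (j =ᶠ i') ∨ (j =ᶠ j'))

allB : ∀ {A : Set} → (A → Bool) → List A → Bool
allB p [] = true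
allB p (x ∷ xs) = p x ∧ allB p xs

-- A face of M_n = a matching, written canonically as the strictly
-- lex-increasing list of its edges (this also fixes its orientation).
isMatching : ∀ {n} → List (Edge n) → Bool
isMatching [] = true
isMatching (e ∷ es) = edgeOK e ∧ allB (λ e' → lexLt e e' ∧ disjointE e e') es ∧ isMatching es

-- a face with exactly m edges, i.e. of dimension m - 1 (m = 0: the empty face)
isFace : ∀ {n} → ℕ → List (Edge n) → Bool
isFace m σ = isMatching σ ∧ (length σ ≡ᵇ m)

-- Augmented simplicial chains with ℤ coefficients, as formal sums.
-- A chain is a finite formal sum  Σ aᵢ σᵢ ; terms whose σᵢ is not a face of
-- the relevant size are ignored (they contribute nothing).

Chain : ℕ → Set
Chain n = List (ℤ × List (Edge n))

coeff : ∀ {n} → ℕ → Chain n → List (Edge n) → ℤ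
coeff m [] σ = 0ℤ
coeff m ((a , τ) ∷ c) σ =
  (if isFace m τ ∧ does (≡-dec (×-≡-dec _≟ᶠ_ _≟ᶠ_) τ σ) then a else 0ℤ) +ℤ coeff m c σ

_≈[_]_ : ∀ {n} → Chain n → ℕ → Chain n → Set
c ≈[ m ] c' = ∀ σ → coeff m c σ ≡ coeff m c' σ

neg : ∀ {n} → Chain n → Chain n
neg = map (λ { (a , σ) → (- a , σ) })

bdFace : ∀ {n} → ℤ → List (Edge n) → Chain n
bdFace a [] = []
bdFace a (e ∷ es) = (a , es) ∷ map (λ { (b , σ) → (b , e ∷ σ) }) (bdFace (- a) es)

-- boundary map C_{m-1} → C_{m-2} on chains of m-edge faces (augmented: the
-- boundary of a vertex is the empty face, so this computes reduced homology)
∂ : ∀ {n} → ℕ → Chain n → Chain n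
∂ m = concatMap (λ { (a , τ) → if isFace m τ then bdFace a τ else [] })

-- Reduced homology H̃_d(M_n ; ℤ) = Z_d / B_d, with Z_d, B_d ⊆ C_d,
-- and C_d spanned by faces with d+1 edges.

IsCycle : (n d : ℕ) → Chain n → Set
IsCycle n d z = ∂ (suc d) z ≈[ d ] []

Homologous : (n d : ℕ) → Chain n → Chain n → Set
Homologous n d z z' = ∃ λ (b : Chain n) → ∂ (suc (suc d)) b ≈[ suc d ] (z ++ neg z')

_+₃_ : Fin 3 → Fin 3 → Fin 3
a +₃ b = (toℕ a + toℕ b) mod 3

_⊕_ : ∀ {m} → Vec (Fin 3) m → Vec (Fin 3) m → Vec (Fin 3) m
_⊕_ = zipWith _+₃_

-- H̃_d(M_n ; ℤ) contains a subgroup isomorphic to (ℤ₃)^m, i.e. there is an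
-- injective group homomorphism (ℤ₃)^m → H̃_d(M_n ; ℤ) (given on representatives).
HasZ3PowerSubgroup : (n d m : ℕ) → Set
HasZ3PowerSubgroup n d m =
  Σ (Vec (Fin 3) m → Chain n) λ f →
    (∀ a → IsCycle n d (f a))
  × (∀ a b → Homologous n d (f (a ⊕ b)) (f a ++ f b))
  × (∀ a b → Homologous n d (f a) (f b) → a ≡ b)

HasElementOfOrder3 : (n d : ℕ) → Set
HasElementOfOrder3 n d =
  Σ (Chain n) λ z →
    IsCycle n d z
  × ¬ Homologous n d z []
  × ¬ Homologous n d (z ++ z) []
  × Homologous n d (z ++ z ++ z) []

{-# OPTIONS --safe #-}
-- Split the vertices into a set P with 2k elements, p₀, q, s, v₀ and r − 1 triples {a, b, c}. A partition
-- P = A ⊔ T with |A| = |T| = k gives a cycle: the fundamental cycle of the chessboard complex on A ∪ {p₀}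
-- and T ∪ {q, s}, followed by γ = ∏ (ab − bc). Two triples and the vertex v₀ carry a chain of M₇ with
-- boundary 3 (ab − bc)(de − ef), so the class of the cycle is killed by 3.
--
-- To detect the classes, join the 2k + 1 vertices of P ∪ {p₀} but one by k edges. Contracting them sends
-- a cocycle of the matching complex on the remaining 3r + 1 vertices to one of the whole complex. On
-- those vertices a cocycle λ mod 3 with value 1 on the product of r factors ab − bc is built in the
-- complex of matchings with loops: with D replacing a loop by a missing vertex one has D³ = 0 mod 3, so
-- that λ arises by solving alternately ∂λ′ = Dλ and ∂λ″ = D²λ′. The value of a contracted λ on the cycle
-- of T is ±1 or 0 according to whether T meets every edge in one point. Since 2 y = (y + n) + (y + w) −
-- (n + w), these values determine the T-coefficients mod 3, which proves independence. The bound in the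
-- second statement follows from C(k + 1, ⌊(k + 1)/2⌋) ≤ C(2k, k).
module Submission where

open import Defs
open import Algebra.Structures using (IsAbelianGroup)
open import Data.Bool using (Bool; true; false; _∧_; T; _∨_; if_then_else_; not)
open import Data.Bool.Properties using (∨-comm)
open import Data.Empty using (⊥-elim; ⊥)
open import Data.Fin using (Fin; zero; suc; punchIn; pinch; toℕ; #_)
open import Data.Fin.Properties using (toℕ-injective) renaming (_≟_ to _≟ᶠ_)
open import Data.Integer using (ℤ; 0ℤ; -[1+_]; 1ℤ) renaming (suc to sucℤ; +_ to pos; _+_ to _+ℤ_;
  -_ to -ℤ_)
open import Data.Integer.Solver using (module +-*-Solver)
open import Data.List using (List; []; _∷_; _++_; length; map; deduplicate; [_])
open import Data.List.Membership.Propositional using (_∈_; _∉_)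
open import Data.List.Membership.Propositional.Properties using (∈-deduplicate⁺; ∈-map⁺; ∈-++⁺ˡ;
  ∈-++⁺ʳ; ∈-++⁻)
open import Data.List.Properties using (∷-injectiveʳ; length-++)
open import Data.List.Relation.Binary.Permutation.Propositional using (_↭_; prep; ↭-sym; ↭-trans;
  ↭-refl)
open import Data.List.Relation.Binary.Permutation.Propositional.Properties using (∈-resp-↭;
  ↭-length; shift; ++-commutativeMonoid)
open import Data.List.Relation.Unary.All using (All; []; _∷_)
open import Data.List.Relation.Unary.AllPairs using ([]; _∷_; AllPairs)
open import Data.List.Relation.Unary.Any using (here; there)
open import Data.List.Relation.Unary.Unique.Propositional using (Unique)
open import Data.Nat using (ℕ; zero; suc; _<ᵇ_; _<_)
open import Data.Nat.Properties using (+-suc; <ᵇ⇒<; <⇒<ᵇ; <-irrefl; <-cmp)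
open import Data.Product using (_×_; _,_; ∃; proj₁; proj₂)
open import Data.Sum using (_⊎_; inj₁; inj₂)
open import Data.Vec using (Vec; []; _∷_; lookup; toList)
open import Function using (_∘_)
open import Relation.Binary.Definitions using (DecidableEquality; tri<; tri≈; tri>)
open import Relation.Binary.PropositionalEquality using (_≡_; refl; sym; trans; cong; cong₂; _≢_;
  subst)
open import Relation.Nullary using (does; yes; no; ¬_)
open import Relation.Nullary.Decidable using (dec-true; dec-false)
import Algebra.Properties.AbelianGroup as AbelianGroupProperties
import Algebra.Properties.CommutativeMonoid.Mult as CommutativeMonoidMult
import Algebra.Properties.CommutativeSemigroup as CommutativeSemigroupProperties
import Data.List.Relation.Binary.Permutation.Propositional as Perm
import Data.List.Relation.Binary.Permutation.Setoid.Properties as SetoidPermutation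
import Data.List.Relation.Unary.All as All
import Data.List.Relation.Unary.All.Properties as AllP
import Data.List.Relation.Unary.AllPairs as AllPairs
import Data.List.Relation.Unary.AllPairs.Properties as AllPairsP
import Data.List.Relation.Unary.Unique.DecPropositional.Properties as UniqueDec
import Data.Vec as Vec

-- Coning off a vertex by a loop makes the complex with loops almost contractible; the obstruction
-- to solving an equation is `E*`, which has values only on faces whose vertices are all gone or
-- matched. Loops minus free vertices is a weight, equal to 0 on those faces, and the right-hand
-- sides of stage i of the zigzag have weight 1 - i. So only stage 1 can be obstructed. There the
-- obstructions are computed: the first cancels, the second is three times something. The solutions
-- restrict to cocycles of ordinary matching complexes because D needs a loop to act on. Chains are
-- compared through functionals on words of edges, with values in ℤ for cycles and boundaries and in
-- F₃ for detection. Alternating functionals suffice, so words need sorting only when they become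
-- faces. The vertex p₀ lies in no T, so an edge p₀u selects the sets T that contain u. As u is then
-- spent, A has one vertex more than the rest of T. Each trade of a point of T for an edge therefore
-- finds two spare vertices, and the last spare is the vertex that the k edges leave out.

module LoopedMatchings where

  -- Arithmetic in the field with three elements, by exhaustion

  data F₃ : Set where
    0₃ 1₃ 2₃ : F₃

  infixl 6 _⊞_
  infix 8 ⊟_

  opaque
    _⊞_ : F₃ → F₃ → F₃
    0₃ ⊞ y = y
    x ⊞ 0₃ = x
    1₃ ⊞ 1₃ = 2₃
    1₃ ⊞ 2₃ = 0₃
    2₃ ⊞ 1₃ = 0₃
    2₃ ⊞ 2₃ = 1₃

    ⊟_ : F₃ → F₃
    ⊟ 0₃ = 0₃
    ⊟ 1₃ = 2₃
    ⊟ 2₃ = 1₃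

  _==_ : F₃ → F₃ → Bool
  0₃ == 0₃ = true
  1₃ == 1₃ = true
  2₃ == 2₃ = true
  _ == _ = false

  ==-sound : ∀ x y → T (x == y) → x ≡ y
  ==-sound 0₃ 0₃ _ = refl
  ==-sound 1₃ 1₃ _ = refl
  ==-sound 2₃ 2₃ _ = refl

  every : (F₃ → Bool) → Bool
  every f = f 0₃ ∧ f 1₃ ∧ f 2₃

  every-sound : ∀ f → T (every f) → ∀ x → T (f x)
  every-sound f t x with f 0₃ in ez | f 1₃ in ep | f 2₃ in em
  every-sound f t 0₃ | true | true | true rewrite ez = _
  every-sound f t 1₃ | true | true | true rewrite ep = _
  every-sound f t 2₃ | true | true | true rewrite em = _

  everyⁿ : ∀ n → (Vec F₃ n → Bool) → Bool
  everyⁿ zero f = f []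
  everyⁿ (suc n) f = every λ x → everyⁿ n (f ∘ (x ∷_))

  everyⁿ-sound : ∀ n f → T (everyⁿ n f) → ∀ v → T (f v)
  everyⁿ-sound zero f t [] = t
  everyⁿ-sound (suc n) f t (x ∷ v) =
    everyⁿ-sound n (f ∘ (x ∷_)) (every-sound (λ x → everyⁿ n (f ∘ (x ∷_))) t x) v

  -- an identity in n variables over F₃ holds as soon as its 3ⁿ instances do
  law : ∀ {n} (f g : Vec F₃ n → F₃) {_ : T (everyⁿ n λ v → f v == g v)} → ∀ v → f v ≡ g v
  law {n} f g {t} v = ==-sound _ _ (everyⁿ-sound n (λ v → f v == g v) t v)

  law₁ : {f g : F₃ → F₃} {_ : T (every λ a → f a == g a)} → ∀ a → f a ≡ g a
  law₁ {f} {g} {t} a = law (λ { (a ∷ []) → f a }) (λ { (a ∷ []) → g a }) {t} (a ∷ [])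

  law₂ : {f g : F₃ → F₃ → F₃} {_ : T (every λ a → every λ b → f a b == g a b)} → ∀ a b → f a b ≡ g a b
  law₂ {f} {g} {t} a b = law (λ { (a ∷ b ∷ []) → f a b }) (λ { (a ∷ b ∷ []) → g a b }) {t} (a ∷ b ∷ [])

  law₃ : {f g : F₃ → F₃ → F₃ → F₃} {_ : T (every λ a → every λ b → every λ c → f a b c == g a b c)} →
    ∀ a b c → f a b c ≡ g a b c
  law₃ {f} {g} {t} a b c =
    law (λ { (a ∷ b ∷ c ∷ []) → f a b c }) (λ { (a ∷ b ∷ c ∷ []) → g a b c }) {t} (a ∷ b ∷ c ∷ [])

  law₄ : {f g : F₃ → F₃ → F₃ → F₃ → F₃}
    {_ : T (every λ a → every λ b → every λ c → every λ d → f a b c d == g a b c d)} →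
    ∀ a b c d → f a b c d ≡ g a b c d
  law₄ {f} {g} {t} a b c d = law (λ { (a ∷ b ∷ c ∷ d ∷ []) → f a b c d })
    (λ { (a ∷ b ∷ c ∷ d ∷ []) → g a b c d }) {t} (a ∷ b ∷ c ∷ d ∷ [])

  opaque
    unfolding _⊞_ ⊟_

    ⊟-fixed⇒0 : ∀ {x} → x ≡ ⊟ x → x ≡ 0₃
    ⊟-fixed⇒0 {0₃} _ = refl

    ⊟0 : ⊟ 0₃ ≡ 0₃
    ⊟0 = refl

    0⊞0 : 0₃ ⊞ 0₃ ≡ 0₃
    0⊞0 = refl

    interchange : ∀ a b c d → (a ⊞ b) ⊞ (c ⊞ d) ≡ (a ⊞ c) ⊞ (b ⊞ d)
    interchange = law₄

    ⊟-involutive : ∀ a → ⊟ ⊟ a ≡ a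
    ⊟-involutive = law₁

    ⊞-identityˡ : ∀ a → 0₃ ⊞ a ≡ a
    ⊞-identityˡ a = refl

    ⊞-identityʳ : ∀ a → a ⊞ 0₃ ≡ a
    ⊞-identityʳ = law₁

    ⊞-inverseʳ : ∀ a → a ⊞ ⊟ a ≡ 0₃
    ⊞-inverseʳ = law₁

    rearrange₁ : ∀ a b c → ⊟ (a ⊞ ⊟ (b ⊞ ⊟ c)) ≡ b ⊞ ⊟ (a ⊞ ⊟ ⊟ c)
    rearrange₁ = law₃

    rearrange₂ : ∀ a b c → ⊟ (a ⊞ (b ⊞ c)) ≡ ⊟ b ⊞ (⊟ a ⊞ ⊟ c)
    rearrange₂ = law₃

    rearrange₃ : ∀ a b c → a ⊞ ⊟ (b ⊞ c) ≡ ⊟ b ⊞ (a ⊞ ⊟ c)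
    rearrange₃ = law₃

    cancel₁ : ∀ a b → ((a ⊞ ⊟ b) ⊞ b) ⊞ 0₃ ≡ a
    cancel₁ = law₂

    cancel₂ : ∀ a → (0₃ ⊞ (a ⊞ ⊟ 0₃)) ⊞ 0₃ ≡ a
    cancel₂ = law₁

    cancel₃ : ∀ a b c → (a ⊞ ⊟ b) ⊞ ⊟ (a ⊞ ⊟ c) ≡ ⊟ b ⊞ c
    cancel₃ = law₃

    ⊟-⊞⊟ : ∀ a b → ⊟ a ⊞ ⊟ ⊟ b ≡ ⊟ (a ⊞ ⊟ b)
    ⊟-⊞⊟ = law₂

    ⊟-⊞ : ∀ a b → ⊟ (a ⊞ b) ≡ ⊟ a ⊞ ⊟ b
    ⊟-⊞ = law₂

    interchange⁻ : ∀ a b c d → (a ⊞ b) ⊞ ⊟ (c ⊞ d) ≡ (a ⊞ ⊟ c) ⊞ (b ⊞ ⊟ d)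
    interchange⁻ = law₄

    triple⁰ : ∀ a → a ⊞ (a ⊞ (a ⊞ 0₃)) ≡ 0₃
    triple⁰ = law₁

    ⊟-sub : ∀ a b → ⊟ (a ⊞ ⊟ b) ≡ ⊟ a ⊞ b
    ⊟-sub = law₂

    rearrange₄ : ∀ a b c → a ⊞ ⊟ (b ⊞ c) ≡ (a ⊞ ⊟ c) ⊞ ⊟ b
    rearrange₄ = law₃

    rearrange₅ : ∀ a b → (a ⊞ b) ⊞ ⊟ ⊟ b ≡ a ⊞ (b ⊞ b)
    rearrange₅ = law₂

    homotopy-law : ∀ x y x₁ y₁ x₂ y₂ c →
      (((c ⊞ ⊟ y) ⊞ ⊟ (c ⊞ ⊟ x)) ⊞ (((y ⊞ y₁) ⊞ y₂) ⊞ ⊟ (y₁ ⊞ ⊟ x₁))) ⊞ (x₂ ⊞ ⊟ y₂) ≡ (x ⊞ x₁) ⊞ x₂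
    homotopy-law x y x₁ y₁ x₂ y₂ c = law
      (λ { (x ∷ y ∷ x₁ ∷ y₁ ∷ x₂ ∷ y₂ ∷ c ∷ []) →
        (((c ⊞ ⊟ y) ⊞ ⊟ (c ⊞ ⊟ x)) ⊞ (((y ⊞ y₁) ⊞ y₂) ⊞ ⊟ (y₁ ⊞ ⊟ x₁))) ⊞ (x₂ ⊞ ⊟ y₂) })
      (λ { (x ∷ y ∷ x₁ ∷ y₁ ∷ x₂ ∷ y₂ ∷ c ∷ []) → (x ⊞ x₁) ⊞ x₂ })
      (x ∷ y ∷ x₁ ∷ y₁ ∷ x₂ ∷ y₂ ∷ c ∷ [])

  -- Matchings of Kₙ in which some uncovered vertices carry a loop and some are gone; the vertices are
  -- read in order, and edge j F joins the first one to the j-th of those left, F describing the rest.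
  data Face : ℕ → Set where
    nil  : Face 0
    free : ∀ {n} → Face n → Face (suc n)
    loop : ∀ {n} → Face n → Face (suc n)
    gone : ∀ {n} → Face n → Face (suc n)
    edge : ∀ {n} → Fin (suc n) → Face n → Face (suc (suc n))

  -- Cochains on looped matchings and their operators

  Fun : ℕ → Set
  Fun n = Face n → F₃

  infix 4 _≗′_
  _≗′_ : ∀ {n} → Fun n → Fun n → Set
  θ ≗′ η = ∀ F → θ F ≡ η F

  infixl 6 _⊕′_
  infix 8 ⊖_
  _⊕′_ : ∀ {n} → Fun n → Fun n → Fun n
  (θ ⊕′ η) F = θ F ⊞ η F
  ⊖_ : ∀ {n} → Fun n → Fun n
  (⊖ θ) F = ⊟ θ F

  record Linear {k n} (f : Fun k → Fun n) : Set where
    field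
      cong≗ : ∀ {θ η} → θ ≗′ η → f θ ≗′ f η
      add : ∀ θ η → f (θ ⊕′ η) ≗′ f θ ⊕′ f η
      neg≗ : ∀ θ → f (⊖ θ) ≗′ ⊖ f θ
    -- A zero cochain is its own negative, hence so is its image, and 2 is invertible in F₃.
    zer : ∀ {θ} → (∀ F → θ F ≡ 0₃) → ∀ F → f θ F ≡ 0₃
    zer {θ} e F = ⊟-fixed⇒0 (trans (cong≗ (λ F → trans (e F) (sym (trans (cong ⊟_ (e F)) ⊟0))) F) (neg≗ θ F))
  open Linear

  -- Transpose of inserting a free vertex at position `j`. When an edge comes first, its partner
  -- moves from `i` to `punchIn j i`, and among the vertices off that edge the new one stands at
  -- `pinch i j`.
  ins : ∀ {n} → Fin (suc n) → Fun (suc n) → Fun n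
  ins zero θ F = θ (free F)
  ins (suc j) θ (free F) = ins j (θ ∘ free) F
  ins (suc j) θ (loop F) = ins j (θ ∘ loop) F
  ins (suc j) θ (gone F) = ins j (θ ∘ gone) F
  ins (suc j) θ (edge i F) = ins (pinch i j) (θ ∘ edge (punchIn j i)) F

  data Odd : Set where
    L G : Odd

  put : Odd → ∀ {n} → Face n → Face (suc n)
  put L = loop
  put G = gone

  -- The sign counts the odd letters (loops, gone vertices and edges) in front of the insertion.
  insˢ : Odd → ∀ {n} → Fin (suc n) → Fun (suc n) → Fun n
  insˢ s zero θ F = θ (put s F)
  insˢ s (suc j) θ (free F) = insˢ s j (θ ∘ free) F
  insˢ s (suc j) θ (loop F) = ⊟ insˢ s j (θ ∘ loop) F
  insˢ s (suc j) θ (gone F) = ⊟ insˢ s j (θ ∘ gone) F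
  insˢ s (suc j) θ (edge i F) = ⊟ insˢ s (pinch i j) (θ ∘ edge (punchIn j i)) F

  -- ∂* is the transpose of the boundary, for which a loop is a vertex of the complex just like an edge,
  -- and D* that of the map turning one loop at a time into a gone vertex: it commutes with ∂*, and
  -- D*³ = 0 in characteristic 3. H* is a homotopy from the identity to E*, whose values vanish on every
  -- face with a free or a looped vertex.
  ∂* D* H* E* : ∀ {n} → Fun n → Fun n

  ∂* θ nil = 0₃
  ∂* θ (free F) = ∂* (θ ∘ free) F
  ∂* θ (loop F) = θ (free F) ⊞ ⊟ ∂* (θ ∘ loop) F
  ∂* θ (gone F) = ⊟ ∂* (θ ∘ gone) F
  ∂* θ (edge j F) = ins j (θ ∘ free) F ⊞ ⊟ ∂* (θ ∘ edge j) F

  D* θ nil = 0₃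
  D* θ (free F) = D* (θ ∘ free) F
  D* θ (loop F) = θ (gone F) ⊞ D* (θ ∘ loop) F
  D* θ (gone F) = D* (θ ∘ gone) F
  D* θ (edge j F) = D* (θ ∘ edge j) F

  H* θ nil = 0₃
  H* θ (free F) = θ (loop F)
  H* θ (loop F) = 0₃
  H* θ (gone F) = ⊟ H* (θ ∘ gone) F
  H* θ (edge j F) = H* (ins j (θ ∘ loop)) F ⊞ ⊟ H* (θ ∘ edge j) F

  E* θ nil = θ nil
  E* θ (free F) = 0₃
  E* θ (loop F) = 0₃
  E* θ (gone F) = E* (θ ∘ gone) F
  E* θ (edge j F) = E* (θ ∘ edge j) F ⊞ ⊟ E* (ins j (θ ∘ loop)) F

  ins-lin : ∀ {n} (j : Fin (suc n)) → Linear (ins j)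
  ins-lin j = record { cong≗ = co j ; add = ad j ; neg≗ = ne j }
    where
    co : ∀ {n} (j : Fin (suc n)) {θ η : Fun (suc n)} → θ ≗′ η → ins j θ ≗′ ins j η
    co zero e F = e (free F)
    co (suc j) e (free F) = co j (e ∘ free) F
    co (suc j) e (loop F) = co j (e ∘ loop) F
    co (suc j) e (gone F) = co j (e ∘ gone) F
    co (suc j) e (edge i F) = co (pinch i j) (e ∘ edge _) F
    ad : ∀ {n} (j : Fin (suc n)) (θ η : Fun (suc n)) → ins j (θ ⊕′ η) ≗′ ins j θ ⊕′ ins j η
    ad zero θ η F = refl
    ad (suc j) θ η (free F) = ad j (θ ∘ free) (η ∘ free) F
    ad (suc j) θ η (loop F) = ad j (θ ∘ loop) (η ∘ loop) F
    ad (suc j) θ η (gone F) = ad j (θ ∘ gone) (η ∘ gone) F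
    ad (suc j) θ η (edge i F) = ad (pinch i j) (θ ∘ edge _) (η ∘ edge _) F
    ne : ∀ {n} (j : Fin (suc n)) (θ : Fun (suc n)) → ins j (⊖ θ) ≗′ ⊖ ins j θ
    ne zero θ F = refl
    ne (suc j) θ (free F) = ne j (θ ∘ free) F
    ne (suc j) θ (loop F) = ne j (θ ∘ loop) F
    ne (suc j) θ (gone F) = ne j (θ ∘ gone) F
    ne (suc j) θ (edge i F) = ne (pinch i j) (θ ∘ edge _) F

  insˢ-lin : ∀ s {n} (j : Fin (suc n)) → Linear (insˢ s j)
  insˢ-lin s j = record { cong≗ = co j ; add = ad j ; neg≗ = ne j }
    where
    co : ∀ {n} (j : Fin (suc n)) {θ η : Fun (suc n)} → θ ≗′ η → insˢ s j θ ≗′ insˢ s j η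
    co zero e F = e (put s F)
    co (suc j) e (free F) = co j (e ∘ free) F
    co (suc j) e (loop F) = cong ⊟_ (co j (e ∘ loop) F)
    co (suc j) e (gone F) = cong ⊟_ (co j (e ∘ gone) F)
    co (suc j) e (edge i F) = cong ⊟_ (co (pinch i j) (e ∘ edge _) F)
    ad : ∀ {n} (j : Fin (suc n)) (θ η : Fun (suc n)) → insˢ s j (θ ⊕′ η) ≗′ insˢ s j θ ⊕′ insˢ s j η
    ad zero θ η F = refl
    ad (suc j) θ η (free F) = ad j (θ ∘ free) (η ∘ free) F
    ad (suc j) θ η (loop F) = trans (cong ⊟_ (ad j (θ ∘ loop) (η ∘ loop) F)) (⊟-⊞ _ _)
    ad (suc j) θ η (gone F) = trans (cong ⊟_ (ad j (θ ∘ gone) (η ∘ gone) F)) (⊟-⊞ _ _)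
    ad (suc j) θ η (edge i F) = trans (cong ⊟_ (ad (pinch i j) (θ ∘ edge _) (η ∘ edge _) F)) (⊟-⊞ _ _)
    ne : ∀ {n} (j : Fin (suc n)) (θ : Fun (suc n)) → insˢ s j (⊖ θ) ≗′ ⊖ insˢ s j θ
    ne zero θ F = refl
    ne (suc j) θ (free F) = ne j (θ ∘ free) F
    ne (suc j) θ (loop F) = cong ⊟_ (ne j (θ ∘ loop) F)
    ne (suc j) θ (gone F) = cong ⊟_ (ne j (θ ∘ gone) F)
    ne (suc j) θ (edge i F) = cong ⊟_ (ne (pinch i j) (θ ∘ edge _) F)

  ∂*-lin : ∀ {n} → Linear (∂* {n})
  ∂*-lin = record { cong≗ = co ; add = ad ; neg≗ = ne }
    where
    co : ∀ {n} {θ η : Fun n} → θ ≗′ η → ∂* θ ≗′ ∂* η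
    co e nil = refl
    co e (free F) = co (e ∘ free) F
    co e (loop F) = cong₂ (λ a b → a ⊞ ⊟ b) (e (free F)) (co (e ∘ loop) F)
    co e (gone F) = cong ⊟_ (co (e ∘ gone) F)
    co e (edge j F) = cong₂ (λ a b → a ⊞ ⊟ b) (cong≗ (ins-lin j) (e ∘ free) F) (co (e ∘ edge j) F)
    ad : ∀ {n} (θ η : Fun n) → ∂* (θ ⊕′ η) ≗′ ∂* θ ⊕′ ∂* η
    ad θ η nil = sym 0⊞0
    ad θ η (free F) = ad (θ ∘ free) (η ∘ free) F
    ad θ η (loop F) = trans (cong₂ (λ a b → a ⊞ ⊟ b) refl (ad (θ ∘ loop) (η ∘ loop) F)) (interchange⁻ _ _ _ _)
    ad θ η (gone F) = trans (cong ⊟_ (ad (θ ∘ gone) (η ∘ gone) F)) (⊟-⊞ _ _)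
    ad θ η (edge j F) = trans (cong₂ (λ a b → a ⊞ ⊟ b) (add (ins-lin j) (θ ∘ free) (η ∘ free) F)
      (ad (θ ∘ edge j) (η ∘ edge j) F)) (interchange⁻ _ _ _ _)
    ne : ∀ {n} (θ : Fun n) → ∂* (⊖ θ) ≗′ ⊖ ∂* θ
    ne θ nil = sym ⊟0
    ne θ (free F) = ne (θ ∘ free) F
    ne θ (loop F) = trans (cong₂ (λ a b → a ⊞ ⊟ b) refl (ne (θ ∘ loop) F)) (⊟-⊞⊟ _ _)
    ne θ (gone F) = cong ⊟_ (ne (θ ∘ gone) F)
    ne θ (edge j F) = trans (cong₂ (λ a b → a ⊞ ⊟ b) (neg≗ (ins-lin j) (θ ∘ free) F) (ne (θ ∘ edge j) F)) (⊟-⊞⊟ _ _)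

  D*-lin : ∀ {n} → Linear (D* {n})
  D*-lin = record { cong≗ = co ; add = ad ; neg≗ = ne }
    where
    co : ∀ {n} {θ η : Fun n} → θ ≗′ η → D* θ ≗′ D* η
    co e nil = refl
    co e (free F) = co (e ∘ free) F
    co e (loop F) = cong₂ _⊞_ (e (gone F)) (co (e ∘ loop) F)
    co e (gone F) = co (e ∘ gone) F
    co e (edge j F) = co (e ∘ edge j) F
    ad : ∀ {n} (θ η : Fun n) → D* (θ ⊕′ η) ≗′ D* θ ⊕′ D* η
    ad θ η nil = sym 0⊞0
    ad θ η (free F) = ad (θ ∘ free) (η ∘ free) F
    ad θ η (loop F) = trans (cong₂ _⊞_ refl (ad (θ ∘ loop) (η ∘ loop) F)) (interchange _ _ _ _)
    ad θ η (gone F) = ad (θ ∘ gone) (η ∘ gone) F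
    ad θ η (edge j F) = ad (θ ∘ edge j) (η ∘ edge j) F
    ne : ∀ {n} (θ : Fun n) → D* (⊖ θ) ≗′ ⊖ D* θ
    ne θ nil = sym ⊟0
    ne θ (free F) = ne (θ ∘ free) F
    ne θ (loop F) = trans (cong₂ _⊞_ refl (ne (θ ∘ loop) F)) (sym (⊟-⊞ _ _))
    ne θ (gone F) = ne (θ ∘ gone) F
    ne θ (edge j F) = ne (θ ∘ edge j) F

  H*-lin : ∀ {n} → Linear (H* {n})
  H*-lin = record { cong≗ = co ; add = ad ; neg≗ = ne }
    where
    co : ∀ {n} {θ η : Fun n} → θ ≗′ η → H* θ ≗′ H* η
    co e nil = refl
    co e (free F) = e (loop F)
    co e (loop F) = refl
    co e (gone F) = cong ⊟_ (co (e ∘ gone) F)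
    co e (edge j F) = cong₂ (λ a b → a ⊞ ⊟ b) (co (cong≗ (ins-lin j) (e ∘ loop)) F) (co (e ∘ edge j) F)
    ad : ∀ {n} (θ η : Fun n) → H* (θ ⊕′ η) ≗′ H* θ ⊕′ H* η
    ad θ η nil = sym 0⊞0
    ad θ η (free F) = refl
    ad θ η (loop F) = sym 0⊞0
    ad θ η (gone F) = trans (cong ⊟_ (ad (θ ∘ gone) (η ∘ gone) F)) (⊟-⊞ _ _)
    ad θ η (edge j F) = trans (cong₂ (λ a b → a ⊞ ⊟ b)
        (trans (co (add (ins-lin j) (θ ∘ loop) (η ∘ loop)) F) (ad (ins j (θ ∘ loop)) (ins j (η ∘ loop)) F))
        (ad (θ ∘ edge j) (η ∘ edge j) F)) (interchange⁻ _ _ _ _)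
    ne : ∀ {n} (θ : Fun n) → H* (⊖ θ) ≗′ ⊖ H* θ
    ne θ nil = sym ⊟0
    ne θ (free F) = refl
    ne θ (loop F) = sym ⊟0
    ne θ (gone F) = cong ⊟_ (ne (θ ∘ gone) F)
    ne θ (edge j F) = trans (cong₂ (λ a b → a ⊞ ⊟ b)
        (trans (co (neg≗ (ins-lin j) (θ ∘ loop)) F) (ne (ins j (θ ∘ loop)) F))
        (ne (θ ∘ edge j) F)) (⊟-⊞⊟ _ _)

  E*-lin : ∀ {n} → Linear (E* {n})
  E*-lin = record { cong≗ = co ; add = ad ; neg≗ = ne }
    where
    co : ∀ {n} {θ η : Fun n} → θ ≗′ η → E* θ ≗′ E* η
    co e nil = e nil
    co e (free F) = refl
    co e (loop F) = refl
    co e (gone F) = co (e ∘ gone) F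
    co e (edge j F) = cong₂ (λ a b → a ⊞ ⊟ b) (co (e ∘ edge j) F) (co (cong≗ (ins-lin j) (e ∘ loop)) F)
    ad : ∀ {n} (θ η : Fun n) → E* (θ ⊕′ η) ≗′ E* θ ⊕′ E* η
    ad θ η nil = refl
    ad θ η (free F) = sym 0⊞0
    ad θ η (loop F) = sym 0⊞0
    ad θ η (gone F) = ad (θ ∘ gone) (η ∘ gone) F
    ad θ η (edge j F) = trans (cong₂ (λ a b → a ⊞ ⊟ b) (ad (θ ∘ edge j) (η ∘ edge j) F)
        (trans (co (add (ins-lin j) (θ ∘ loop) (η ∘ loop)) F) (ad (ins j (θ ∘ loop)) (ins j (η ∘ loop)) F)))
        (interchange⁻ _ _ _ _)
    ne : ∀ {n} (θ : Fun n) → E* (⊖ θ) ≗′ ⊖ E* θ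
    ne θ nil = refl
    ne θ (free F) = sym ⊟0
    ne θ (loop F) = sym ⊟0
    ne θ (gone F) = ne (θ ∘ gone) F
    ne θ (edge j F) = trans (cong₂ (λ a b → a ⊞ ⊟ b) (ne (θ ∘ edge j) F)
        (trans (co (neg≗ (ins-lin j) (θ ∘ loop)) F) (ne (ins j (θ ∘ loop)) F))) (⊟-⊞⊟ _ _)

  -- Exchange laws for insertions, and the homotopy formula

  punchIn-punchIn : ∀ {k} (i : Fin (suc (suc k))) (j : Fin (suc (suc (suc k)))) (l : Fin (suc k)) →
    punchIn j (punchIn i l) ≡ punchIn (punchIn j i) (punchIn (pinch i j) l)
  punchIn-punchIn zero zero l = refl
  punchIn-punchIn zero (suc j) l = refl
  punchIn-punchIn (suc i) zero l = refl
  punchIn-punchIn (suc i) (suc j) zero = refl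
  punchIn-punchIn {suc k} (suc i) (suc j) (suc l) = cong suc (punchIn-punchIn i j l)

  pinch-pinch : ∀ {k} (i : Fin (suc (suc k))) (j : Fin (suc (suc (suc k)))) (l : Fin (suc k)) →
    pinch (pinch l i) (pinch (punchIn i l) j) ≡ pinch l (pinch i j)
  pinch-pinch zero zero l = refl
  pinch-pinch zero (suc j) zero = refl
  pinch-pinch zero (suc j) (suc l) = refl
  pinch-pinch (suc i) zero zero = refl
  pinch-pinch (suc i) zero (suc l) = refl
  pinch-pinch (suc i) (suc j) zero = refl
  pinch-pinch {suc k} (suc i) (suc j) (suc l) = cong suc (pinch-pinch i j l)

  punchIn-pinch : ∀ {k} (i : Fin (suc (suc k))) (j : Fin (suc (suc (suc k)))) (l : Fin (suc k)) →
    punchIn (pinch (punchIn i l) j) (pinch l i) ≡ pinch (punchIn (pinch i j) l) (punchIn j i)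
  punchIn-pinch zero zero zero = refl
  punchIn-pinch zero zero (suc l) = refl
  punchIn-pinch zero (suc zero) zero = refl
  punchIn-pinch zero (suc (suc j)) zero = refl
  punchIn-pinch zero (suc zero) (suc l) = refl
  punchIn-pinch zero (suc (suc j)) (suc l) = refl
  punchIn-pinch (suc i) zero zero = refl
  punchIn-pinch (suc i) zero (suc l) = refl
  punchIn-pinch (suc i) (suc j) zero = refl
  punchIn-pinch {suc k} (suc i) (suc j) (suc l) = cong suc (punchIn-pinch i j l)

  -- Whichever of two vertices is inserted second shifts the position of the other. In the edge case
  -- the partner is a third position, and the three lemmas above are the exchange laws for the three
  -- of them.
  ins-ins : ∀ {n} (i : Fin (suc n)) (j : Fin (suc (suc n))) (ξ : Fun (suc (suc n))) →
    ins i (ins j ξ) ≗′ ins (pinch i j) (ins (punchIn j i) ξ)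
  ins-ins zero zero ξ F = refl
  ins-ins zero (suc j) ξ F = refl
  ins-ins (suc i) zero ξ F = refl
  ins-ins (suc i) (suc j) ξ (free F) = ins-ins i j (ξ ∘ free) F
  ins-ins (suc i) (suc j) ξ (loop F) = ins-ins i j (ξ ∘ loop) F
  ins-ins (suc i) (suc j) ξ (gone F) = ins-ins i j (ξ ∘ gone) F
  ins-ins (suc i) (suc j) ξ (edge l F)
    rewrite punchIn-punchIn i j l
          | sym (pinch-pinch i j l)
          | sym (punchIn-pinch i j l) = ins-ins (pinch l i) (pinch (punchIn i l) j) _ F

  ins-insˢ : ∀ s {n} (i : Fin (suc n)) (j : Fin (suc (suc n))) (ξ : Fun (suc (suc n))) →
    ins i (insˢ s j ξ) ≗′ insˢ s (pinch i j) (ins (punchIn j i) ξ)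
  ins-insˢ L zero zero ξ F = refl
  ins-insˢ G zero zero ξ F = refl
  ins-insˢ s zero (suc j) ξ F = refl
  ins-insˢ L (suc i) zero ξ F = refl
  ins-insˢ G (suc i) zero ξ F = refl
  ins-insˢ s (suc i) (suc j) ξ (free F) = ins-insˢ s i j (ξ ∘ free) F
  ins-insˢ s (suc i) (suc j) ξ (loop F) =
    trans (neg≗ (ins-lin i) (insˢ s j (ξ ∘ loop)) F) (cong ⊟_ (ins-insˢ s i j (ξ ∘ loop) F))
  ins-insˢ s (suc i) (suc j) ξ (gone F) =
    trans (neg≗ (ins-lin i) (insˢ s j (ξ ∘ gone)) F) (cong ⊟_ (ins-insˢ s i j (ξ ∘ gone) F))
  ins-insˢ s (suc i) (suc j) ξ (edge l F)
    rewrite punchIn-punchIn i j l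
          | sym (pinch-pinch i j l)
          | sym (punchIn-pinch i j l) =
    trans (neg≗ (ins-lin (pinch l i)) (insˢ s (pinch (punchIn i l) j) _) F)
          (cong ⊟_ (ins-insˢ s (pinch l i) (pinch (punchIn i l) j) _ F))

  sub : ∀ {k n} {f : Fun k → Fun n} → Linear f → ∀ θ η → f (θ ⊕′ ⊖ η) ≗′ f θ ⊕′ ⊖ f η
  sub l θ η F = trans (add l θ (⊖ η) F) (cong₂ _⊞_ refl (neg≗ l η F))

  ∂*-ins : ∀ {n} (j : Fin (suc n)) (θ : Fun (suc n)) → ins j (∂* θ) ≗′ ∂* (ins j θ)
  ∂*-ins zero θ F = refl
  ∂*-ins (suc j) θ (free F) = ∂*-ins j (θ ∘ free) F
  ∂*-ins (suc j) θ (loop F) =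
    trans (sub (ins-lin j) (θ ∘ free) (∂* (θ ∘ loop)) F)
          (cong₂ (λ a b → a ⊞ ⊟ b) refl (∂*-ins j (θ ∘ loop) F))
  ∂*-ins (suc j) θ (gone F) =
    trans (neg≗ (ins-lin j) (∂* (θ ∘ gone)) F) (cong ⊟_ (∂*-ins j (θ ∘ gone) F))
  ∂*-ins (suc j) θ (edge i F) =
    trans (sub (ins-lin (pinch i j)) (ins (punchIn j i) (θ ∘ free)) (∂* (θ ∘ edge (punchIn j i))) F)
          (cong₂ (λ a b → a ⊞ ⊟ b) (sym (ins-ins i j (θ ∘ free) F))
            (∂*-ins (pinch i j) (θ ∘ edge (punchIn j i)) F))

  D*-ins : ∀ {n} (j : Fin (suc n)) (θ : Fun (suc n)) → ins j (D* θ) ≗′ D* (ins j θ)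
  D*-ins zero θ F = refl
  D*-ins (suc j) θ (free F) = D*-ins j (θ ∘ free) F
  D*-ins (suc j) θ (loop F) =
    trans (add (ins-lin j) (θ ∘ gone) (D* (θ ∘ loop)) F)
          (cong₂ _⊞_ refl (D*-ins j (θ ∘ loop) F))
  D*-ins (suc j) θ (gone F) = D*-ins j (θ ∘ gone) F
  D*-ins (suc j) θ (edge i F) = D*-ins (pinch i j) (θ ∘ edge (punchIn j i)) F

  -- Deleting the new loop leaves a free vertex; every other deletion commutes with the insertion,
  -- up to the sign of passing one odd letter.
  ∂*-insL : ∀ {n} (j : Fin (suc n)) (ξ : Fun (suc n)) →
    insˢ L j (∂* ξ) ≗′ ins j ξ ⊕′ ⊖ ∂* (insˢ L j ξ)
  ∂*-insL zero ξ F = refl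
  ∂*-insL (suc j) ξ (free F) = ∂*-insL j (ξ ∘ free) F
  ∂*-insL (suc j) ξ (loop F) =
    trans (cong ⊟_ (trans (sub (insˢ-lin L j) (ξ ∘ free) (∂* (ξ ∘ loop)) F)
                          (cong₂ (λ a b → a ⊞ ⊟ b) refl (∂*-insL j (ξ ∘ loop) F))))
    (trans (rearrange₁ _ _ _)
      (cong₂ (λ a b → a ⊞ ⊟ (_⊞_ (insˢ L j (ξ ∘ free) F) (⊟ b))) refl (sym (neg≗ ∂*-lin (insˢ L j (ξ ∘ loop)) F))))
  ∂*-insL (suc j) ξ (gone F) =
    trans (cong ⊟_ (neg≗ (insˢ-lin L j) (∂* (ξ ∘ gone)) F))
    (trans (⊟-involutive _)
    (trans (∂*-insL j (ξ ∘ gone) F)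
      (cong₂ (λ a b → a ⊞ ⊟ b) refl
        (sym (trans (cong ⊟_ (neg≗ ∂*-lin (insˢ L j (ξ ∘ gone)) F)) (⊟-involutive _))))))
  ∂*-insL (suc j) ξ (edge i F) =
    trans (cong ⊟_ (trans (sub (insˢ-lin L (pinch i j)) (ins (punchIn j i) (ξ ∘ free)) (∂* (ξ ∘ edge (punchIn j i))) F)
                          (cong₂ (λ a b → a ⊞ ⊟ b) (sym (ins-insˢ L i j (ξ ∘ free) F))
                            (∂*-insL (pinch i j) (ξ ∘ edge (punchIn j i)) F))))
    (trans (rearrange₁ _ _ _)
      (cong₂ (λ a b → a ⊞ ⊟ (_⊞_ (ins i (insˢ L j (ξ ∘ free)) F) (⊟ b))) refl
        (sym (neg≗ ∂*-lin (insˢ L (pinch i j) (ξ ∘ edge (punchIn j i))) F))))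

  D*-insG : ∀ {n} (j : Fin (suc n)) (ξ : Fun (suc n)) → insˢ G j (D* ξ) ≗′ D* (insˢ G j ξ)
  D*-insG zero ξ F = refl
  D*-insG (suc j) ξ (free F) = D*-insG j (ξ ∘ free) F
  D*-insG (suc j) ξ (loop F) =
    trans (cong ⊟_ (trans (add (insˢ-lin G j) (ξ ∘ gone) (D* (ξ ∘ loop)) F)
                          (cong₂ _⊞_ refl (D*-insG j (ξ ∘ loop) F))))
    (trans (⊟-⊞ _ _) (cong₂ _⊞_ refl (sym (neg≗ D*-lin (insˢ G j (ξ ∘ loop)) F))))
  D*-insG (suc j) ξ (gone F) =
    trans (cong ⊟_ (D*-insG j (ξ ∘ gone) F)) (sym (neg≗ D*-lin (insˢ G j (ξ ∘ gone)) F))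
  D*-insG (suc j) ξ (edge i F) =
    trans (cong ⊟_ (D*-insG (pinch i j) (ξ ∘ edge (punchIn j i)) F))
          (sym (neg≗ D*-lin (insˢ G (pinch i j) (ξ ∘ edge (punchIn j i))) F))

  -- The extra term is the one in which the new loop itself becomes a gone vertex.
  D*-insL : ∀ {n} (j : Fin (suc n)) (ξ : Fun (suc n)) →
    insˢ L j (D* ξ) ≗′ insˢ G j ξ ⊕′ D* (insˢ L j ξ)
  D*-insL zero ξ F = refl
  D*-insL (suc j) ξ (free F) = D*-insL j (ξ ∘ free) F
  D*-insL (suc j) ξ (loop F) =
    trans (cong ⊟_ (trans (add (insˢ-lin L j) (ξ ∘ gone) (D* (ξ ∘ loop)) F)
                          (cong₂ _⊞_ refl (D*-insL j (ξ ∘ loop) F))))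
    (trans (rearrange₂ _ _ _)
      (cong₂ (λ a b → a ⊞ (_⊞_ (⊟ insˢ L j (ξ ∘ gone) F) b)) refl (sym (neg≗ D*-lin (insˢ L j (ξ ∘ loop)) F))))
  D*-insL (suc j) ξ (gone F) =
    trans (cong ⊟_ (D*-insL j (ξ ∘ gone) F))
    (trans (⊟-⊞ _ _) (cong₂ _⊞_ refl (sym (neg≗ D*-lin (insˢ L j (ξ ∘ gone)) F))))
  D*-insL (suc j) ξ (edge i F) =
    trans (cong ⊟_ (D*-insL (pinch i j) (ξ ∘ edge (punchIn j i)) F))
    (trans (⊟-⊞ _ _) (cong₂ _⊞_ refl (sym (neg≗ D*-lin (insˢ L (pinch i j) (ξ ∘ edge (punchIn j i))) F))))

  H*-insG : ∀ {n} (j : Fin (suc n)) (ξ : Fun (suc n)) → insˢ G j (H* ξ) ≗′ ⊖ H* (insˢ G j ξ)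
  H*-insG zero ξ F = refl
  H*-insG (suc j) ξ (free F) = sym (⊟-involutive _)
  H*-insG (suc j) ξ (loop F) = cong ⊟_ (zer (insˢ-lin G j) (λ _ → refl) F)
  H*-insG (suc j) ξ (gone F) = cong ⊟_
    (trans (neg≗ (insˢ-lin G j) (H* (ξ ∘ gone)) F)
    (trans (cong ⊟_ (H*-insG j (ξ ∘ gone) F))
      (cong ⊟_ (sym (neg≗ H*-lin (insˢ G j (ξ ∘ gone)) F)))))
  H*-insG (suc j) ξ (edge i F) = cong ⊟_
    (trans (sub (insˢ-lin G (pinch i j)) (H* (ins (punchIn j i) (ξ ∘ loop))) (H* (ξ ∘ edge (punchIn j i))) F)
    (cong₂ (λ a b → a ⊞ ⊟ b)
      (trans (H*-insG (pinch i j) (ins (punchIn j i) (ξ ∘ loop)) F)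
      (trans (cong ⊟_ (cong≗ H*-lin (λ F → sym (ins-insˢ G i j (ξ ∘ loop) F)) F))
      (trans (sym (neg≗ H*-lin (ins i (insˢ G j (ξ ∘ loop))) F))
             (cong≗ H*-lin (λ F → sym (neg≗ (ins-lin i) (insˢ G j (ξ ∘ loop)) F)) F))))
      (trans (H*-insG (pinch i j) (ξ ∘ edge (punchIn j i)) F)
             (sym (neg≗ H*-lin (insˢ G (pinch i j) (ξ ∘ edge (punchIn j i))) F)))))

  ∂*-D* : ∀ {n} (θ : Fun n) → ∂* (D* θ) ≗′ D* (∂* θ)
  ∂*-D* θ nil = refl
  ∂*-D* θ (free F) = ∂*-D* (θ ∘ free) F
  ∂*-D* θ (loop F) =
    trans (cong₂ (λ a b → a ⊞ ⊟ b) refl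
            (trans (add ∂*-lin (θ ∘ gone) (D* (θ ∘ loop)) F) (cong₂ _⊞_ refl (∂*-D* (θ ∘ loop) F))))
    (trans (rearrange₃ _ _ _)
           (cong₂ _⊞_ refl (sym (sub D*-lin (θ ∘ free) (∂* (θ ∘ loop)) F))))
  ∂*-D* θ (gone F) = trans (cong ⊟_ (∂*-D* (θ ∘ gone) F)) (sym (neg≗ D*-lin (∂* (θ ∘ gone)) F))
  ∂*-D* θ (edge j F) =
    trans (cong₂ (λ a b → a ⊞ ⊟ b) (D*-ins j (θ ∘ free) F) (∂*-D* (θ ∘ edge j) F))
          (sym (sub D*-lin (ins j (θ ∘ free)) (∂* (θ ∘ edge j)) F))

  -- The first loop and a later one are turned in either order, which is why the first summand
  -- occurs twice.
  D*²-loop : ∀ {n} (θ : Fun (suc n)) F →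
    D* (D* θ) (loop F) ≡ D* (θ ∘ gone) F ⊞ (D* (θ ∘ gone) F ⊞ D* (D* (θ ∘ loop)) F)
  D*²-loop θ F = cong₂ _⊞_ refl (add D*-lin (θ ∘ gone) (D* (θ ∘ loop)) F)

  -- Three given loops are turned in 3! orders. In the recursion on the first loop this shows as
  -- three copies of `D* (D* (θ ∘ gone))`.
  D*³ : ∀ {n} (θ : Fun n) F → D* (D* (D* θ)) F ≡ 0₃
  D*³ θ nil = refl
  D*³ θ (free F) = D*³ (θ ∘ free) F
  D*³ θ (loop F) =
    trans (D*²-loop (D* θ) F)
    (trans (cong₂ (λ a b → a ⊞ (a ⊞ b)) refl
       (trans (trans (cong≗ D*-lin (add D*-lin (θ ∘ gone) (D* (θ ∘ loop))) F)
                     (add D*-lin (D* (θ ∘ gone)) (D* (D* (θ ∘ loop))) F))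
              (cong₂ _⊞_ refl (D*³ (θ ∘ loop) F))))
    (triple⁰ (D* (D* (θ ∘ gone)) F)))
  D*³ θ (gone F) = D*³ (θ ∘ gone) F
  D*³ θ (edge j F) = D*³ (θ ∘ edge j) F

  -- A free first vertex is coned off by a loop. An edge is compared with the face that has a loop
  -- at its first end and nothing at the second: deleting the edge or the loop leaves the same face,
  -- so those two terms cancel, and induction applies both to this replacement and to the edge
  -- itself.
  homotopy : ∀ {n} (θ : Fun n) F → (H* (∂* θ) F ⊞ ∂* (H* θ) F) ⊞ E* θ F ≡ θ F
  homotopy θ nil = trans (cong (_⊞ θ nil) 0⊞0) (⊞-identityˡ _)
  homotopy θ (free F) = cancel₁ _ _
  homotopy θ (loop F) =
    trans (cong₂ (λ a b → (0₃ ⊞ (a ⊞ ⊟ b)) ⊞ 0₃) refl (zer ∂*-lin (λ _ → refl) F)) (cancel₂ _)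
  homotopy θ (gone F) = trans (cong (_⊞ E* (θ ∘ gone) F) (cong₂ _⊞_
      (trans (cong ⊟_ (neg≗ H*-lin (∂* (θ ∘ gone)) F)) (⊟-involutive _))
      (trans (cong ⊟_ (neg≗ ∂*-lin (H* (θ ∘ gone)) F)) (⊟-involutive _))))
    (homotopy (θ ∘ gone) F)
  homotopy θ (edge j F) =
    trans (cong (_⊞ E* θ (edge j F)) (cong₂ _⊞_
      (cong₂ (λ a b → a ⊞ ⊟ b)
        (trans (cong≗ H*-lin (λ F → trans (sub (ins-lin j) (θ ∘ free) (∂* (θ ∘ loop)) F)
                 (cong₂ (λ a b → a ⊞ ⊟ b) refl (∂*-ins j (θ ∘ loop) F))) F)
               (sub H*-lin (ins j (θ ∘ free)) (∂* (ins j (θ ∘ loop))) F))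
        (sub H*-lin (ins j (θ ∘ free)) (∂* (θ ∘ edge j)) F))
      (cong₂ (λ a b → a ⊞ ⊟ b) (sym (homotopy (ins j (θ ∘ loop)) F))
        (sub ∂*-lin (H* (ins j (θ ∘ loop))) (H* (θ ∘ edge j)) F))))
    (trans (homotopy-law (H* (∂* (θ ∘ edge j)) F) _ _ _ _ _ _) (homotopy (θ ∘ edge j) F))

  -- On an edge, `E*` subtracts the looped replacement. Removing the edge from the one and the loop
  -- from the other leaves the same two free vertices, so both terms equal
  -- `E* (ins j (θ ∘ free)) F`.
  E*-∂* : ∀ {n} (θ : Fun n) F → E* (∂* θ) F ≡ 0₃
  E*-∂* θ nil = refl
  E*-∂* θ (free F) = refl
  E*-∂* θ (loop F) = refl
  E*-∂* θ (gone F) = trans (neg≗ E*-lin (∂* (θ ∘ gone)) F) (trans (cong ⊟_ (E*-∂* (θ ∘ gone) F)) ⊟0)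
  E*-∂* θ (edge j F) =
    trans (cong₂ (λ a b → a ⊞ ⊟ b)
      (trans (sub E*-lin (ins j (θ ∘ free)) (∂* (θ ∘ edge j)) F)
             (cong₂ (λ a b → a ⊞ ⊟ b) refl (E*-∂* (θ ∘ edge j) F)))
      (trans (cong≗ E*-lin (λ F → trans (sub (ins-lin j) (θ ∘ free) (∂* (θ ∘ loop)) F)
                 (cong₂ (λ a b → a ⊞ ⊟ b) refl (∂*-ins j (θ ∘ loop) F))) F)
      (trans (sub E*-lin (ins j (θ ∘ free)) (∂* (ins j (θ ∘ loop))) F)
             (cong₂ (λ a b → a ⊞ ⊟ b) refl (E*-∂* (ins j (θ ∘ loop)) F)))))
      (⊞-inverseʳ _)

  -- Homogeneous cochains

  open import Data.Integer using () renaming (pred to predℤ)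
  open import Data.Integer.Properties using (pred-suc; suc-pred)

  infixr 9 _∘ˡ_
  _∘ˡ_ : ∀ {k l n} {f : Fun l → Fun n} {g : Fun k → Fun l} → Linear f → Linear g → Linear (f ∘ g)
  _∘ˡ_ {g = g} lf lg = record
    { cong≗ = λ e → cong≗ lf (cong≗ lg e)
    ; add = λ θ η F → trans (cong≗ lf (add lg θ η) F) (add lf (g θ) (g η) F)
    ; neg≗ = λ θ F → trans (cong≗ lf (neg≗ lg θ) F) (neg≗ lf (g θ) F) }

  -- Loops minus free vertices. Turning a loop into a gone vertex lowers it by 1, and deleting a
  -- loop or an edge lowers it by 2; thus `D*` raises the weight of a cochain by 1 and `H*`, which
  -- goes against the boundary, lowers it by 2.
  wt : ∀ {n} → Face n → ℤ
  wt nil = 0ℤ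
  wt (free F) = predℤ (wt F)
  wt (loop F) = sucℤ (wt F)
  wt (gone F) = wt F
  wt (edge _ F) = wt F

  Homog : ∀ {n} → ℤ → Fun n → Set
  Homog w θ = ∀ F → wt F ≡ w ⊎ θ F ≡ 0₃

  homog-free : ∀ {n w} {θ : Fun (suc n)} → Homog w θ → Homog (sucℤ w) (θ ∘ free)
  homog-free h F with h (free F)
  ... | inj₁ e = inj₁ (trans (sym (suc-pred (wt F))) (cong sucℤ e))
  ... | inj₂ e = inj₂ e

  homog-loop : ∀ {n w} {θ : Fun (suc n)} → Homog w θ → Homog (predℤ w) (θ ∘ loop)
  homog-loop h F with h (loop F)
  ... | inj₁ e = inj₁ (trans (sym (pred-suc (wt F))) (cong predℤ e))
  ... | inj₂ e = inj₂ e

  homog-ins : ∀ {n w} (j : Fin (suc n)) {θ : Fun (suc n)} → Homog w θ → Homog (sucℤ w) (ins j θ)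
  homog-ins zero h F = homog-free h F
  homog-ins {w = w} (suc j) h (free F) with homog-ins j (homog-free h) F
  ... | inj₁ e = inj₁ (trans (cong predℤ e) (pred-suc (sucℤ w)))
  ... | inj₂ e = inj₂ e
  homog-ins {w = w} (suc j) h (loop F) with homog-ins j (homog-loop h) F
  ... | inj₁ e = inj₁ (cong sucℤ (trans e (suc-pred w)))
  ... | inj₂ e = inj₂ e
  homog-ins (suc j) h (gone F) = homog-ins j (h ∘ gone) F
  homog-ins (suc j) h (edge i F) = homog-ins (pinch i j) (h ∘ edge (punchIn j i)) F

  homog-insloop : ∀ {n w} (j : Fin (suc n)) {θ : Fun (suc (suc n))} → Homog w θ →
    Homog w (ins j (θ ∘ loop))
  homog-insloop {w = w} j h F with homog-ins j (homog-loop h) F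
  ... | inj₁ e = inj₁ (trans e (suc-pred w))
  ... | inj₂ e = inj₂ e

  homog-D : ∀ {n w} {θ : Fun n} → Homog w θ → Homog (sucℤ w) (D* θ)
  homog-D h nil = inj₂ refl
  homog-D {w = w} h (free F) with homog-D (homog-free h) F
  ... | inj₁ e = inj₁ (trans (cong predℤ e) (pred-suc (sucℤ w)))
  ... | inj₂ e = inj₂ e
  homog-D {w = w} h (loop F) with h (gone F) | homog-D (homog-loop h) F
  ... | inj₁ e | _ = inj₁ (cong sucℤ e)
  ... | inj₂ _ | inj₁ e = inj₁ (cong sucℤ (trans e (suc-pred w)))
  ... | inj₂ e | inj₂ e′ = inj₂ (trans (cong₂ _⊞_ e e′) 0⊞0)
  homog-D h (gone F) = homog-D (h ∘ gone) F
  homog-D h (edge j F) = homog-D (h ∘ edge j) F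

  homog-H : ∀ {n w} {θ : Fun n} → Homog w θ → Homog (predℤ (predℤ w)) (H* θ)
  homog-H h nil = inj₂ refl
  homog-H h (free F) with h (loop F)
  ... | inj₁ e = inj₁ (cong predℤ (trans (sym (pred-suc (wt F))) (cong predℤ e)))
  ... | inj₂ e = inj₂ e
  homog-H h (loop F) = inj₂ refl
  homog-H h (gone F) with homog-H (h ∘ gone) F
  ... | inj₁ e = inj₁ e
  ... | inj₂ e = inj₂ (trans (cong ⊟_ e) ⊟0)
  homog-H h (edge j F) with homog-H (homog-insloop j h) F | homog-H (h ∘ edge j) F
  ... | inj₁ e | _ = inj₁ e
  ... | inj₂ _ | inj₁ e = inj₁ e
  ... | inj₂ e | inj₂ e′ = inj₂ (trans (cong₂ (λ a b → a ⊞ ⊟ b) e e′) (⊞-inverseʳ 0₃))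

  homog-E : ∀ {n} (θ : Fun n) → Homog 0ℤ (E* θ)
  homog-E θ nil = inj₁ refl
  homog-E θ (free F) = inj₂ refl
  homog-E θ (loop F) = inj₂ refl
  homog-E θ (gone F) = homog-E (θ ∘ gone) F
  homog-E θ (edge j F) with homog-E (θ ∘ edge j) F | homog-E (ins j (θ ∘ loop)) F
  ... | inj₁ e | _ = inj₁ e
  ... | inj₂ _ | inj₁ e = inj₁ e
  ... | inj₂ e | inj₂ e′ = inj₂ (trans (cong₂ (λ a b → a ⊞ ⊟ b) e e′) (⊞-inverseʳ 0₃))

  -- The recursion of `E*` ends at `nil`, of weight 0, and its corrections keep the weight, since
  -- they trade an edge for one loop and one free vertex.
  E*-homog : ∀ {n w} {θ : Fun n} → Homog w θ → w ≢ 0ℤ → ∀ F → E* θ F ≡ 0₃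
  E*-homog h w≢0 nil with h nil
  ... | inj₁ e = ⊥-elim (w≢0 (sym e))
  ... | inj₂ e = e
  E*-homog h w≢0 (free F) = refl
  E*-homog h w≢0 (loop F) = refl
  E*-homog h w≢0 (gone F) = E*-homog (h ∘ gone) w≢0 F
  E*-homog h w≢0 (edge j F) =
    trans (cong₂ (λ a b → a ⊞ ⊟ b) (E*-homog (h ∘ edge j) w≢0 F) (E*-homog (homog-insloop j h) w≢0 F))
          (⊞-inverseʳ 0₃)

  -- The zigzag and its obstructions

  ev : ∀ {n} → Fun n
  ev nil = 1₃
  ev (gone F) = ev F
  ev (free F) = 0₃
  ev (loop F) = 0₃
  ev (edge j F) = 0₃

  -- The zigzag ∂* λᵉᵢ = D* λᵒᵢ, ∂* λᵒᵢ₊₁ = D*² λᵉᵢ: as D*³ = 0, each right-hand side is closed,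
  -- and H* solves the equation once E* kills it.
  λᵒ λᵉ : ℕ → ∀ {n} → Fun n
  λᵒ zero = ev
  λᵒ (suc i) = H* (D* (D* (λᵉ i)))
  λᵉ i = H* (D* (λᵒ i))

  weight : ℕ → ℤ
  weight zero = 0ℤ
  weight (suc i) = predℤ (weight i)

  homog-λᵒ : ∀ i {n} → Homog (weight i) (λᵒ i {n})
  homog-λᵉ : ∀ i {n} → Homog (weight (suc i)) (λᵉ i {n})
  homog-λᵒ zero nil = inj₁ refl
  homog-λᵒ zero (free F) = inj₂ refl
  homog-λᵒ zero (loop F) = inj₂ refl
  homog-λᵒ zero (gone F) = homog-λᵒ zero F
  homog-λᵒ zero (edge x F) = inj₂ refl
  homog-λᵒ (suc i) F with homog-H (homog-D (homog-D (homog-λᵉ i))) F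
  ... | inj₁ e = inj₁ (trans e (trans (cong predℤ (pred-suc (sucℤ (weight (suc i))))) (pred-suc (weight (suc i)))))
  ... | inj₂ e = inj₂ e
  homog-λᵉ i F with homog-H (homog-D (homog-λᵒ i)) F
  ... | inj₁ e = inj₁ (trans e (cong predℤ (pred-suc (weight i))))
  ... | inj₂ e = inj₂ e

  weight-suc : ∀ i → weight (suc i) ≡ -[1+ i ]
  weight-suc zero = refl
  weight-suc (suc i) = cong predℤ (weight-suc i)

  ∂*-H* : ∀ {n} {θ : Fun n} → (∀ F → ∂* θ F ≡ 0₃) → (∀ F → E* θ F ≡ 0₃) → ∂* (H* θ) ≗′ θ
  ∂*-H* {θ = θ} c v F = trans (sym (trans (cong₂ (λ a b → (a ⊞ ∂* (H* θ) F) ⊞ b)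
    (zer H*-lin c F) (v F)) (trans (⊞-identityʳ _) (⊞-identityˡ _)))) (homotopy θ F)

  ins-ev : ∀ {n} (j : Fin (suc n)) (F : Face n) → ins j ev F ≡ 0₃
  ins-ev zero F = refl
  ins-ev (suc j) (free F) = zer (ins-lin j) (λ _ → refl) F
  ins-ev (suc j) (loop F) = zer (ins-lin j) (λ _ → refl) F
  ins-ev (suc j) (gone F) = ins-ev j F
  ins-ev (suc j) (edge i F) = zer (ins-lin (pinch i j)) (λ _ → refl) F

  insL-ev : ∀ {n} (j : Fin (suc n)) (F : Face n) → insˢ L j ev F ≡ 0₃
  insL-ev zero F = refl
  insL-ev (suc j) (free F) = zer (insˢ-lin L j) (λ _ → refl) F
  insL-ev (suc j) (loop F) = trans (cong ⊟_ (zer (insˢ-lin L j) (λ _ → refl) F)) ⊟0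
  insL-ev (suc j) (gone F) = trans (cong ⊟_ (insL-ev j F)) ⊟0
  insL-ev (suc j) (edge i F) = trans (cong ⊟_ (zer (insˢ-lin L (pinch i j)) (λ _ → refl) F)) ⊟0

  λ⁰ : ∀ {n} → Fun n
  λ⁰ = λᵉ 0

  λ⁰-free : ∀ {n} (F : Face n) → λ⁰ (free F) ≡ ev F
  λ⁰-free F = trans (cong (ev F ⊞_) (zer D*-lin (λ _ → refl) F)) (⊞-identityʳ _)

  λ⁰-edge : ∀ {n} j (F : Face n) → λ⁰ (edge j F) ≡ 0₃
  λ⁰-edge j F = trans (cong₂ (λ a b → a ⊞ ⊟ b)
    (zer H*-lin (λ F → trans (cong≗ (ins-lin j) λ⁰-free F) (ins-ev j F)) F)
    (zer (H*-lin ∘ˡ D*-lin) (λ _ → refl) F)) (⊞-inverseʳ 0₃)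

  -- `D*` ignores a leading gone vertex and `H*` changes sign across it. A `λᵒ` arises by an even
  -- number of `H*`, a `λᵉ` by an odd number.
  λᵒ-gone : ∀ i {n} (F : Face n) → λᵒ i (gone F) ≡ λᵒ i F
  λᵉ-gone : ∀ i {n} (F : Face n) → λᵉ i (gone F) ≡ ⊟ λᵉ i F
  λᵒ-gone zero F = refl
  λᵒ-gone (suc i) F = trans (cong ⊟_ (trans (cong≗ HDD (λᵉ-gone i) F) (neg≗ HDD (λᵉ i) F))) (⊟-involutive _)
    where HDD = H*-lin ∘ˡ D*-lin ∘ˡ D*-lin
  λᵉ-gone i F = cong ⊟_ (cong≗ (H*-lin ∘ˡ D*-lin) (λᵒ-gone i) F)

  ⊟^ : ∀ {n} → Fin n → F₃ → F₃
  ⊟^ zero x = x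
  ⊟^ (suc j) x = ⊟ ⊟^ j x

  ⊟^0 : ∀ {n} (j : Fin n) → ⊟^ j 0₃ ≡ 0₃
  ⊟^0 zero = refl
  ⊟^0 (suc j) = trans (cong ⊟_ (⊟^0 j)) ⊟0

  ⊟^-lin : ∀ {k l n} {f : Fun k → Fun l} → Linear f → (j : Fin n) (θ : Fun k) →
    f (⊟^ j ∘ θ) ≗′ ⊟^ j ∘ f θ
  ⊟^-lin lf zero θ F = refl
  ⊟^-lin lf (suc j) θ F = trans (neg≗ lf (⊟^ j ∘ θ) F) (cong ⊟_ (⊟^-lin lf j θ F))

  -- `λ⁰` lives on the faces with one free vertex and all others gone; its sign counts the gone
  -- vertices in front of the free one.
  ins-λ⁰ : ∀ {n} (j : Fin (suc n)) → ins j λ⁰ ≗′ ⊟^ j ∘ ev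
  ins-λ⁰ zero F = λ⁰-free F
  ins-λ⁰ (suc j) (free F) =
    trans (trans (cong≗ (ins-lin j) λ⁰-free F) (ins-ev j F)) (sym (⊟^0 (suc j)))
  ins-λ⁰ (suc j) (loop F) = trans (zer (ins-lin j) (λ _ → refl) F) (sym (⊟^0 (suc j)))
  ins-λ⁰ (suc j) (gone F) = trans (cong≗ (ins-lin j) (λᵉ-gone 0) F)
    (trans (neg≗ (ins-lin j) λ⁰ F) (cong ⊟_ (ins-λ⁰ j F)))
  ins-λ⁰ (suc j) (edge i F) =
    trans (zer (ins-lin (pinch i j)) (λ⁰-edge (punchIn j i)) F) (sym (⊟^0 (suc j)))

  insG-ev : ∀ {n} (j : Fin (suc n)) → insˢ G j ev ≗′ ⊟^ j ∘ ev
  insG-ev zero F = refl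
  insG-ev (suc j) (free F) = trans (zer (insˢ-lin G j) (λ _ → refl) F) (sym (⊟^0 (suc j)))
  insG-ev (suc j) (loop F) = cong ⊟_ (trans (zer (insˢ-lin G j) (λ _ → refl) F) (sym (⊟^0 j)))
  insG-ev (suc j) (gone F) = cong ⊟_ (insG-ev j F)
  insG-ev (suc j) (edge i F) =
    cong ⊟_ (trans (zer (insˢ-lin G (pinch i j)) (λ _ → refl) F) (sym (⊟^0 j)))

  HD : ∀ {n} → Linear (H* ∘ D* {n})
  HD = H*-lin ∘ˡ D*-lin

  HDD : ∀ {n} → Linear (H* ∘ D* ∘ D* {n})
  HDD = H*-lin ∘ˡ D*-lin ∘ˡ D*-lin

  insG-λ⁰ : ∀ {n} (j : Fin (suc n)) → insˢ G j λ⁰ ≗′ ⊖ H* (D* (ins j λ⁰))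
  insG-λ⁰ j F = trans (H*-insG j (D* ev) F)
    (cong ⊟_ (trans (cong≗ H*-lin (D*-insG j ev) F)
      (cong≗ HD (λ F → trans (insG-ev j F) (sym (ins-λ⁰ j F))) F)))

  HDins-λ⁰ : ∀ {n} (j : Fin (suc n)) → H* (D* (ins j λ⁰)) ≗′ ⊟^ j ∘ λ⁰
  HDins-λ⁰ j F = trans (cong≗ HD (ins-λ⁰ j) F) (⊟^-lin HD j ev F)

  insL-λ⁰ : ∀ {n} (j : Fin (suc n)) (F : Face n) → insˢ L j λ⁰ F ≡ 0₃
  insL-λ⁰ zero F = refl
  insL-λ⁰ (suc j) (free F) = trans (cong≗ (insˢ-lin L j) λ⁰-free F) (insL-ev j F)
  insL-λ⁰ (suc j) (loop F) = trans (cong ⊟_ (zer (insˢ-lin L j) (λ _ → refl) F)) ⊟0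
  insL-λ⁰ (suc j) (gone F) = trans (cong ⊟_ (trans (cong≗ (insˢ-lin L j) (λᵉ-gone 0) F)
    (trans (neg≗ (insˢ-lin L j) λ⁰ F) (cong ⊟_ (insL-λ⁰ j F))))) (trans (⊟-involutive 0₃) refl)
  insL-λ⁰ (suc j) (edge i F) =
    trans (cong ⊟_ (zer (insˢ-lin L (pinch i j)) (λ⁰-edge (punchIn j i)) F)) ⊟0

  -- The first stage of `E*` at an edge, split off because it anticommutes with `∂*` and commutes
  -- with `D*` up to an insertion. This allows the zigzag equations to be used underneath it.
  κ : ∀ {n} → Fin (suc n) → Fun (suc (suc n)) → Fun n
  κ j ξ = (ξ ∘ edge j) ⊕′ ⊖ ins j (ξ ∘ loop)

  E*-edge : ∀ {n} (θ : Fun (suc (suc n))) j F → E* θ (edge j F) ≡ E* (κ j θ) F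
  E*-edge θ j F = sym (sub E*-lin (θ ∘ edge j) (ins j (θ ∘ loop)) F)

  κ-cong : ∀ {n} (j : Fin (suc n)) {ξ η} → ξ ≗′ η → κ j ξ ≗′ κ j η
  κ-cong j e F = cong₂ (λ a b → a ⊞ ⊟ b) (e (edge j F)) (cong≗ (ins-lin j) (e ∘ loop) F)

  κ-∂* : ∀ {n} (j : Fin (suc n)) ξ → κ j (∂* ξ) ≗′ ⊖ ∂* (κ j ξ)
  κ-∂* j ξ F = trans (cong₂ (λ a b → a ⊞ ⊟ b) refl
    (trans (sub (ins-lin j) (ξ ∘ free) (∂* (ξ ∘ loop)) F)
           (cong₂ (λ a b → a ⊞ ⊟ b) refl (∂*-ins j (ξ ∘ loop) F))))
    (trans (cancel₃ _ _ _) (trans (sym (⊟-sub _ _))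
      (cong ⊟_ (sym (sub ∂*-lin (ξ ∘ edge j) (ins j (ξ ∘ loop)) F)))))

  κ-D* : ∀ {n} (j : Fin (suc n)) ξ → κ j (D* ξ) ≗′ D* (κ j ξ) ⊕′ ⊖ ins j (ξ ∘ gone)
  κ-D* j ξ F = trans (cong₂ (λ a b → a ⊞ ⊟ b) refl
    (trans (add (ins-lin j) (ξ ∘ gone) (D* (ξ ∘ loop)) F)
           (cong₂ _⊞_ refl (D*-ins j (ξ ∘ loop) F))))
    (trans (rearrange₄ _ _ _)
      (cong₂ _⊞_ (sym (sub D*-lin (ξ ∘ edge j) (ins j (ξ ∘ loop)) F)) refl))

  -- ξ ∘ gone ≗ ⊖ ξ holds for every λᵉ i
  κ-D*⁻ : ∀ {n} (j : Fin (suc n)) (ξ : ∀ {n} → Fun n) → (∀ {n} (F : Face n) → ξ (gone F) ≡ ⊟ ξ F) →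
    κ j (D* ξ) ≗′ D* (κ j ξ) ⊕′ ins j ξ
  κ-D*⁻ j ξ e F = trans (κ-D* j ξ F) (cong₂ _⊞_ refl
    (trans (cong ⊟_ (trans (cong≗ (ins-lin j) e F) (neg≗ (ins-lin j) ξ F))) (⊟-involutive _)))

  κ-D*D* : ∀ {n} (j : Fin (suc n)) (ξ : ∀ {n} → Fun n) → (∀ {n} (F : Face n) → ξ (gone F) ≡ ⊟ ξ F) →
    κ j (D* (D* ξ)) ≗′ D* (D* (κ j ξ)) ⊕′ (D* (ins j ξ) ⊕′ D* (ins j ξ))
  κ-D*D* j ξ e F = trans (κ-D* j (D* ξ) F)
    (trans (cong₂ (λ a b → a ⊞ ⊟ b)
       (trans (cong≗ D*-lin (κ-D*⁻ j ξ e) F) (add D*-lin (D* (κ j ξ)) (ins j ξ) F))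
       (trans (D*-ins j (ξ ∘ gone) F)
         (trans (cong≗ (D*-lin ∘ˡ ins-lin j) e F) (neg≗ (D*-lin ∘ˡ ins-lin j) ξ F))))
    (rearrange₅ _ _))

  opaque
    unfolding _⊞_ ⊟_

    λ¹-law : ∀ a b → ⊟ (a ⊞ a) ⊞ ⊟ ((⊟ b ⊞ ⊟ b) ⊞ 0₃) ≡ (b ⊞ b) ⊞ ⊟ (a ⊞ a)
    λ¹-law = law₂

    λ²-law : ∀ a q → ⊟ ⊟ (a ⊞ a) ⊞ ((⊟ a ⊞ ⊟ a) ⊞ q) ⊞ ((0₃ ⊞ q) ⊞ 0₃ ⊞ ((0₃ ⊞ q) ⊞ 0₃)) ≡ 0₃
    λ²-law = law₂

    ⊞0⊞0 : ∀ a → (a ⊞ 0₃) ⊞ 0₃ ≡ a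
    ⊞0⊞0 = law₁

  DD : ∀ {n} → Linear (D* ∘ D* {n})
  DD = D*-lin ∘ˡ D*-lin

  -- Apply `f` to the homotopy formula. It serves to replace a cochain by its coboundary, which the
  -- zigzag makes explicit, wherever `f` kills coboundaries and the image of `E*`.
  unhomotopy : ∀ {k n} {f : Fun k → Fun n} → Linear f → ∀ θ F →
    f (∂* (H* θ)) F ≡ 0₃ → f (E* θ) F ≡ 0₃ → f θ F ≡ f (H* (∂* θ)) F
  unhomotopy {f = f} lf θ F e₁ e₂ =
    trans (sym (cong≗ lf (homotopy θ) F))
    (trans (add lf (H* (∂* θ) ⊕′ ∂* (H* θ)) (E* θ) F)
    (trans (cong₂ _⊞_ (trans (add lf (H* (∂* θ)) (∂* (H* θ)) F) (cong₂ _⊞_ refl e₁)) e₂) (⊞0⊞0 _)))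

  unhomotopy′ : ∀ {k n} {f : Fun k → Fun n} → Linear f → ∀ θ F →
    f (∂* (H* θ)) F ≡ 0₃ → f (E* θ) F ≡ 0₃ → f (H* (∂* θ)) F ≡ f θ F
  unhomotopy′ lf θ F e₁ e₂ = sym (unhomotopy lf θ F e₁ e₂)

  ED∂ : ∀ {n} (θ : Fun n) F → E* (D* (∂* θ)) F ≡ 0₃
  ED∂ θ F = trans (cong≗ E*-lin (λ F → sym (∂*-D* θ F)) F) (E*-∂* (D* θ) F)

  EDD∂ : ∀ {n} (θ : Fun n) F → E* (D* (D* (∂* θ))) F ≡ 0₃
  EDD∂ θ F = trans (cong≗ (E*-lin ∘ˡ D*-lin) (λ F → sym (∂*-D* θ F)) F) (ED∂ (D* θ) F)

  EDE : ∀ {n} (θ : Fun n) F → E* (D* (E* θ)) F ≡ 0₃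
  EDE θ = E*-homog (homog-D (homog-E θ)) (λ ())

  EDDE : ∀ {n} (θ : Fun n) F → E* (D* (D* (E* θ))) F ≡ 0₃
  EDDE θ = E*-homog (homog-D (homog-D (homog-E θ))) (λ ())

  EDDHDE : ∀ {n} (θ : Fun n) F → E* (D* (D* (H* (D* (E* θ))))) F ≡ 0₃
  EDDHDE θ = E*-homog (homog-D (homog-D (homog-H (homog-D (homog-E θ))))) (λ ())

  λᵉ₀-∂ : ∀ {n} → ∂* (λᵉ 0 {n}) ≗′ D* ev
  λᵉ₀-∂ = ∂*-H* (λ F → trans (∂*-D* ev F) (zer D*-lin ∂*-ev F))
               (E*-homog (homog-D (homog-λᵒ 0)) (λ ()))
    where
    ∂*-ev : ∀ {n} (F : Face n) → ∂* ev F ≡ 0₃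
    ∂*-ev nil = refl
    ∂*-ev (free F) = zer ∂*-lin (λ _ → refl) F
    ∂*-ev (loop F) = trans (cong₂ (λ a b → a ⊞ ⊟ b) refl (zer ∂*-lin (λ _ → refl) F)) (⊞-inverseʳ 0₃)
    ∂*-ev (gone F) = trans (cong ⊟_ (∂*-ev F)) ⊟0
    ∂*-ev (edge j F) = trans (cong₂ (λ a b → a ⊞ ⊟ b) (zer (ins-lin j) (λ _ → refl) F)
      (zer ∂*-lin (λ _ → refl) F)) (⊞-inverseʳ 0₃)

  λᵒ₁-∂ : ∀ {n} → ∂* (λᵒ 1 {n}) ≗′ D* (D* λ⁰)
  λᵒ₁-∂ = ∂*-H*
    (λ F → trans (∂*-D* (D* λ⁰) F) (trans (cong≗ D*-lin (∂*-D* λ⁰) F)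
      (trans (cong≗ DD λᵉ₀-∂ F) (D*³ ev F))))
    (E*-homog (homog-D (homog-D (homog-λᵉ 0))) (λ ()))

  λ¹ : ∀ {n} → Fun n
  λ¹ = λᵒ 1

  κ-DDλ⁰ : ∀ {n} (j : Fin (suc n)) → κ j (D* (D* λ⁰)) ≗′ D* (ins j λ⁰) ⊕′ D* (ins j λ⁰)
  κ-DDλ⁰ j F = trans (κ-D*D* j λ⁰ (λᵉ-gone 0) F)
    (trans (cong (_⊞ (D* (ins j λ⁰) F ⊞ D* (ins j λ⁰) F)) (zer DD (λ F → trans (cong₂ (λ a b → a ⊞ ⊟ b) (λ⁰-edge j F)
      (zer (ins-lin j) (λ _ → refl) F)) (⊞-inverseʳ 0₃)) F)) (⊞-identityˡ _))

  -- `∂*-insL` solved for `ins j ξ`: up to a coboundary, the free insertion depends on `∂* ξ` alone,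
  -- which is known for the cochains of the zigzag.
  ins-∂ : ∀ {n} (j : Fin (suc n)) (ξ : Fun (suc n)) → ins j ξ ≗′ insˢ L j (∂* ξ) ⊕′ ∂* (insˢ L j ξ)
  ins-∂ j ξ F = sym (trans (cong₂ _⊞_ (∂*-insL j ξ F) refl)
    (trans (sym (⊞-identityʳ _)) (cancel₁ _ _)))

  ins-λ¹ : ∀ {n} (j : Fin (suc n)) →
    ins j λ¹ ≗′ (D* (insˢ G j λ⁰) ⊕′ D* (insˢ G j λ⁰)) ⊕′ ∂* (insˢ L j λ¹)
  ins-λ¹ j F = trans (ins-∂ j λ¹ F) (cong₂ _⊞_
    (trans (cong≗ (insˢ-lin L j) λᵒ₁-∂ F)
    (trans (D*-insL j (D* λ⁰) F)
    (cong₂ _⊞_ (D*-insG j λ⁰ F)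
      (cong≗ D*-lin (λ F → trans (D*-insL j λ⁰ F)
        (trans (cong₂ _⊞_ refl (zer D*-lin (insL-λ⁰ j) F)) (⊞-identityʳ _))) F)))) refl)

  ED-κλ¹ : ∀ {n} (j : Fin (suc n)) {k} {f : Fun n → Fun k} → Linear f → ∀ F →
    f (H* (∂* (κ j λ¹))) F ≡
    ⊟ (f (H* (D* (ins j λ⁰))) F ⊞ f (H* (D* (ins j λ⁰))) F)
  ED-κλ¹ j {f = f} lf F =
    trans (cong≗ fH (λ F → trans (sym (⊟-involutive _)) (cong ⊟_ (sym (κ-∂* j λ¹ F)))) F)
    (trans (neg≗ fH (κ j (∂* λ¹)) F)
    (cong ⊟_ (trans (cong≗ fH (λ F → trans (κ-cong j λᵒ₁-∂ F) (κ-DDλ⁰ j F)) F)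
                    (add fH (D* (ins j λ⁰)) (D* (ins j λ⁰)) F))))
    where fH = lf ∘ˡ H*-lin

  ED-insG : ∀ {n} (j : Fin (suc n)) {k} {f : Fun n → Fun k} → Linear f → ∀ F →
    f (insˢ G j λ⁰) F ≡ ⊟ f (H* (D* (ins j λ⁰))) F
  ED-insG j lf F = trans (cong≗ lf (insG-λ⁰ j) F) (neg≗ lf (H* (D* (ins j λ⁰))) F)

  EDλᵒ₁ : ∀ {n} (F : Face n) → E* (D* λ¹) F ≡ 0₃
  EDλᵒ₁ nil = refl
  EDλᵒ₁ (free F) = refl
  EDλᵒ₁ (loop F) = refl
  EDλᵒ₁ (gone F) = trans (cong≗ (E*-lin ∘ˡ D*-lin) (λᵒ-gone 1) F) (EDλᵒ₁ F)
  EDλᵒ₁ (edge j F) =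
    trans (E*-edge (D* λ¹) j F)
    (trans (cong≗ E*-lin (κ-D* j λ¹) F)
    (trans (sub E*-lin (D* (κ j λ¹)) (ins j (λ¹ ∘ gone)) F)
    (trans (cong₂ (λ a b → a ⊞ ⊟ b)
      (trans (unhomotopy ED (κ j λ¹) F (ED∂ (H* (κ j λ¹)) F) (EDE (κ j λ¹) F)) (ED-κλ¹ j ED F))
      (trans (cong≗ (E*-lin ∘ˡ ins-lin j) (λᵒ-gone 1) F)
      (trans (cong≗ E*-lin (ins-λ¹ j) F)
      (trans (add E*-lin (D* g ⊕′ D* g) (∂* (insˢ L j λ¹)) F)
        (cong₂ _⊞_ (trans (add E*-lin (D* g) (D* g) F) (cong (λ a → a ⊞ a) (ED-insG j ED F)))
          (E*-∂* (insˢ L j λ¹) F))))))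
    (trans (λ¹-law _ _) (⊞-inverseʳ _)))))
    where
    ED = E*-lin ∘ˡ D*-lin
    g = insˢ G j λ⁰

  λ² : ∀ {n} → Fun n
  λ² = λᵉ 1

  λᵉ₁-∂ : ∀ {n} → ∂* (λ² {n}) ≗′ D* λ¹
  λᵉ₁-∂ = ∂*-H* (λ F → trans (∂*-D* λ¹ F) (trans (cong≗ D*-lin λᵒ₁-∂ F) (D*³ λ⁰ F))) EDλᵒ₁

  insG-λ¹ : ∀ {n} (j : Fin (suc n)) → insˢ G j λ¹ ≗′ ⊟^ j ∘ λ¹
  insG-λ¹ j F = trans (H*-insG j (D* (D* λ⁰)) F)
    (trans (cong ⊟_ (trans (cong≗ H*-lin (λ F → trans (D*-insG j (D* λ⁰) F) (cong≗ D*-lin (D*-insG j λ⁰) F)) F)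
      (trans (ED-insG j HDD F)
        (cong ⊟_ (trans (cong≗ HDD (HDins-λ⁰ j) F) (⊟^-lin HDD j λ⁰ F))))))
    (⊟-involutive _))

  -- The other obstruction of weight 0. On an edge, with a = `E* (D* (D* (H* (D* e))))` and q =
  -- `E* (D* (D* η))` at `F`, the term `T₁` is 2a + (-2a + q) and `T₂`, which occurs twice, is q.
  -- The sum 3q vanishes only modulo 3.
  EDDλᵉ₁ : ∀ {n} (F : Face n) → E* (D* (D* λ²)) F ≡ 0₃
  EDDλᵉ₁ nil = refl
  EDDλᵉ₁ (free F) = refl
  EDDλᵉ₁ (loop F) = refl
  EDDλᵉ₁ (gone F) = trans (cong≗ (E*-lin ∘ˡ DD) (λᵉ-gone 1) F)
    (trans (neg≗ (E*-lin ∘ˡ DD) λ² F) (trans (cong ⊟_ (EDDλᵉ₁ F)) ⊟0))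
  EDDλᵉ₁ {suc (suc n)} (edge j F) =
    trans (E*-edge (D* (D* λ²)) j F)
    (trans (cong≗ E*-lin (κ-D*D* j λ² (λᵉ-gone 1)) F)
    (trans (add E*-lin (D* (D* (κ j λ²))) (D* (ins j λ²) ⊕′ D* (ins j λ²)) F)
    (trans (cong₂ _⊞_ T₁ (trans (add E*-lin (D* (ins j λ²)) (D* (ins j λ²)) F) (cong₂ _⊞_ T₂ T₂)))
      (λ²-law (E* (D* (D* (H* (D* e)))) F) (E* (D* (D* η)) F)))))
    where
    ED : Linear (E* ∘ D* {n})
    ED = E*-lin ∘ˡ D*-lin
    EDD : Linear (E* ∘ D* ∘ D* {n})
    EDD = E*-lin ∘ˡ DD
    EDDH : Linear (E* ∘ D* ∘ D* ∘ H* {n})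
    EDDH = EDD ∘ˡ H*-lin
    EDDHD : Linear (E* ∘ D* ∘ D* ∘ H* ∘ D* {n})
    EDDHD = EDDH ∘ˡ D*-lin
    e g η : Fun n
    e = H* (D* (ins j λ⁰))
    g = insˢ G j λ⁰
    η = insˢ L j λ¹
    EDDHD∂ : ∀ (ω : Fun n) F → E* (D* (D* (H* (D* (∂* ω))))) F ≡ 0₃
    EDDHD∂ ω F = trans (cong≗ EDDH (λ F → sym (∂*-D* ω F)) F)
      (trans (unhomotopy′ EDD (D* ω) F (EDD∂ (H* (D* ω)) F) (EDDE (D* ω) F))
        (zer E*-lin (D*³ ω) F))
    P : E* (D* (D* (H* (D* (κ j λ¹))))) F ≡ ⊟ (E* (D* (D* (H* (D* e)))) F ⊞ E* (D* (D* (H* (D* e)))) F)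
    P = trans (unhomotopy EDDHD (κ j λ¹) F (EDDHD∂ (H* (κ j λ¹)) F) (EDDHDE (κ j λ¹) F))
              (ED-κλ¹ j EDDHD F)
    Q : E* (D* (D* (H* (ins j λ¹)))) F ≡
        (⊟ E* (D* (D* (H* (D* e)))) F ⊞ ⊟ E* (D* (D* (H* (D* e)))) F) ⊞ E* (D* (D* η)) F
    Q = trans (cong≗ EDDH (ins-λ¹ j) F)
      (trans (add EDDH (D* g ⊕′ D* g) (∂* η) F)
      (cong₂ _⊞_ (trans (add EDDH (D* g) (D* g) F) (cong (λ a → a ⊞ a) (ED-insG j EDDHD F)))
        (unhomotopy′ EDD η F (EDD∂ (H* η) F) (EDDE η F))))
    T₁ : E* (D* (D* (κ j λ²))) F ≡
         ⊟ ⊟ (E* (D* (D* (H* (D* e)))) F ⊞ E* (D* (D* (H* (D* e)))) F) ⊞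
         ((⊟ E* (D* (D* (H* (D* e)))) F ⊞ ⊟ E* (D* (D* (H* (D* e)))) F) ⊞ E* (D* (D* η)) F)
    T₁ = trans (unhomotopy EDD (κ j λ²) F (EDD∂ (H* (κ j λ²)) F) (EDDE (κ j λ²) F))
      (trans (cong≗ EDDH (λ F → trans (sym (⊟-involutive _)) (cong ⊟_ (sym (κ-∂* j λ² F)))) F)
      (trans (neg≗ EDDH (κ j (∂* λ²)) F)
      (trans (cong ⊟_ (trans (cong≗ EDDH (λ F → trans (κ-cong j λᵉ₁-∂ F) (trans (κ-D* j λ¹ F)
          (cong₂ (λ a b → a ⊞ ⊟ b) refl (cong≗ (ins-lin j) (λᵒ-gone 1) F)))) F)
        (sub EDDH (D* (κ j λ¹)) (ins j λ¹) F)))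
      (trans (⊟-sub _ _) (cong₂ (λ a b → ⊟ a ⊞ b) P Q)))))
    T₂ : E* (D* (ins j λ²)) F ≡ (0₃ ⊞ E* (D* (D* η)) F) ⊞ 0₃
    T₂ = trans (cong≗ ED (ins-∂ j λ²) F)
      (trans (add ED (insˢ L j (∂* λ²)) (∂* (insˢ L j λ²)) F)
      (cong₂ _⊞_ (trans (cong≗ ED (λ F → trans (cong≗ (insˢ-lin L j) λᵉ₁-∂ F) (D*-insL j λ¹ F)) F)
          (trans (add ED (insˢ G j λ¹) (D* η) F)
            (cong₂ _⊞_ (trans (cong≗ ED (insG-λ¹ j) F) (trans (⊟^-lin ED j λ¹ F)
              (trans (cong (⊟^ j) (EDλᵒ₁ F)) (⊟^0 j)))) refl)))
        (ED∂ (insˢ L j λ²) F)))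

  -- `D* (λᵒ i)` has weight 1 - i, so its weight settles every index but 1. The same holds for
  -- `D* (D* (λᵉ i))` below.
  EDλᵒ : ∀ i {n} (F : Face n) → E* (D* (λᵒ i)) F ≡ 0₃
  EDλᵒ 0 = E*-homog (homog-D (homog-λᵒ 0)) (λ ())
  EDλᵒ 1 = EDλᵒ₁
  EDλᵒ (suc (suc i)) = E*-homog (homog-D (homog-λᵒ (suc (suc i))))
    (λ e → case (trans (sym (cong sucℤ (weight-suc (suc i)))) e))
    where
    case : -[1+ i ] ≢ 0ℤ
    case ()

  EDDλᵉ : ∀ i {n} (F : Face n) → E* (D* (D* (λᵉ i))) F ≡ 0₃
  EDDλᵉ 0 = E*-homog (homog-D (homog-D (homog-λᵉ 0))) (λ ())
  EDDλᵉ 1 = EDDλᵉ₁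
  EDDλᵉ (suc (suc i)) = E*-homog (homog-D (homog-D (homog-λᵉ (suc (suc i)))))
    (λ e → case (trans (sym (cong (λ w → sucℤ (sucℤ w)) (weight-suc (suc (suc i))))) e))
    where
    case : -[1+ i ] ≢ 0ℤ
    case ()

  λᵉ-∂ : ∀ i {n} → ∂* (λᵉ i {n}) ≗′ D* (λᵒ i)
  λᵒ-∂ : ∀ i {n} → ∂* (λᵒ (suc i) {n}) ≗′ D* (D* (λᵉ i))
  λᵉ-∂ zero = λᵉ₀-∂
  λᵉ-∂ (suc i) = ∂*-H* (λ F → trans (∂*-D* (λᵒ (suc i)) F)
    (trans (cong≗ D*-lin (λᵒ-∂ i) F) (D*³ (λᵉ i) F))) (EDλᵒ (suc i))
  λᵒ-∂ i = ∂*-H* (λ F → trans (∂*-D* (D* (λᵉ i)) F) (trans (cong≗ D*-lin (∂*-D* (λᵉ i)) F)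
    (trans (cong≗ DD (λᵉ-∂ i) F) (D*³ (λᵒ i) F)))) (EDDλᵉ i)

  -- Values of the zigzag on faces without loops

  data Loopless : ∀ {n} → Face n → Set where
    nilˡ : Loopless nil
    freeˡ : ∀ {n} {F : Face n} → Loopless F → Loopless (free F)
    goneˡ : ∀ {n} {F : Face n} → Loopless F → Loopless (gone F)
    edgeˡ : ∀ {n} j {F : Face n} → Loopless F → Loopless (edge j F)

  D*-loopless : ∀ {n} (θ : Fun n) {F} → Loopless F → D* θ F ≡ 0₃
  D*-loopless θ nilˡ = refl
  D*-loopless θ (freeˡ l) = D*-loopless (θ ∘ free) l
  D*-loopless θ (goneˡ l) = D*-loopless (θ ∘ gone) l
  D*-loopless θ (edgeˡ j l) = D*-loopless (θ ∘ edge j) l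

  -- The coboundary of `λᵉ i` is an image of `D*`, and a value of `D*` is a sum over the loops of
  -- the face.
  λᵉ-cocycle : ∀ i {n} {F : Face n} → Loopless F → ∂* (λᵉ i) F ≡ 0₃
  λᵉ-cocycle i {F = F} l = trans (λᵉ-∂ i F) (D*-loopless (λᵒ i) l)

  open import Data.Nat using (_*_)

  opaque
    unfolding _⊞_ ⊟_
    double-law : ∀ a → ⊟ a ⊞ ⊟ a ≡ a
    double-law = law₁

  λᵉ-free : ∀ i {n} {F : Face n} → Loopless F → λᵉ i (free F) ≡ λᵒ i F
  λᵉ-free i {F = F} l =
    trans (cong₂ _⊞_ (λᵒ-gone i F) (D*-loopless (λᵒ i ∘ loop) l)) (⊞-identityʳ _)

  D*²-oneloop : ∀ {n} (θ : Fun (suc n)) {F} → Loopless F → D* (D* θ) (loop F) ≡ 0₃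
  D*²-oneloop θ {F} l = trans (D*²-loop θ F)
    (trans (cong₂ (λ a b → a ⊞ (a ⊞ b)) (D*-loopless (θ ∘ gone) l) (D*-loopless (D* (θ ∘ loop)) l))
    (trans (cong₂ _⊞_ refl 0⊞0) 0⊞0))

  -- Unfolding `H*` at the edge puts loops on the first and third vertices. Turning both, in two
  -- orders, gives twice the value of `λᵉ i` at `gone (free (gone F))`, which is -2 `λᵒ i F`, and -2
  -- = 1 in F₃. All other terms carry a single loop, and there `D*` applied twice is zero.
  λᵒ-suc : ∀ i {n} {F : Face n} → Loopless F →
    λᵒ (suc i) (edge zero (free F)) ⊞ ⊟ λᵒ (suc i) (free (edge zero F)) ≡ λᵒ i F
  λᵒ-suc i {F = F} l = trans (cong₂ (λ a b → a ⊞ ⊟ b)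
      (trans (cong₂ (λ a b → a ⊞ ⊟ b) two (D*²-oneloop (λᵉ i ∘ edge zero) l))
             (trans (cong₂ _⊞_ refl ⊟0) (⊞-identityʳ _)))
      (D*²-oneloop (λᵉ i) (edgeˡ zero l)))
    (trans (cong₂ _⊞_ refl ⊟0) (⊞-identityʳ _))
    where
    one : D* (λᵉ i ∘ gone) (free (loop F)) ≡ ⊟ λᵒ i F
    one = trans (cong₂ _⊞_ (trans (λᵉ-gone i (free (gone F))) (cong ⊟_ (trans (λᵉ-free i (goneˡ l)) (λᵒ-gone i F))))
                           (D*-loopless (λᵉ i ∘ gone ∘ free ∘ loop) l)) (⊞-identityʳ _)
    two : D* (D* (λᵉ i)) (loop (free (loop F))) ≡ λᵒ i F
    two = trans (D*²-loop (λᵉ i) (free (loop F)))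
      (trans (cong₂ (λ a b → a ⊞ (a ⊞ b)) one (D*²-oneloop (λᵉ i ∘ loop ∘ free) l))
      (trans (cong₂ _⊞_ refl (⊞-identityʳ _)) (double-law _)))

  -- The value on the product of `r` factors ab - bc over consecutive triples: `edge zero (free F)`
  -- reads ab with c free, and `free (edge zero F)` reads bc with a free.
  ∫γ : ∀ r → Fun (r * 3) → F₃
  ∫γ zero θ = θ nil
  ∫γ (suc r) θ = ∫γ r (θ ∘ edge zero ∘ free) ⊞ ⊟ ∫γ r (θ ∘ free ∘ edge zero)

  ∫γ-cong : ∀ r {θ η : Fun (r * 3)} → (∀ {F} → Loopless F → θ F ≡ η F) → ∫γ r θ ≡ ∫γ r η
  ∫γ-cong zero e = e nilˡ
  ∫γ-cong (suc r) e = cong₂ (λ a b → a ⊞ ⊟ b)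
    (∫γ-cong r (λ l → e (edgeˡ zero (freeˡ l)))) (∫γ-cong r (λ l → e (freeˡ (edgeˡ zero l))))

  ∫γ-sub : ∀ r (θ η : Fun (r * 3)) → ∫γ r (λ F → θ F ⊞ ⊟ η F) ≡ ∫γ r θ ⊞ ⊟ ∫γ r η
  ∫γ-sub zero θ η = refl
  ∫γ-sub (suc r) θ η = trans (cong₂ (λ a b → a ⊞ ⊟ b) (∫γ-sub r (θ ∘ edge zero ∘ free) (η ∘ edge zero ∘ free))
                                             (∫γ-sub r (θ ∘ free ∘ edge zero) (η ∘ free ∘ edge zero)))
    (trans (interchange⁻ _ _ _ _) (cong₂ _⊞_ refl (⊟-⊞⊟ _ _)))

  ∫γ-λ : ∀ r → ∫γ r (λᵉ r ∘ free) ≡ 1₃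
  ∫γ-λ r = trans (∫γ-cong r (λᵉ-free r)) (go r)
    where
    go : ∀ r → ∫γ r (λᵒ r) ≡ 1₃
    go zero = refl
    go (suc r) = trans (sym (∫γ-sub r (λᵒ (suc r) ∘ edge zero ∘ free) (λᵒ (suc r) ∘ free ∘ edge zero))) (trans (∫γ-cong r (λᵒ-suc r)) (go r))

-- Functionals on words of edges

module Words where

  open import Algebra.Bundles using (AbelianGroup)
  open import Data.Integer using (_⊖_)
  open import Data.Integer.Properties using ([1+m]⊖[1+n]≡m⊖n)

  -- The same calculations are made over ℤ, for cycles and bounding chains, and over F₃, for
  -- detection; integer multiples of values are all that both require.
  record Coefficients : Set₁ where
    infixl 6 _+_
    infix 8 -_
    infixr 7 _·_
    field
      Carrier : Set
      _+_ : Carrier → Carrier → Carrier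
      0# : Carrier
      -_ : Carrier → Carrier
      isAbelianGroup : IsAbelianGroup _≡_ _+_ 0# -_
    abelianGroup : AbelianGroup _ _
    abelianGroup = record { isAbelianGroup = isAbelianGroup }

    open AbelianGroup abelianGroup public
      using (assoc; comm; identityˡ; identityʳ; inverseˡ; inverseʳ; commutativeMonoid; commutativeSemigroup)
    open AbelianGroupProperties abelianGroup public using (⁻¹-involutive; ⁻¹-∙-comm; ε⁻¹≈ε)
    open CommutativeSemigroupProperties commutativeSemigroup public using (interchange; x∙yz≈y∙xz)
    open CommutativeMonoidMult commutativeMonoid public using (×-homo-+; ×-distrib-+) renaming (_×_ to _×ᴷ_)

    neg-+ : ∀ x y → - (x + y) ≡ - x + - y
    neg-+ x y = sym (⁻¹-∙-comm x y)

    _·_ : ℤ → Carrier → Carrier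
    pos n · x = n ×ᴷ x
    -[1+ n ] · x = - (suc n ×ᴷ x)

    ⊖-· : ∀ m n x → (m ⊖ n) · x ≡ (m ×ᴷ x) + - (n ×ᴷ x)
    ⊖-· m zero x = sym (trans (cong ((m ×ᴷ x) +_) ε⁻¹≈ε) (identityʳ _))
    ⊖-· zero (suc n) x = sym (identityˡ _)
    ⊖-· (suc m) (suc n) x = trans (cong (_· x) ([1+m]⊖[1+n]≡m⊖n m n)) (trans (⊖-· m n x)
      (sym (trans (cong ((suc m ×ᴷ x) +_) (neg-+ x (n ×ᴷ x)))
        (trans (interchange x (m ×ᴷ x) (- x) (- (n ×ᴷ x))) (trans (cong (_+ ((m ×ᴷ x) + - (n ×ᴷ x))) (inverseʳ x)) (identityˡ _))))))

    ·-+ : ∀ a b x → (a +ℤ b) · x ≡ a · x + b · x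
    ·-+ (pos m) (pos n) x = ×-homo-+ x m n
    ·-+ (pos m) -[1+ n ] x = ⊖-· m (suc n) x
    ·-+ -[1+ m ] (pos n) x = trans (⊖-· n (suc m) x) (comm _ _)
    ·-+ -[1+ m ] -[1+ n ] x = trans (cong (λ k → - (suc k ×ᴷ x)) (sym (+-suc m n)))
      (trans (cong -_ (×-homo-+ x (suc m) (suc n))) (neg-+ _ _))

    ·-distrib : ∀ a x y → a · (x + y) ≡ a · x + a · y
    ·-distrib (pos n) x y = ×-distrib-+ x y n
    ·-distrib -[1+ n ] x y = trans (cong -_ (×-distrib-+ x y (suc n))) (neg-+ _ _)

    neg-· : ∀ a x → (-ℤ a) · x ≡ - (a · x)
    neg-· (pos zero) x = sym ε⁻¹≈ε
    neg-· (pos (suc n)) x = refl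
    neg-· -[1+ n ] x = sym (⁻¹-involutive _)

    ×-0 : ∀ n → n ×ᴷ 0# ≡ 0#
    ×-0 zero = refl
    ×-0 (suc n) = trans (identityˡ _) (×-0 n)

    ·-0 : ∀ a → a · 0# ≡ 0#
    ·-0 (pos n) = ×-0 n
    ·-0 -[1+ n ] = trans (cong -_ (×-0 (suc n))) ε⁻¹≈ε

    ·-neg : ∀ a x → a · (- x) ≡ - (a · x)
    ·-neg a x = trans (sym (identityʳ _)) (trans (cong (a · (- x) +_) (sym (inverseʳ (a · x))))
      (trans (sym (assoc _ _ _)) (trans (cong (_+ - (a · x)) (trans (sym (·-distrib a (- x) x))
        (trans (cong (a ·_) (inverseˡ x)) (·-0 a)))) (identityˡ _))))

  data Pick {A : Set} : List A → A → List A → Set where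
    here : ∀ {x xs} → Pick (x ∷ xs) x xs
    there : ∀ {x y xs ys} → Pick xs y ys → Pick (x ∷ xs) y (x ∷ ys)

  All-pick : {A : Set} {P : A → Set} {xs : List A} {y : A} {ys : List A} → All P xs → Pick xs y ys → P y × All P ys
  All-pick (px ∷ pxs) here = px , pxs
  All-pick (px ∷ pxs) (there k) with All-pick pxs k
  ... | py , pys = py , px ∷ pys

  length-pick : {A : Set} {xs : List A} {y : A} {ys : List A} → Pick xs y ys → length xs ≡ suc (length ys)
  length-pick here = refl
  length-pick (there k) = cong suc (length-pick k)

  module Functionals (K : Coefficients) where
    open Coefficients K

    interchange⁻ᴷ : ∀ a b c d → (a + b) + - (c + d) ≡ (a + - c) + (b + - d)
    interchange⁻ᴷ a b c d = trans (cong ((a + b) +_) (neg-+ c d)) (interchange a b (- c) (- d))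

    neg-sub : ∀ a b → - a + - - b ≡ - (a + - b)
    neg-sub a b = ⁻¹-∙-comm a (- b)

    sub-0 : ∀ a → a + - 0# ≡ a
    sub-0 a = trans (cong (a +_) ε⁻¹≈ε) (identityʳ a)

    swap-law : ∀ x y w → x + - (y + - w) ≡ - (y + - (x + w))
    swap-law x y w = trans (cong (x +_) (trans (neg-+ y (- w)) (cong (- y +_) (⁻¹-involutive w))))
      (trans (x∙yz≈y∙xz x (- y) w) (sym (trans (neg-+ y (- (x + w))) (cong (- y +_) (⁻¹-involutive _)))))

    -- The alternating sum over positions behind all constructions on words: boundary, contraction
    -- of an edge, choice of a column in a chessboard. The summand receives the letters left over,
    -- so that such sums can be nested.
    S : {A : Set} → List A → (A → List A → Carrier) → Carrier
    S [] g = 0#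
    S (x ∷ xs) g = g x xs + - S xs (λ y ys → g y (x ∷ ys))

    U : {A : Set} → List A → (A → List A → Carrier) → Carrier
    U [] g = 0#
    U (x ∷ xs) g = g x xs + U xs (λ y ys → g y (x ∷ ys))

    on : Bool → Carrier → Carrier
    on b x = if b then x else 0#

    module _ {A : Set} where

      S-cong : ∀ w {g h : A → List A → Carrier} →
        (∀ {x xs} → Pick w x xs → g x xs ≡ h x xs) → S w g ≡ S w h
      S-cong [] e = refl
      S-cong (x ∷ w) e = cong₂ (λ a b → a + - b) (e here) (S-cong w (e ∘ there))

      S-+ : ∀ w (g h : A → List A → Carrier) → S w (λ x xs → g x xs + h x xs) ≡ S w g + S w h
      S-+ [] g h = sym (identityˡ 0#)
      S-+ (x ∷ w) g h = trans (cong (λ a → (g x w + h x w) + - a) (S-+ w _ _)) (interchange⁻ᴷ _ _ _ _)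

      S-neg : ∀ w (g : A → List A → Carrier) → S w (λ x xs → - g x xs) ≡ - S w g
      S-neg [] g = sym ε⁻¹≈ε
      S-neg (x ∷ w) g = trans (cong (λ a → (- g x w) + - a) (S-neg w _)) (neg-sub _ _)

      S-0 : ∀ w {g : A → List A → Carrier} → (∀ {x xs} → Pick w x xs → g x xs ≡ 0#) → S w g ≡ 0#
      S-0 [] e = refl
      S-0 (x ∷ w) e = trans (cong₂ (λ a b → a + - b) (e here) (S-0 w (e ∘ there))) (inverseʳ 0#)

      S-on : ∀ b w (g : A → List A → Carrier) → S w (λ x xs → on b (g x xs)) ≡ on b (S w g)
      S-on true w g = refl
      S-on false w g = S-0 w (λ _ → refl)

      -- Taking out two letters in the other order moves one of them past one letter less, which
      -- flips the sign.
      S-S : ∀ w (g : A → A → List A → Carrier) →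
        S w (λ x xs → S xs (λ y ys → g x y ys)) ≡ - S w (λ x xs → S xs (λ y ys → g y x ys))
      S-S [] g = sym ε⁻¹≈ε
      S-S (x ∷ w) g = trans (cong (λ a → S w (g x) + - a) (trans (S-+ w _ _) (cong (S w (λ y → g y x) +_) (S-neg w _))))
        (trans (swap-law _ _ _) (cong -_ (cong (S w (λ y → g y x) +_) (cong -_
          (sym (trans (S-+ w _ _) (cong (S w (g x) +_)
            (trans (S-neg w _) (trans (cong -_ (S-S w (λ y z ys → g z y (x ∷ ys)))) (⁻¹-involutive _))))))))))

      U-cong : ∀ w {g h : A → List A → Carrier} →
        (∀ {x xs} → Pick w x xs → g x xs ≡ h x xs) → U w g ≡ U w h
      U-cong [] e = refl
      U-cong (x ∷ w) e = cong₂ _+_ (e here) (U-cong w (e ∘ there))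

      U-0 : ∀ w {g : A → List A → Carrier} → (∀ {x xs} → Pick w x xs → g x xs ≡ 0#) → U w g ≡ 0#
      U-0 [] e = refl
      U-0 (x ∷ w) e = trans (cong₂ _+_ (e here) (U-0 w (e ∘ there))) (identityˡ 0#)

      U-+ : ∀ w (g h : A → List A → Carrier) → U w (λ x xs → g x xs + h x xs) ≡ U w g + U w h
      U-+ [] g h = sym (identityˡ 0#)
      U-+ (x ∷ w) g h = trans (cong ((g x w + h x w) +_) (U-+ w _ _)) (interchange _ _ _ _)

      U-neg : ∀ w (g : A → List A → Carrier) → U w (λ x xs → - g x xs) ≡ - U w g
      U-neg [] g = sym ε⁻¹≈ε
      U-neg (x ∷ w) g = trans (cong ((- g x w) +_) (U-neg w _)) (sym (neg-+ _ _))

      neg^ : List A → Carrier → Carrier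
      neg^ [] c = c
      neg^ (x ∷ w) c = - neg^ w c

      S-++ : ∀ w v (g : A → List A → Carrier) →
        S (w ++ v) g ≡ S w (λ x xs → g x (xs ++ v)) + neg^ w (S v (λ y ys → g y (w ++ ys)))
      S-++ [] v g = sym (identityˡ _)
      S-++ (x ∷ w) v g = trans (cong (λ a → g x (w ++ v) + - a) (S-++ w v _))
        (trans (cong (g x (w ++ v) +_) (neg-+ _ _)) (sym (assoc _ _ _)))

    U-S : ∀ {A B : Set} (w : List A) (v : List B) (g : A → List A → B → List B → Carrier) →
      U w (λ x xs → S v (g x xs)) ≡ S v (λ y ys → U w (λ x xs → g x xs y ys))
    U-S [] v g = sym (S-0 v (λ _ → refl))
    U-S (x ∷ w) v g = trans (cong (S v (g x w) +_) (U-S w v _)) (sym (S-+ v _ _))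

    on-0 : ∀ b → on b 0# ≡ 0#
    on-0 true = refl
    on-0 false = refl

    on-neg : ∀ b x → on b (- x) ≡ - on b x
    on-neg true x = refl
    on-neg false x = sym ε⁻¹≈ε

    -- What makes a functional on words a cochain on oriented simplices: order matters up to sign,
    -- and the direction of an edge does not matter.
    record Alternating {V : Set} (Ψ : List (V × V) → Carrier) : Set where
      field
        swap : ∀ u e f v → Ψ (u ++ e ∷ f ∷ v) ≡ - Ψ (u ++ f ∷ e ∷ v)
        flip : ∀ u x y v → Ψ (u ++ (x , y) ∷ v) ≡ Ψ (u ++ (y , x) ∷ v)
    open Alternating

    module _ {V : Set} where

      Word : Set
      Word = List (V × V)

      ∷-alternating : ∀ {Ψ : Word → Carrier} → Alternating Ψ → ∀ e → Alternating (Ψ ∘ (e ∷_))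
      ∷-alternating a e = record { swap = λ u → swap a (e ∷ u) ; flip = λ u → flip a (e ∷ u) }

      S-alternating : ∀ {g : V × V → Word → Carrier} → (∀ e → Alternating (g e)) →
        (∀ x y w → g (x , y) w ≡ g (y , x) w) → Alternating (λ w → S w g)
      S-alternating a s = record { swap = sw a ; flip = fl a s }
        where
        sw : ∀ {g : V × V → Word → Carrier} → (∀ e → Alternating (g e)) →
          ∀ u e f v → S (u ++ e ∷ f ∷ v) g ≡ - S (u ++ f ∷ e ∷ v) g
        sw {g} a [] e f v = trans (swap-law _ _ _) (cong (λ c → - (g f (e ∷ v) + - (g e (f ∷ v) + c)))
          (trans (S-cong v (λ {h} {w} _ → swap (a h) [] e f w)) (S-neg v _)))
        sw {g} a (h ∷ u) e f v = trans (cong₂ (λ x y → x + - y) (swap (a h) u e f v)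
          (sw (λ e′ → ∷-alternating (a e′) h) u e f v)) (neg-sub _ _)
        fl : ∀ {g : V × V → Word → Carrier} → (∀ e → Alternating (g e)) →
          (∀ x y w → g (x , y) w ≡ g (y , x) w) →
          ∀ u x y v → S (u ++ (x , y) ∷ v) g ≡ S (u ++ (y , x) ∷ v) g
        fl a s [] x y v = cong₂ (λ c d → c + - d) (s x y v) (S-cong v (λ {h} {w} _ → flip (a h) [] x y w))
        fl a s (h ∷ u) x y v = cong₂ (λ c d → c + - d) (flip (a h) u x y v)
          (fl (λ e → ∷-alternating (a e) h) (λ x y w → s x y (h ∷ w)) u x y v)

      on-alternating : ∀ b {Ψ : Word → Carrier} → Alternating Ψ → Alternating (λ w → on b (Ψ w))
      on-alternating b a = record
        { swap = λ u e f v → trans (cong (on b) (swap a u e f v)) (on-neg b _)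
        ; flip = λ u x y v → cong (on b) (flip a u x y v) }

      δ : (Word → Carrier) → Word → Carrier
      δ Ψ w = S w (λ _ → Ψ)

      δ-alternating : ∀ {Ψ} → Alternating Ψ → Alternating (δ Ψ)
      δ-alternating a = S-alternating (λ _ → a) (λ _ _ _ → refl)

      ⟪_⟫ : List (ℤ × Word) → (Word → Carrier) → Carrier
      ⟪ [] ⟫ Ψ = 0#
      ⟪ (a , w) ∷ c ⟫ Ψ = a · Ψ w + ⟪ c ⟫ Ψ

      ⟪⟫-++ : ∀ c d Ψ → ⟪ c ++ d ⟫ Ψ ≡ ⟪ c ⟫ Ψ + ⟪ d ⟫ Ψ
      ⟪⟫-++ [] d Ψ = sym (identityˡ _)
      ⟪⟫-++ ((a , w) ∷ c) d Ψ = trans (cong (a · Ψ w +_) (⟪⟫-++ c d Ψ)) (sym (assoc _ _ _))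

    module Contraction {V : Set} (_==_ : V → V → Bool) where

      same : V × V → V × V → Bool
      same (x , y) (a , b) = ((a == x) ∧ (b == y)) ∨ ((b == x) ∧ (a == y))

      same-flip : ∀ e a b → same e (a , b) ≡ same e (b , a)
      same-flip (x , y) a b = ∨-comm ((a == x) ∧ (b == y)) _

      -- The product of Ψ with the cochain dual to the edge `e`: an occurrence of `e` is moved to
      -- the front, with its sign, and dropped.
      contract : V × V → (Word → Carrier) → Word → Carrier
      contract e Ψ w = S w (λ f v → on (same e f) (Ψ v))

      contract-alternating : ∀ e {Ψ} → Alternating Ψ → Alternating (contract e Ψ)
      contract-alternating e a = S-alternating (λ f → on-alternating (same e f) a)
        (λ x y w → cong (λ b → on b _) (same-flip e x y))

      δ-contract : ∀ e Ψ w → δ (contract e Ψ) w ≡ - contract e (δ Ψ) w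
      δ-contract e Ψ w = trans (S-S w (λ _ f u → on (same e f) (Ψ u)))
        (cong -_ (S-cong w (λ {f} {v} _ → S-on (same e f) v _)))

-- From cochains on faces to functionals on words

module Reading {V : Set} (_≟_ : DecidableEquality V) where

  open LoopedMatchings
  open Words
  open import Data.Bool.Properties using (∨-zeroʳ)
  open import Data.Fin using (punchOut)
  open import Data.Fin.Properties using (suc-injective; punchIn-injective; punchIn-punchOut)
  open import Relation.Binary.PropositionalEquality using (isEquivalence)

  open Linear

  opaque
    unfolding _⊞_ ⊟_
    ⊞-⊟-isAbelianGroup : IsAbelianGroup _≡_ _⊞_ 0₃ ⊟_
    ⊞-⊟-isAbelianGroup = record
      { isGroup = record
        { isMonoid = record
          { isSemigroup = record
            { isMagma = record { isEquivalence = isEquivalence ; ∙-cong = cong₂ _⊞_ }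
            ; assoc = law₃ }
          ; identity = ⊞-identityˡ , ⊞-identityʳ }
        ; inverse = law₁ , ⊞-inverseʳ
        ; ⁻¹-cong = cong ⊟_ }
      ; comm = law₂ }

  F₃ᴷ : Coefficients
  F₃ᴷ = record { isAbelianGroup = ⊞-⊟-isAbelianGroup }

  open Functionals F₃ᴷ public
  open Alternating public

  infix 7 _≡ᵇ_
  _≡ᵇ_ : V → V → Bool
  x ≡ᵇ y = does (x ≟ y)

  ≡ᵇ-refl : ∀ x → x ≡ᵇ x ≡ true
  ≡ᵇ-refl x = dec-true (x ≟ x) refl

  ≢⇒≡ᵇ : ∀ {x y} → x ≢ y → x ≡ᵇ y ≡ false
  ≢⇒≡ᵇ {x} {y} = dec-false (x ≟ y)

  touches : V → V × V → Bool
  touches x (a , b) = a ≡ᵇ x ∨ b ≡ᵇ x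

  absent : V → List (V × V) → Bool
  absent x [] = true
  absent x (e ∷ w) = not (touches x e) ∧ absent x w

  mate : V → V × V → (V → F₃) → F₃
  mate x (a , b) h = on (a ≡ᵇ x) (h b) ⊞ on (b ≡ᵇ x) (h a)

  ∑ : ∀ n → (Fin n → F₃) → F₃
  ∑ zero f = 0₃
  ∑ (suc n) f = f zero ⊞ ∑ n (f ∘ suc)

  ∑-cong : ∀ n {f g : Fin n → F₃} → (∀ i → f i ≡ g i) → ∑ n f ≡ ∑ n g
  ∑-cong zero e = refl
  ∑-cong (suc n) e = cong₂ _⊞_ (e zero) (∑-cong n (e ∘ suc))

  ∑-⊞ : ∀ n (f g : Fin n → F₃) → ∑ n (λ i → f i ⊞ g i) ≡ ∑ n f ⊞ ∑ n g
  ∑-⊞ zero f g = sym 0⊞0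
  ∑-⊞ (suc n) f g = trans (cong₂ _⊞_ refl (∑-⊞ n (f ∘ suc) (g ∘ suc))) (LoopedMatchings.interchange _ _ _ _)

  ∑-⊟ : ∀ n (f : Fin n → F₃) → ∑ n (λ i → ⊟ f i) ≡ ⊟ ∑ n f
  ∑-⊟ zero f = sym ⊟0
  ∑-⊟ (suc n) f = trans (cong₂ _⊞_ refl (∑-⊟ n (f ∘ suc))) (sym (⊟-⊞ _ _))

  ∑-0 : ∀ n {f : Fin n → F₃} → (∀ i → f i ≡ 0₃) → ∑ n f ≡ 0₃
  ∑-0 zero e = refl
  ∑-0 (suc n) e = trans (cong₂ _⊞_ (e zero) (∑-0 n (e ∘ suc))) 0⊞0

  ∑-punchIn : ∀ n (j : Fin (suc n)) f → ∑ (suc n) f ≡ f j ⊞ ∑ n (f ∘ punchIn j)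
  ∑-punchIn n zero f = refl
  ∑-punchIn (suc n) (suc j) f = trans (cong₂ _⊞_ refl (∑-punchIn n j (f ∘ suc)))
    (Coefficients.x∙yz≈y∙xz F₃ᴷ _ _ _)

  ∑-only : ∀ n (j : Fin n) f → (∀ i → i ≢ j → f i ≡ 0₃) → ∑ n f ≡ f j
  ∑-only (suc n) zero f e = trans (cong₂ _⊞_ refl (∑-0 n (λ i → e (suc i) (λ ())))) (⊞-identityʳ _)
  ∑-only (suc n) (suc j) f e = trans (cong₂ _⊞_ (e zero (λ ()))
    (∑-only n j (f ∘ suc) (λ i i≢j → e (suc i) (i≢j ∘ suc-injective)))) (⊞-identityˡ _)

  S-∑ : ∀ n (w : List (V × V)) (g : Fin n → List (V × V) → F₃) →
    S w (λ _ v → ∑ n (λ i → g i v)) ≡ ∑ n (λ i → S w (λ _ v → g i v))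
  S-∑ zero w g = S-0 w (λ _ → refl)
  S-∑ (suc n) w g = trans (S-+ w _ _) (cong₂ _⊞_ refl (S-∑ n w (g ∘ suc)))

  mate-⊟ : ∀ x e h → mate x e (λ y → ⊟ h y) ≡ ⊟ mate x e h
  mate-⊟ x (a , b) h = trans (cong₂ _⊞_ (on-neg (a ≡ᵇ x) _) (on-neg (b ≡ᵇ x) _)) (sym (⊟-⊞ _ _))

  on-⊞ : ∀ b x y → on b (x ⊞ y) ≡ on b x ⊞ on b y
  on-⊞ true x y = refl
  on-⊞ false x y = sym 0⊞0

  mate-⊞ : ∀ x e h k → mate x e (λ y → h y ⊞ k y) ≡ mate x e h ⊞ mate x e k
  mate-⊞ x (a , b) h k = trans (cong₂ _⊞_ (on-⊞ (a ≡ᵇ x) _ _) (on-⊞ (b ≡ᵇ x) _ _)) (LoopedMatchings.interchange _ _ _ _)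

  S-mate : ∀ x e w (h : V → List (V × V) → F₃) →
    S w (λ _ v → mate x e (λ y → h y v)) ≡ mate x e (λ y → S w (λ _ v → h y v))
  S-mate x (a , b) w h = trans (S-+ w _ _) (cong₂ _⊞_ (S-on (a ≡ᵇ x) w _) (S-on (b ≡ᵇ x) w _))

  removeAt : ∀ {n} → Vec V (suc n) → Fin (suc n) → Vec V n
  removeAt (x ∷ X) zero = X
  removeAt {suc n} (x ∷ X) (suc j) = x ∷ removeAt X j

  -- Reads a word of edges along the vertex order X: the face it spells is fed to θ, with the
  -- sign of the permutation that sorts the edges by their first vertex in X.
  Φ : ∀ n → Vec V n → Fun n → List (V × V) → F₃
  Π : ∀ n → Vec V n → Fun (suc n) → V → List (V × V) → F₃
  Φ zero [] θ [] = θ nil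
  Φ zero [] θ (_ ∷ _) = 0₃
  Φ (suc n) (x ∷ X) θ w =
    on (absent x w) (Φ n X (θ ∘ free) w) ⊞ S w (λ e v → mate x e (λ y → Π n X θ y v))
  Π zero X θ y v = 0₃
  Π (suc n) X θ y v = ∑ (suc n) (λ j → on (lookup X j ≡ᵇ y) (Φ n (removeAt X j) (θ ∘ edge j) v))

  Φ-cong : ∀ n X {θ η : Fun n} → θ ≗′ η → ∀ w → Φ n X θ w ≡ Φ n X η w
  Π-cong : ∀ n X {θ η : Fun (suc n)} → θ ≗′ η → ∀ y w → Π n X θ y w ≡ Π n X η y w
  Φ-cong zero [] e [] = e nil
  Φ-cong zero [] e (_ ∷ _) = refl
  Φ-cong (suc n) (x ∷ X) e w = cong₂ _⊞_ (cong (on (absent x w)) (Φ-cong n X (e ∘ free) w))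
    (S-cong w (λ { {a , b} {v} _ → cong₂ _⊞_ (cong (on (a ≡ᵇ x)) (Π-cong n X e b v))
                                    (cong (on (b ≡ᵇ x)) (Π-cong n X e a v)) }))
  Π-cong zero X e y w = refl
  Π-cong (suc n) X e y w = ∑-cong (suc n) (λ j → cong (on (lookup X j ≡ᵇ y))
    (Φ-cong n (removeAt X j) (e ∘ edge j) w))

  Φ-sub : ∀ n X (θ η : Fun n) w → Φ n X (θ ⊕′ ⊖ η) w ≡ Φ n X θ w ⊞ ⊟ Φ n X η w
  Π-sub : ∀ n X (θ η : Fun (suc n)) y w → Π n X (θ ⊕′ ⊖ η) y w ≡ Π n X θ y w ⊞ ⊟ Π n X η y w
  Φ-sub zero [] θ η [] = refl
  Φ-sub zero [] θ η (_ ∷ _) = sym (⊞-inverseʳ 0₃)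
  Φ-sub (suc n) (x ∷ X) θ η w = trans (cong₂ _⊞_
      (trans (cong (on (absent x w)) (Φ-sub n X (θ ∘ free) (η ∘ free) w))
        (trans (on-⊞ (absent x w) _ _) (cong₂ _⊞_ refl (on-neg (absent x w) _))))
      (trans (S-cong w (λ { {a , b} {v} _ →
          trans (cong₂ _⊞_ (cong (on (a ≡ᵇ x)) (Π-sub n X θ η b v)) (cong (on (b ≡ᵇ x)) (Π-sub n X θ η a v)))
          (trans (mate-⊞ x (a , b) _ _) (cong₂ _⊞_ refl (mate-⊟ x (a , b) _))) }))
        (trans (S-+ w _ _) (cong₂ _⊞_ refl (S-neg w _)))))
    (trans (LoopedMatchings.interchange _ _ _ _) (cong₂ _⊞_ refl (sym (⊟-⊞ _ _))))
  Π-sub zero X θ η y w = sym (⊞-inverseʳ 0₃)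
  Π-sub (suc n) X θ η y w = trans (∑-cong (suc n) (λ j →
      trans (cong (on (lookup X j ≡ᵇ y)) (Φ-sub n (removeAt X j) (θ ∘ edge j) (η ∘ edge j) w))
        (trans (on-⊞ (lookup X j ≡ᵇ y) _ _) (cong₂ _⊞_ refl (on-neg (lookup X j ≡ᵇ y) _)))))
    (trans (∑-⊞ (suc n) (λ j → on (lookup X j ≡ᵇ y) (Φ n (removeAt X j) (θ ∘ edge j) w))
      (λ j → ⊟ on (lookup X j ≡ᵇ y) (Φ n (removeAt X j) (η ∘ edge j) w)))
      (cong₂ _⊞_ refl (∑-⊟ (suc n) (λ j → on (lookup X j ≡ᵇ y) (Φ n (removeAt X j) (η ∘ edge j) w)))))

  absent-swap : ∀ x u e f v → absent x (u ++ e ∷ f ∷ v) ≡ absent x (u ++ f ∷ e ∷ v)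
  absent-swap x [] e f v with touches x e | touches x f
  ... | true | true = refl
  ... | true | false = refl
  ... | false | true = refl
  ... | false | false = refl
  absent-swap x (h ∷ u) e f v = cong (not (touches x h) ∧_) (absent-swap x u e f v)

  absent-flip : ∀ x u a b v → absent x (u ++ (a , b) ∷ v) ≡ absent x (u ++ (b , a) ∷ v)
  absent-flip x [] a b v = cong (λ t → not t ∧ absent x v) (∨-comm (a ≡ᵇ x) _)
  absent-flip x (h ∷ u) a b v = cong (not (touches x h) ∧_) (absent-flip x u a b v)

  Φ-alternating : ∀ n X θ → Alternating (Φ n X θ)
  Π-alternating : ∀ n X θ y → Alternating (Π n X θ y)
  Φ-alternating zero [] θ = record { swap = sw ; flip = fl }
    where
    sw : ∀ u e f v → Φ zero [] θ (u ++ e ∷ f ∷ v) ≡ ⊟ Φ zero [] θ (u ++ f ∷ e ∷ v)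
    sw [] e f v = sym ⊟0
    sw (_ ∷ u) e f v = sym ⊟0
    fl : ∀ u x y v → Φ zero [] θ (u ++ (x , y) ∷ v) ≡ Φ zero [] θ (u ++ (y , x) ∷ v)
    fl [] x y v = refl
    fl (_ ∷ u) x y v = refl
  Φ-alternating (suc n) (x ∷ X) θ = record
    { swap = λ u e f v → trans (cong₂ _⊞_
        (trans (cong₂ on (absent-swap x u e f v) (swap A u e f v)) (on-neg (absent x (u ++ f ∷ e ∷ v)) _))
        (swap B u e f v)) (sym (⊟-⊞ _ _))
    ; flip = λ u a b v → cong₂ _⊞_ (cong₂ on (absent-flip x u a b v) (flip A u a b v)) (flip B u a b v) }
    where
    A : Alternating (Φ n X (θ ∘ free))
    A = Φ-alternating n X (θ ∘ free)
    C : ∀ y → Alternating (Π n X θ y)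
    C = Π-alternating n X θ
    B : Alternating (λ w → S w (λ e v → mate x e (λ y → Π n X θ y v)))
    B = S-alternating
      (λ { (a , b) → record
        { swap = λ u e f v → trans (cong₂ _⊞_ (swap (on-alternating (a ≡ᵇ x) (C b)) u e f v)
                                              (swap (on-alternating (b ≡ᵇ x) (C a)) u e f v)) (sym (⊟-⊞ _ _))
        ; flip = λ u c d v → cong₂ _⊞_ (flip (on-alternating (a ≡ᵇ x) (C b)) u c d v)
                                       (flip (on-alternating (b ≡ᵇ x) (C a)) u c d v) } })
      (λ a b w → Coefficients.comm F₃ᴷ _ _)
  Π-alternating zero X θ y = record { swap = λ _ _ _ _ → sym ⊟0 ; flip = λ _ _ _ _ → refl }
  Π-alternating (suc n) X θ y = record
    { swap = λ u e f v → trans (∑-cong (suc n) (λ j →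
        swap (on-alternating (lookup X j ≡ᵇ y) (Φ-alternating n (removeAt X j) (θ ∘ edge j))) u e f v))
        (∑-⊟ (suc n) (λ j → on (lookup X j ≡ᵇ y) (Φ n (removeAt X j) (θ ∘ edge j) (u ++ f ∷ e ∷ v))))
    ; flip = λ u a b v → ∑-cong (suc n) (λ j →
        flip (on-alternating (lookup X j ≡ᵇ y) (Φ-alternating n (removeAt X j) (θ ∘ edge j))) u a b v) }

  Apart : V → V × V → Set
  Apart x (a , b) = a ≢ x × b ≢ x

  data Matched : List (V × V) → Set where
    [] : Matched []
    _∷_ : ∀ {a b w} → (a ≢ b × All (Apart a) w × All (Apart b) w) → Matched w → Matched ((a , b) ∷ w)

  Matched-pick : ∀ {w a b v} → Matched w → Pick w (a , b) v →
    Matched v × (a ≢ b × All (Apart a) v × All (Apart b) v)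
  Matched-pick (h ∷ M) here = M , h
  Matched-pick {w = (c , d) ∷ _} ((c≢d , cs , ds) ∷ M) (there k)
    with Matched-pick M k | All-pick cs k | All-pick ds k
  ... | M′ , a≢b , as , bs | (a≢c , b≢c) , cs′ | (a≢d , b≢d) , ds′ =
    ((c≢d , cs′ , ds′) ∷ M′) , a≢b , ((a≢c ∘ sym , a≢d ∘ sym) ∷ as) , ((b≢c ∘ sym , b≢d ∘ sym) ∷ bs)

  mate-apart : ∀ {x a b} h → Apart x (a , b) → mate x (a , b) h ≡ 0₃
  mate-apart {x} h (a≢x , b≢x) rewrite ≢⇒≡ᵇ a≢x | ≢⇒≡ᵇ b≢x = 0⊞0

  absent-apart : ∀ {x w} → All (Apart x) w → absent x w ≡ true
  absent-apart [] = refl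
  absent-apart {x} ((a≢x , b≢x) ∷ as) rewrite ≢⇒≡ᵇ a≢x | ≢⇒≡ᵇ b≢x = absent-apart as

  lookup-removeAt : ∀ {n} (X : Vec V (suc n)) j i → lookup (removeAt X j) i ≡ lookup X (punchIn j i)
  lookup-removeAt (x ∷ X) zero i = refl
  lookup-removeAt {suc n} (x ∷ X) (suc j) zero = refl
  lookup-removeAt {suc n} (x ∷ X) (suc j) (suc i) = lookup-removeAt X j i

  lookup-removeAt-pinch : ∀ {n} (X : Vec V (suc (suc n))) j i →
    lookup (removeAt X (punchIn j i)) (pinch i j) ≡ lookup X j
  lookup-removeAt-pinch (x ∷ y ∷ X) zero i = refl
  lookup-removeAt-pinch (x ∷ y ∷ X) (suc j) zero = refl
  lookup-removeAt-pinch {suc n} (x ∷ X) (suc j) (suc i) = lookup-removeAt-pinch X j i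

  removeAt-removeAt : ∀ {n} (X : Vec V (suc (suc n))) j i →
    removeAt (removeAt X (punchIn j i)) (pinch i j) ≡ removeAt (removeAt X j) i
  removeAt-removeAt (x ∷ y ∷ X) zero i = refl
  removeAt-removeAt (x ∷ y ∷ X) (suc j) zero = refl
  removeAt-removeAt {suc n} (x ∷ X) (suc j) (suc i) = cong (x ∷_) (removeAt-removeAt X j i)

  -- A vertex that the word does not touch can only be read as free, so it may be left out of the
  -- vertex order if the cochain supplies the free vertex instead.
  Φ-skip : ∀ n (X : Vec V (suc n)) j θ {w} → All (Apart (lookup X j)) w →
    Φ (suc n) X θ w ≡ Φ n (removeAt X j) (ins j θ) w
  Π-skip : ∀ n (X : Vec V (suc n)) j (θ : Fun (suc (suc n))) {y w} → y ≢ lookup X j →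
    All (Apart (lookup X j)) w → Π (suc n) X θ y w ≡ Π n (removeAt X j) (ins (suc j) θ) y w
  Φ-skip n (x ∷ X) zero θ {w} as rewrite absent-apart as =
    trans (cong₂ _⊞_ refl (S-0 w (λ { {e} {v} k → mate-apart (λ y → Π n X θ y v) (proj₁ (All-pick as k)) })))
          (⊞-identityʳ _)
  Φ-skip (suc n) (x ∷ X) (suc j) θ {w} as = cong₂ _⊞_
    (cong (on (absent x w)) (Φ-skip n X j (θ ∘ free) as))
    (S-cong w (λ { {a , b} k → cong₂ _⊞_
      (cong (on (a ≡ᵇ x)) (Π-skip n X j θ (proj₂ (proj₁ (All-pick as k))) (proj₂ (All-pick as k))))
      (cong (on (b ≡ᵇ x)) (Π-skip n X j θ (proj₁ (proj₁ (All-pick as k))) (proj₂ (All-pick as k)))) }))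
  Π-skip zero X zero θ {y} {w} y≢ as rewrite ≢⇒≡ᵇ (y≢ ∘ sym) = 0⊞0
  Π-skip (suc n) X j θ {y} {w} y≢ as = trans (∑-punchIn (suc n) j (λ i → on (lookup X i ≡ᵇ y) (Φ (suc n) (removeAt X i) (θ ∘ edge i) w)))
    (trans (cong₂ _⊞_ (cong (λ b → on b (Φ (suc n) (removeAt X j) (θ ∘ edge j) w)) (≢⇒≡ᵇ (y≢ ∘ sym))) (∑-cong (suc n) (λ i →
      cong₂ on (cong (_≡ᵇ y) (sym (lookup-removeAt X j i)))
        (trans (Φ-skip n (removeAt X (punchIn j i)) (pinch i j) (θ ∘ edge (punchIn j i))
                 (subst (λ t → All (Apart t) w) (sym (lookup-removeAt-pinch X j i)) as))
               (cong (λ Y → Φ n Y (ins (pinch i j) (θ ∘ edge (punchIn j i))) w) (removeAt-removeAt X j i))))))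
    (⊞-identityˡ _))

  infix 4 _∈ᵛ_
  _∈ᵛ_ : ∀ {n} → V → Vec V n → Set
  x ∈ᵛ X = ∃ λ j → lookup X j ≡ x

  Distinct : ∀ {n} → Vec V n → Set
  Distinct X = ∀ i j → lookup X i ≡ lookup X j → i ≡ j

  Distinct-tail : ∀ {n x} {X : Vec V n} → Distinct (x ∷ X) → Distinct X
  Distinct-tail d i j e = suc-injective (d (suc i) (suc j) e)

  Distinct-removeAt : ∀ {n} {X : Vec V (suc n)} j → Distinct X → Distinct (removeAt X j)
  Distinct-removeAt {X = X} j d i k e = punchIn-injective j i k (d (punchIn j i) (punchIn j k)
    (trans (sym (lookup-removeAt X j i)) (trans e (lookup-removeAt X j k))))

  Within : ∀ {n} → Vec V n → V × V → Set
  Within X (a , b) = a ∈ᵛ X × b ∈ᵛ X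

  ∈ᵛ-tail : ∀ {n x y} {X : Vec V n} → y ≢ x → y ∈ᵛ x ∷ X → y ∈ᵛ X
  ∈ᵛ-tail y≢x (zero , e) = ⊥-elim (y≢x (sym e))
  ∈ᵛ-tail y≢x (suc j , e) = j , e

  ∈ᵛ-removeAt : ∀ {n y} (X : Vec V (suc n)) j → y ≢ lookup X j → y ∈ᵛ X → y ∈ᵛ removeAt X j
  ∈ᵛ-removeAt {y = y} X j y≢ (i , e) = punchOut j≢i ,
    trans (lookup-removeAt X j (punchOut j≢i)) (trans (cong (lookup X) (punchIn-punchOut j≢i)) e)
    where
    j≢i : j ≢ i
    j≢i refl = y≢ (sym e)

  Within-tail : ∀ {n x w} {X : Vec V n} → All (Apart x) w → All (Within (x ∷ X)) w → All (Within X) w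
  Within-tail [] [] = []
  Within-tail ((a≢x , b≢x) ∷ as) ((a∈ , b∈) ∷ is) = (∈ᵛ-tail a≢x a∈ , ∈ᵛ-tail b≢x b∈) ∷ Within-tail as is

  Within-removeAt : ∀ {n w} (X : Vec V (suc n)) j → All (Apart (lookup X j)) w →
    All (Within X) w → All (Within (removeAt X j)) w
  Within-removeAt X j [] [] = []
  Within-removeAt X j ((a≢ , b≢) ∷ as) ((a∈ , b∈) ∷ is) =
    (∈ᵛ-removeAt X j a≢ a∈ , ∈ᵛ-removeAt X j b≢ b∈) ∷ Within-removeAt X j as is

  apart-absent : ∀ x w → absent x w ≡ true → All (Apart x) w
  apart-absent x [] _ = []
  apart-absent x ((a , b) ∷ w) e with a ≟ x | b ≟ x
  ... | no a≢x | no b≢x = (a≢x , b≢x) ∷ apart-absent x w e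

  touching-absent : ∀ {x w e v} → touches x e ≡ true → Pick w e v → absent x w ≡ false
  touching-absent t here rewrite t = refl
  touching-absent {x} t (there {x = f} k) rewrite touching-absent t k with touches x f
  ... | true = refl
  ... | false = refl

  apart-touches : ∀ {x a b} → Apart x (a , b) → touches x (a , b) ≡ false
  apart-touches (a≢x , b≢x) rewrite ≢⇒≡ᵇ a≢x | ≢⇒≡ᵇ b≢x = refl

  apart-pick-absent : ∀ {x w e v} → touches x e ≡ false → Pick w e v → absent x w ≡ absent x v
  apart-pick-absent t here rewrite t = refl
  apart-pick-absent {x} t (there {x = f} k) = cong (not (touches x f) ∧_) (apart-pick-absent t k)

  -- In a matching, taking out the edge ab uncovers exactly a and b. So afterwards x is uncovered
  -- either because it was so before or because it is an end of ab, and these cases exclude each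
  -- other.
  absent-pick : ∀ x {w a b v} c → Matched w → Pick w (a , b) v →
    on (absent x v) c ≡ on (absent x w) c ⊞ mate x (a , b) (λ _ → c)
  absent-pick x {w} {a} {b} {v} c M k with a ≟ x | b ≟ x | Matched-pick M k
  ... | yes refl | yes refl | _ , a≢b , _ = ⊥-elim (a≢b refl)
  ... | yes refl | no b≢x | _ , a≢b , as , bs
    rewrite absent-apart as | touching-absent {x} {w} {x , b} {v} (cong (_∨ b ≡ᵇ x) (≡ᵇ-refl x)) k
    = sym (trans (⊞-identityˡ _) (⊞-identityʳ _))
  ... | no a≢x | yes refl | _ , a≢b , as , bs
    rewrite absent-apart bs | touching-absent {x} {w} {a , x} {v}
      (trans (cong (a ≡ᵇ x ∨_) (≡ᵇ-refl x)) (∨-zeroʳ _)) k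
    = sym (trans (⊞-identityˡ _) (⊞-identityˡ _))
  ... | no a≢x | no b≢x | _ rewrite apart-pick-absent (apart-touches (a≢x , b≢x)) k
    = sym (trans (cong₂ _⊞_ refl 0⊞0) (⊞-identityʳ _))

  mate-cong : ∀ x a b {h k : V → F₃} → (a ≡ x → h b ≡ k b) → (b ≡ x → h a ≡ k a) →
    mate x (a , b) h ≡ mate x (a , b) k
  mate-cong x a b e₁ e₂ with a ≟ x | b ≟ x
  ... | yes a≡x | yes b≡x = cong₂ _⊞_ (e₁ a≡x) (e₂ b≡x)
  ... | yes a≡x | no _ = cong₂ _⊞_ (e₁ a≡x) refl
  ... | no _ | yes b≡x = cong₂ _⊞_ refl (e₂ b≡x)
  ... | no _ | no _ = refl

  -- `Π` reads cochains at faces that begin with an edge. There `∂*` has two parts, deletion of this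
  -- edge and deletion of something later, and they are separated here into `θᵢ` and `θ∂`.
  onEdges : ∀ {n} → (∀ {k} → Fin (suc k) → Fun (suc (suc k)) → Fun k) → Fun n → Fun n
  onEdges f θ (edge j F) = f j θ F
  onEdges f θ F = 0₃

  θᵢ θ∂ : ∀ {n} → Fun n → Fun n
  θᵢ = onEdges (λ j θ → ins j (θ ∘ free))
  θ∂ = onEdges (λ j θ → ∂* (θ ∘ edge j))

  Π-∂* : ∀ n X (θ : Fun (suc n)) y w → Π n X (∂* θ) y w ≡ Π n X (θᵢ θ) y w ⊞ ⊟ Π n X (θ∂ θ) y w
  Π-∂* zero X θ y w = sym (⊞-inverseʳ 0₃)
  Π-∂* (suc n) X θ y w = Π-sub (suc n) X (θᵢ θ) (θ∂ θ) y w

  Π-free : ∀ n X (θ : Fun (suc n)) {y w} → Distinct X → y ∈ᵛ X → All (Apart y) w →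
    Φ n X (θ ∘ free) w ≡ Π n X (θᵢ θ) y w
  Π-free (suc n) X θ {w = w} d (j , refl) as = trans (Φ-skip n X j (θ ∘ free) as)
    (sym (trans (∑-only (suc n) j
        (λ i → on (lookup X i ≡ᵇ lookup X j) (Φ n (removeAt X i) (ins i (θ ∘ free)) w))
        (λ i i≢j → cong (λ b → on b (Φ n (removeAt X i) (ins i (θ ∘ free)) w)) (≢⇒≡ᵇ (λ e → i≢j (d i j e)))))
      (cong (λ b → on b (Φ n (removeAt X j) (ins j (θ ∘ free)) w)) (≡ᵇ-refl (lookup X j)))))

  -- Take an edge e out of a word and look at the first vertex x. Either x was uncovered already, or
  -- e was the edge at x and x becomes free, or x keeps its edge. The cases give the value of `∂*`
  -- on `free`, the `ins` part on an edge and the `∂*` part on an edge; in the last case two letters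
  -- are taken out, and `S-S` provides the minus sign.
  Φ-δ : ∀ n X θ {w} → Distinct X → Matched w → All (Within X) w → δ (Φ n X θ) w ≡ Φ n X (∂* θ) w
  Π-δ : ∀ n X θ {y w} → Distinct X → Matched w → All (Within X) w → All (Apart y) w →
    S w (λ _ → Π n X θ y) ≡ Π n X (θ∂ θ) y w
  Φ-δ zero [] θ d [] [] = refl
  Φ-δ zero [] θ d (_ ∷ _) (((() , _) , _) ∷ _)
  Φ-δ (suc n) (x ∷ X) θ {w} d M I = trans (S-cong w split)
    (trans (S-+ w (λ e v → on (absent x w) (A v) ⊞ mate x e (λ _ → A v)) (λ _ → B))
    (trans (cong₂ _⊞_ (trans (S-+ w (λ _ v → on (absent x w) (A v)) (λ e v → mate x e (λ _ → A v)))
        (cong₂ _⊞_ part₁ (S-cong w part₂))) part₃)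
    (trans (Coefficients.assoc F₃ᴷ _ _ _) (cong (on (absent x w) (Φ n X (∂* (θ ∘ free)) w) ⊞_) (sym rhs)))))
    where
    A B : List (V × V) → F₃
    A = Φ n X (θ ∘ free)
    B v = S v (λ f u → mate x f (λ y → Π n X θ y u))
    d′ : Distinct X
    d′ = Distinct-tail d
    split : ∀ {e v} → Pick w e v → Φ (suc n) (x ∷ X) θ v ≡
      (on (absent x w) (A v) ⊞ mate x e (λ _ → A v)) ⊞ B v
    split {a , b} {v} k = cong (_⊞ B v) (absent-pick x (A v) M k)
    part₁ : S w (λ _ v → on (absent x w) (A v)) ≡ on (absent x w) (Φ n X (∂* (θ ∘ free)) w)
    part₁ with absent x w in eq
    ... | false = S-0 w (λ _ → refl)
    ... | true = Φ-δ n X (θ ∘ free) d′ M (Within-tail (apart-absent x w eq) I)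
    facts : ∀ {a b v} → Pick w (a , b) v → (a ≡ x → b ∈ᵛ X × All (Apart b) v × All (Within X) v) ×
                                            (b ≡ x → a ∈ᵛ X × All (Apart a) v × All (Within X) v)
    facts {a} {b} {v} k with Matched-pick M k | All-pick I k
    ... | _ , a≢b , as , bs | (a∈ , b∈) , I′ =
      (λ { refl → ∈ᵛ-tail (a≢b ∘ sym) b∈ , bs , Within-tail as I′ }) ,
      (λ { refl → ∈ᵛ-tail a≢b a∈ , as , Within-tail bs I′ })
    part₂ : ∀ {e v} → Pick w e v → mate x e (λ _ → A v) ≡ mate x e (λ y → Π n X (θᵢ θ) y v)
    part₂ {a , b} {v} k = mate-cong x a b
      (λ a≡x → let (b∈ , bs , _) = proj₁ (facts k) a≡x in Π-free n X θ d′ b∈ bs)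
      (λ b≡x → let (a∈ , as , _) = proj₂ (facts k) b≡x in Π-free n X θ d′ a∈ as)
    part₃ : S w (λ _ → B) ≡ ⊟ S w (λ e v → mate x e (λ y → Π n X (θ∂ θ) y v))
    part₃ = trans (S-S w (λ _ f u → mate x f (λ y → Π n X θ y u)))
      (cong ⊟_ (S-cong w (λ { {a , b} {v} k → trans (S-mate x (a , b) v (λ y u → Π n X θ y u))
        (mate-cong x a b
          (λ a≡x → let (b∈ , bs , I′) = proj₁ (facts k) a≡x in Π-δ n X θ d′ (proj₁ (Matched-pick M k)) I′ bs)
          (λ b≡x → let (a∈ , as , I′) = proj₂ (facts k) b≡x in Π-δ n X θ d′ (proj₁ (Matched-pick M k)) I′ as)) })))
    rhs : S w (λ e v → mate x e (λ y → Π n X (∂* θ) y v)) ≡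
          S w (λ e v → mate x e (λ y → Π n X (θᵢ θ) y v)) ⊞ ⊟ S w (λ e v → mate x e (λ y → Π n X (θ∂ θ) y v))
    rhs = trans (S-cong w (λ { {a , b} {v} _ →
        trans (mate-cong x a b (λ _ → Π-∂* n X θ b v) (λ _ → Π-∂* n X θ a v))
        (trans (mate-⊞ x (a , b) (λ y → Π n X (θᵢ θ) y v) (λ y → ⊟ Π n X (θ∂ θ) y v)) (cong₂ _⊞_ refl (mate-⊟ x (a , b) (λ y → Π n X (θ∂ θ) y v)))) }))
      (trans (S-+ w _ _) (cong₂ _⊞_ refl (S-neg w _)))
  Π-δ zero X θ {w = w} d M I as = S-0 w (λ _ → refl)
  Π-δ (suc n) X θ {y} {w} d M I as = trans (S-∑ (suc n) w (λ j v → on (lookup X j ≡ᵇ y) (Φ n (removeAt X j) (θ ∘ edge j) v)))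
    (∑-cong (suc n) each)
    where
    each : ∀ j → S w (λ _ v → on (lookup X j ≡ᵇ y) (Φ n (removeAt X j) (θ ∘ edge j) v)) ≡
                 on (lookup X j ≡ᵇ y) (Φ n (removeAt X j) (∂* (θ ∘ edge j)) w)
    each j with lookup X j ≟ y
    ... | no _ = S-0 w (λ _ → refl)
    ... | yes refl = Φ-δ n (removeAt X j) (θ ∘ edge j) (Distinct-removeAt {X = X} j d) M (Within-removeAt X j as I)

-- Chessboard cycles and products of differences of edges

module Chessboard where

  open Words
  open import Data.Nat.Properties using (suc-injective)

  module _ {V : Set} where

    WordChain : Set
    WordChain = List (ℤ × List (V × V))

    negᶜ : WordChain → WordChain
    negᶜ = map (λ { (a , w) → (-ℤ a , w) })

    prepend : V × V → WordChain → WordChain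
    prepend e = map (λ { (a , w) → (a , e ∷ w) })

    Sᶜ : List V → (V → List V → WordChain) → WordChain
    Sᶜ [] g = []
    Sᶜ (b ∷ B) g = g b B ++ negᶜ (Sᶜ B (λ b′ B′ → g b′ (b ∷ B′)))

    -- the fundamental cycle of the chessboard complex on A × B, followed by t
    chessboard : List V → List V → WordChain → WordChain
    chessboard [] B t = t
    chessboard (a ∷ A) B t = Sᶜ B (λ b B′ → prepend (a , b) (chessboard A B′ t))

    γ : ∀ {r} → Vec (V × V × V) r → WordChain
    γ [] = (1ℤ , []) ∷ []
    γ ((a , b , c) ∷ ts) = prepend (a , b) (γ ts) ++ negᶜ (prepend (b , c) (γ ts))

    signed : Bool → WordChain → WordChain
    signed true c = c
    signed false c = negᶜ c

    prependAll : List (V × V) → WordChain → WordChain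
    prependAll [] t = t
    prependAll (e ∷ w) t = prepend e (prependAll w t)

    combine : List (Bool × List (V × V)) → WordChain → WordChain
    combine [] t = []
    combine ((s , w) ∷ l) t = signed s (prependAll w t) ++ combine l t

  module Chessboards (K : Coefficients) {V : Set} where
    open Coefficients K
    open Functionals K

    private
      Fn : Set
      Fn = List (V × V) → Carrier

    -- The value of Ψ on the chessboard cycle as an iterated alternating sum, so that the laws of
    -- `S` apply without listing the terms of the chain.
    Z : List V → List V → Fn → Carrier
    Z [] B Ψ = Ψ []
    Z (a ∷ A) B Ψ = S B (λ b B′ → Z A B′ (Ψ ∘ ((a , b) ∷_)))

    ∫ : ∀ {r} → Vec (V × V × V) r → Fn → Carrier
    ∫ [] Ψ = Ψ []
    ∫ ((a , b , c) ∷ ts) Ψ = ∫ ts (Ψ ∘ ((a , b) ∷_)) + - ∫ ts (Ψ ∘ ((b , c) ∷_))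

    ± : Bool → Carrier → Carrier
    ± true x = x
    ± false x = - x

    ∑± : List (Bool × List (V × V)) → Fn → Carrier
    ∑± [] Ψ = 0#
    ∑± ((s , w) ∷ l) Ψ = ± s (Ψ w) + ∑± l Ψ

    ⟪⟫-neg : ∀ (c : WordChain {V}) Ψ → ⟪ negᶜ c ⟫ Ψ ≡ - ⟪ c ⟫ Ψ
    ⟪⟫-neg [] Ψ = sym ε⁻¹≈ε
    ⟪⟫-neg ((a , w) ∷ c) Ψ = trans (cong₂ _+_ (neg-· a (Ψ w)) (⟪⟫-neg c Ψ)) (sym (neg-+ _ _))

    ⟪⟫-prepend : ∀ e (c : WordChain {V}) Ψ → ⟪ prepend e c ⟫ Ψ ≡ ⟪ c ⟫ (Ψ ∘ (e ∷_))
    ⟪⟫-prepend e [] Ψ = refl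
    ⟪⟫-prepend e ((a , w) ∷ c) Ψ = cong ((a · Ψ (e ∷ w)) +_) (⟪⟫-prepend e c Ψ)

    ⟪⟫-Sᶜ : ∀ B g Ψ → ⟪ Sᶜ B g ⟫ Ψ ≡ S B (λ b B′ → ⟪ g b B′ ⟫ Ψ)
    ⟪⟫-Sᶜ [] g Ψ = refl
    ⟪⟫-Sᶜ (b ∷ B) g Ψ = trans (⟪⟫-++ (g b B) _ Ψ) (cong (⟪ g b B ⟫ Ψ +_)
      (trans (⟪⟫-neg (Sᶜ B (λ b′ B′ → g b′ (b ∷ B′))) Ψ) (cong -_ (⟪⟫-Sᶜ B _ Ψ))))

    tail : WordChain {V} → Fn → Fn
    tail t Ψ w = ⟪ t ⟫ (λ v → Ψ (w ++ v))

    ⟪⟫-chessboard : ∀ A B t Ψ → ⟪ chessboard A B t ⟫ Ψ ≡ Z A B (tail t Ψ)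
    ⟪⟫-chessboard [] B t Ψ = refl
    ⟪⟫-chessboard (a ∷ A) B t Ψ = trans (⟪⟫-Sᶜ B _ Ψ) (S-cong B (λ {b} {B′} _ →
      trans (⟪⟫-prepend (a , b) (chessboard A B′ t) Ψ) (⟪⟫-chessboard A B′ t (Ψ ∘ ((a , b) ∷_)))))

    ⟪⟫-γ : ∀ {r} (ts : Vec (V × V × V) r) Ψ → ⟪ γ ts ⟫ Ψ ≡ ∫ ts Ψ
    ⟪⟫-γ [] Ψ = trans (identityʳ _) (identityʳ _)
    ⟪⟫-γ ((a , b , c) ∷ ts) Ψ = trans (⟪⟫-++ (prepend (a , b) (γ ts)) _ Ψ) (cong₂ _+_
      (trans (⟪⟫-prepend (a , b) (γ ts) Ψ) (⟪⟫-γ ts _))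
      (trans (⟪⟫-neg (prepend (b , c) (γ ts)) Ψ) (cong -_ (trans (⟪⟫-prepend (b , c) (γ ts) Ψ) (⟪⟫-γ ts _)))))

    ⟪⟫-signed : ∀ s (c : WordChain {V}) Ψ → ⟪ signed s c ⟫ Ψ ≡ ± s (⟪ c ⟫ Ψ)
    ⟪⟫-signed true c Ψ = refl
    ⟪⟫-signed false c Ψ = ⟪⟫-neg c Ψ

    ⟪⟫-prependAll : ∀ w (t : WordChain {V}) Ψ → ⟪ prependAll w t ⟫ Ψ ≡ tail t Ψ w
    ⟪⟫-prependAll [] t Ψ = refl
    ⟪⟫-prependAll (e ∷ w) t Ψ = trans (⟪⟫-prepend e (prependAll w t) Ψ) (⟪⟫-prependAll w t (Ψ ∘ (e ∷_)))

    ⟪⟫-combine : ∀ l t Ψ → ⟪ combine l t ⟫ Ψ ≡ ∑± l (tail t Ψ)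
    ⟪⟫-combine [] t Ψ = refl
    ⟪⟫-combine ((s , w) ∷ l) t Ψ = trans (⟪⟫-++ (signed s (prependAll w t)) _ Ψ) (cong₂ _+_
      (trans (⟪⟫-signed s (prependAll w t) Ψ) (cong (± s) (⟪⟫-prependAll w t Ψ))) (⟪⟫-combine l t Ψ))

    ⟪⟫-cong : ∀ (c : WordChain {V}) {Ψ Ψ′} → All (λ { (_ , w) → Ψ w ≡ Ψ′ w }) c → ⟪ c ⟫ Ψ ≡ ⟪ c ⟫ Ψ′
    ⟪⟫-cong [] [] = refl
    ⟪⟫-cong ((a , w) ∷ c) (e ∷ es) = cong₂ (λ x y → a · x + y) e (⟪⟫-cong c es)

    ⟪⟫-+ : ∀ (c : WordChain {V}) Ψ Ψ′ → ⟪ c ⟫ (λ w → Ψ w + Ψ′ w) ≡ ⟪ c ⟫ Ψ + ⟪ c ⟫ Ψ′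
    ⟪⟫-+ [] Ψ Ψ′ = sym (identityˡ _)
    ⟪⟫-+ ((a , w) ∷ c) Ψ Ψ′ = trans (cong₂ _+_ (·-distrib a (Ψ w) (Ψ′ w)) (⟪⟫-+ c Ψ Ψ′)) (interchange _ _ _ _)

    ⟪⟫-neg′ : ∀ (c : WordChain {V}) Ψ → ⟪ c ⟫ (λ w → - Ψ w) ≡ - ⟪ c ⟫ Ψ
    ⟪⟫-neg′ [] Ψ = sym ε⁻¹≈ε
    ⟪⟫-neg′ ((a , w) ∷ c) Ψ = trans (cong₂ _+_ (·-neg a (Ψ w)) (⟪⟫-neg′ c Ψ)) (sym (neg-+ _ _))

    ⟪⟫-S : ∀ {A : Set} (c : WordChain {V}) (w : List A) (g : A → List A → Fn) →
      ⟪ c ⟫ (λ v → S w (λ e u → g e u v)) ≡ S w (λ e u → ⟪ c ⟫ (g e u))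
    ⟪⟫-S c [] g = zero′ c
      where
      zero′ : ∀ c → ⟪ c ⟫ (λ _ → 0#) ≡ 0#
      zero′ [] = refl
      zero′ ((a , w) ∷ c) = trans (cong₂ _+_ (·-0 a) (zero′ c)) (identityˡ _)
    ⟪⟫-S c (e ∷ w) g = trans (⟪⟫-+ c (g e w) (λ v → - S w (λ f u → g f (e ∷ u) v))) (cong (⟪ c ⟫ (g e w) +_)
      (trans (⟪⟫-neg′ c (λ v → S w (λ f u → g f (e ∷ u) v))) (cong -_ (⟪⟫-S c w _))))

    ⟪⟫-neg^ : ∀ (c : WordChain {V}) (w : List (V × V)) Ψ → ⟪ c ⟫ (λ v → neg^ w (Ψ v)) ≡ neg^ w (⟪ c ⟫ Ψ)
    ⟪⟫-neg^ c [] Ψ = refl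
    ⟪⟫-neg^ c (e ∷ w) Ψ = trans (⟪⟫-neg′ c (λ v → neg^ w (Ψ v))) (cong -_ (⟪⟫-neg^ c w Ψ))

    Cycle : WordChain {V} → Set
    Cycle t = ∀ Ψ → ⟪ t ⟫ (δ Ψ) ≡ 0#

    -- The Leibniz rule for concatenation: a letter is deleted either from `w` or, past all of `w`,
    -- from the tail.
    tail-δ : ∀ t Ψ w → tail t (δ Ψ) w ≡ δ (tail t Ψ) w + neg^ w (⟪ t ⟫ (δ (λ v → Ψ (w ++ v))))
    tail-δ t Ψ w = trans (⟪⟫-cong t (All.universal (λ { (_ , v) → S-++ w v (λ _ → Ψ) }) t))
      (trans (⟪⟫-+ t _ _) (cong₂ _+_ (⟪⟫-S t w (λ _ u v → Ψ (u ++ v)))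
        (⟪⟫-neg^ t w (λ v → S v (λ _ u → Ψ (w ++ u))))))

    neg^-0 : ∀ {A : Set} (w : List A) → neg^ w 0# ≡ 0#
    neg^-0 [] = refl
    neg^-0 (e ∷ w) = trans (cong -_ (neg^-0 w)) ε⁻¹≈ε

    tail-δ-cycle : ∀ {t} → Cycle t → ∀ Ψ w → tail t (δ Ψ) w ≡ δ (tail t Ψ) w
    tail-δ-cycle {t} cy Ψ w = trans (tail-δ t Ψ w) (trans (cong (δ (tail t Ψ) w +_)
      (trans (cong (neg^ w) (cy _)) (neg^-0 w))) (identityʳ _))

    Z-cong : ∀ A B {Ψ Ψ′} → (∀ w → Ψ w ≡ Ψ′ w) → Z A B Ψ ≡ Z A B Ψ′
    Z-cong [] B e = e []
    Z-cong (a ∷ A) B e = S-cong B (λ {b} {B′} _ → Z-cong A B′ (e ∘ ((a , b) ∷_)))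

    Z-+ : ∀ A B Ψ Ψ′ → Z A B (λ w → Ψ w + Ψ′ w) ≡ Z A B Ψ + Z A B Ψ′
    Z-+ [] B Ψ Ψ′ = refl
    Z-+ (a ∷ A) B Ψ Ψ′ = trans (S-cong B (λ {b} {B′} _ → Z-+ A B′ _ _)) (S-+ B _ _)

    Z-neg : ∀ A B Ψ → Z A B (λ w → - Ψ w) ≡ - Z A B Ψ
    Z-neg [] B Ψ = refl
    Z-neg (a ∷ A) B Ψ = trans (S-cong B (λ {b} {B′} _ → Z-neg A B′ _)) (S-neg B _)

    Z-neg^ : ∀ A B Ψ → Z A B (λ w → neg^ w (Ψ w)) ≡ neg^ A (Z A B Ψ)
    Z-neg^ [] B Ψ = refl
    Z-neg^ (a ∷ A) B Ψ = trans (S-cong B (λ {b} {B′} _ →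
        trans (Z-neg A B′ (λ w → neg^ w (Ψ ((a , b) ∷ w)))) (cong -_ (Z-neg^ A B′ _))))
      (trans (S-neg B _) (cong -_ (S-neg^ A B _)))
      where
      S-neg^ : ∀ (A B : List V) (g : V → List V → Carrier) →
        S B (λ b B′ → neg^ A (g b B′)) ≡ neg^ A (S B g)
      S-neg^ [] B g = refl
      S-neg^ (a ∷ A) B g = trans (S-neg B _) (cong -_ (S-neg^ A B g))

    S-Z-0 : ∀ A B Ψ → length B ≡ suc (suc (length A)) → S B (λ _ B′ → Z A B′ Ψ) ≡ 0#
    S-Z-0 [] (b ∷ b′ ∷ []) Ψ refl = trans (cong (Ψ [] +_) (cong -_ (sub-0 (Ψ [])))) (inverseʳ _)
    S-Z-0 (a ∷ A) B Ψ l = trans (S-S B (λ _ b′ B″ → Z A B″ (Ψ ∘ ((a , b′) ∷_))))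
      (trans (cong -_ (S-0 B (λ {b′} {B′} k → S-Z-0 A B′ (Ψ ∘ ((a , b′) ∷_))
        (suc-injective (trans (sym (length-pick k)) l))))) ε⁻¹≈ε)

    Z-δ : ∀ A B Ψ → length B ≡ suc (length A) → Z A B (δ Ψ) ≡ 0#
    Z-δ [] B Ψ l = refl
    Z-δ (a ∷ A) B Ψ l = trans (S-cong B each) (S-Z-0 A B Ψ l)
      where
      each : ∀ {b B′} → Pick B b B′ → Z A B′ (λ w → δ Ψ ((a , b) ∷ w)) ≡ Z A B′ Ψ
      each {b} {B′} k = trans (Z-+ A B′ Ψ _) (trans (cong (Z A B′ Ψ +_)
        (trans (Z-neg A B′ (δ (Ψ ∘ ((a , b) ∷_)))) (trans (cong -_ (Z-δ A B′ (Ψ ∘ ((a , b) ∷_))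
          (suc-injective (trans (sym (length-pick k)) l)))) ε⁻¹≈ε))) (identityʳ _))

    chessboard-∂ : ∀ A B t Ψ → length B ≡ suc (length A) →
      ⟪ chessboard A B t ⟫ (δ Ψ) ≡ neg^ A (Z A B (λ w → ⟪ t ⟫ (δ (λ v → Ψ (w ++ v)))))
    chessboard-∂ A B t Ψ l = trans (⟪⟫-chessboard A B t (δ Ψ)) (trans (Z-cong A B (tail-δ t Ψ))
      (trans (Z-+ A B (δ (tail t Ψ)) _) (trans (cong₂ _+_ (Z-δ A B (tail t Ψ) l) (Z-neg^ A B _)) (identityˡ _))))

    Z-0 : ∀ A B {Ψ} → (∀ w → Ψ w ≡ 0#) → Z A B Ψ ≡ 0#
    Z-0 [] B e = e []
    Z-0 (a ∷ A) B e = S-0 B (λ {b} {B′} _ → Z-0 A B′ (e ∘ ((a , b) ∷_)))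

    chessboard-cycle : ∀ A B {t} → length B ≡ suc (length A) → Cycle t → Cycle (chessboard A B t)
    chessboard-cycle A B {t} l cy Ψ = trans (chessboard-∂ A B t Ψ l)
      (trans (cong (neg^ A) (Z-0 A B (λ w → cy (λ v → Ψ (w ++ v))))) (neg^-0 A))

    ∫-+ : ∀ {r} (ts : Vec (V × V × V) r) Ψ Ψ′ → ∫ ts (λ w → Ψ w + Ψ′ w) ≡ ∫ ts Ψ + ∫ ts Ψ′
    ∫-+ [] Ψ Ψ′ = refl
    ∫-+ ((a , b , c) ∷ ts) Ψ Ψ′ = trans (cong₂ (λ x y → x + - y) (∫-+ ts _ _) (∫-+ ts _ _)) (interchange⁻ᴷ _ _ _ _)

    ∫-neg : ∀ {r} (ts : Vec (V × V × V) r) Ψ → ∫ ts (λ w → - Ψ w) ≡ - ∫ ts Ψ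
    ∫-neg [] Ψ = refl
    ∫-neg ((a , b , c) ∷ ts) Ψ = trans (cong₂ (λ x y → x + - y) (∫-neg ts _) (∫-neg ts _)) (neg-sub _ _)

    ∫-δ : ∀ {r} (ts : Vec (V × V × V) r) Ψ → ∫ ts (δ Ψ) ≡ 0#
    ∫-δ [] Ψ = refl
    ∫-δ ((a , b , c) ∷ ts) Ψ = trans (cong₂ (λ x y → x + - y) (each (a , b)) (each (b , c))) (inverseʳ _)
      where
      each : ∀ e → ∫ ts (λ w → δ Ψ (e ∷ w)) ≡ ∫ ts Ψ
      each e = trans (∫-+ ts Ψ _) (trans (cong (∫ ts Ψ +_) (trans (∫-neg ts (δ (Ψ ∘ (e ∷_))))
        (trans (cong -_ (∫-δ ts (Ψ ∘ (e ∷_)))) ε⁻¹≈ε))) (identityʳ _))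

    γ-cycle : ∀ {r} (ts : Vec (V × V × V) r) → Cycle (γ ts)
    γ-cycle ts Ψ = trans (⟪⟫-γ ts (δ Ψ)) (∫-δ ts Ψ)

    module _ (_==_ : V → V → Bool) where
      open Contraction _==_

      Z-S : ∀ {A′ : Set} A B (w : List A′) (g : A′ → List A′ → Fn) →
        Z A B (λ v → S w (λ e u → g e u v)) ≡ S w (λ e u → Z A B (g e u))
      Z-S A B [] g = Z-0 A B (λ _ → refl)
      Z-S A B (e ∷ w) g = trans (Z-+ A B (g e w) _) (cong (Z A B (g e w) +_)
        (trans (Z-neg A B _) (cong -_ (Z-S A B w _))))

      Z-on : ∀ b A B Ψ → Z A B (λ w → on b (Ψ w)) ≡ on b (Z A B Ψ)
      Z-on true A B Ψ = refl
      Z-on false A B Ψ = Z-0 A B (λ _ → refl)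

      -- To bring the edge of row `a` to the front one passes all earlier rows twice: in the word,
      -- and in the order in which columns are chosen. These signs cancel, so rows are summed by `U`
      -- without sign and only the position of the column counts.
      Z-contract : ∀ e A B Ψ → Z A B (contract e Ψ) ≡
        U A (λ a A′ → S B (λ b B′ → on (same e (a , b)) (Z A′ B′ Ψ)))
      Z-contract e [] B Ψ = refl
      Z-contract e (a ∷ A) B Ψ =
        trans (S-cong B each) (trans (S-+ B _ _) (cong (S B (λ b B′ → on (same e (a , b)) (Z A B′ Ψ)) +_)
          (trans (S-neg B Y) (trans (cong -_ expand) (trans (⁻¹-involutive _) collect)))))
        where
        term : V → V → List V → V → List V → Carrier
        term b a′ A′ b′ B″ = on (same e (a′ , b′)) (Z A′ B″ (Ψ ∘ ((a , b) ∷_)))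
        Y : V → List V → Carrier
        Y b B′ = U A (λ a′ A′ → S B′ (term b a′ A′))
        each : ∀ {b B′} → Pick B b B′ → Z A B′ (λ w → contract e Ψ ((a , b) ∷ w)) ≡
          on (same e (a , b)) (Z A B′ Ψ) + - Y b B′
        each {b} {B′} _ = trans (Z-+ A B′ (λ w → on (same e (a , b)) (Ψ w)) _) (cong₂ _+_ (Z-on (same e (a , b)) A B′ Ψ)
          (trans (Z-neg A B′ (contract e (Ψ ∘ ((a , b) ∷_)))) (cong -_ (Z-contract e A B′ (Ψ ∘ ((a , b) ∷_))))))
        expand : S B Y ≡ - S B (λ b′ B′ → S B′ (λ b B″ → U A (λ a′ A′ → term b a′ A′ b′ B″)))
        expand = trans (S-cong B (λ {b} {B′} _ → U-S A B′ (term b)))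
          (S-S B (λ b b′ B″ → U A (λ a′ A′ → term b a′ A′ b′ B″)))
        collect : S B (λ b′ B′ → S B′ (λ b B″ → U A (λ a′ A′ → term b a′ A′ b′ B″))) ≡
          U A (λ a′ A′ → S B (λ b′ B′ → on (same e (a′ , b′)) (Z (a ∷ A′) B′ Ψ)))
        collect = trans (S-cong B (λ {b′} {B′} _ → sym (U-S A B′ (λ a′ A′ b B″ → term b a′ A′ b′ B″))))
          (trans (sym (U-S A B (λ a′ A′ b′ B′ → S B′ (λ b B″ → term b a′ A′ b′ B″))))
          (U-cong A (λ {a′} {A′} _ → S-cong B (λ {b′} {B′} _ →
            S-on (same e (a′ , b′)) B′ (λ b B″ → Z A′ B″ (Ψ ∘ ((a , b) ∷_)))))))

-- Evaluating functionals on chains of faces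

module Faces where

  open Words
  open import Data.Bool.Properties using (∧-zeroʳ; T-≡)
  open import Data.Integer.Properties using (+-0-isAbelianGroup)
  open import Data.List.Properties using (≡-dec)
  open import Data.Nat.Properties using (suc-injective; ≡ᵇ⇒≡; ≡⇒≡ᵇ; <-trans)
  open import Data.Product.Properties using () renaming (≡-dec to ×-≡-dec)
  open import Function using (Equivalence)

  ℤᴷ : Coefficients
  ℤᴷ = record { isAbelianGroup = +-0-isAbelianGroup }

  module _ {n : ℕ} where

    _≟ᵉ_ : (e f : Edge n) → _
    _≟ᵉ_ = ×-≡-dec _≟ᶠ_ _≟ᶠ_

    _≟ʷ_ : (σ τ : List (Edge n)) → _
    _≟ʷ_ = ≡-dec _≟ᵉ_

    _<ₗ_ : Edge n → Edge n → Set
    (i , j) <ₗ (i′ , j′) = toℕ i < toℕ i′ ⊎ (i ≡ i′ × toℕ j < toℕ j′)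

    T⇒≡ : ∀ {b} → T b → b ≡ true
    T⇒≡ = Equivalence.to T-≡

    ≡⇒T : ∀ {b} → b ≡ true → T b
    ≡⇒T = Equivalence.from T-≡

    =ᶠ-refl : (i : Fin n) → (i =ᶠ i) ≡ true
    =ᶠ-refl i = T⇒≡ (≡⇒≡ᵇ (toℕ i) (toℕ i) refl)

    =ᶠ⇒≡ : (i j : Fin n) → (i =ᶠ j) ≡ true → i ≡ j
    =ᶠ⇒≡ i j e = toℕ-injective (≡ᵇ⇒≡ (toℕ i) (toℕ j) (≡⇒T e))

    ≢⇒=ᶠ : {i j : Fin n} → i ≢ j → (i =ᶠ j) ≡ false
    ≢⇒=ᶠ {i} {j} i≢j with i =ᶠ j in eq
    ... | true = ⊥-elim (i≢j (=ᶠ⇒≡ i j eq))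
    ... | false = refl

    <ₗ⇒lexLt : ∀ {e f} → e <ₗ f → lexLt e f ≡ true
    <ₗ⇒lexLt {i , j} {i′ , j′} (inj₁ lt) rewrite T⇒≡ (<⇒<ᵇ lt) = refl
    <ₗ⇒lexLt {i , j} {i′ , j′} (inj₂ (refl , lt)) rewrite =ᶠ-refl i | T⇒≡ (<⇒<ᵇ lt) with toℕ i <ᵇ toℕ i
    ... | true = refl
    ... | false = refl

    lexLt⇒<ₗ : ∀ {e f} → lexLt e f ≡ true → e <ₗ f
    lexLt⇒<ₗ {i , j} {i′ , j′} eq with toℕ i <ᵇ toℕ i′ in e₁
    ... | true = inj₁ (<ᵇ⇒< _ _ (≡⇒T e₁))
    ... | false with i =ᶠ i′ in e₂
    ... | true = inj₂ (=ᶠ⇒≡ i i′ e₂ , <ᵇ⇒< _ _ (≡⇒T eq))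

    <ₗ-trans : ∀ {e f g} → e <ₗ f → f <ₗ g → e <ₗ g
    <ₗ-trans (inj₁ a) (inj₁ b) = inj₁ (<-trans a b)
    <ₗ-trans (inj₁ a) (inj₂ (refl , _)) = inj₁ a
    <ₗ-trans (inj₂ (refl , _)) (inj₁ b) = inj₁ b
    <ₗ-trans (inj₂ (refl , a)) (inj₂ (refl , b)) = inj₂ (refl , <-trans a b)

    <ₗ-irrefl : ∀ {e} → ¬ e <ₗ e
    <ₗ-irrefl (inj₁ a) = <-irrefl refl a
    <ₗ-irrefl (inj₂ (_ , a)) = <-irrefl refl a

    data Cmp (e f : Edge n) : Set where
      less : e <ₗ f → Cmp e f
      same : e ≡ f → Cmp e f
      greater : f <ₗ e → Cmp e f

    cmpₗ : ∀ e f → Cmp e f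
    cmpₗ (i , j) (i′ , j′) with <-cmp (toℕ i) (toℕ i′)
    ... | tri< a _ _ = less (inj₁ a)
    ... | tri> _ _ a = greater (inj₁ a)
    ... | tri≈ _ e _ with toℕ-injective e | <-cmp (toℕ j) (toℕ j′)
    ... | refl | tri< a _ _ = less (inj₂ (refl , a))
    ... | refl | tri> _ _ a = greater (inj₂ (refl , a))
    ... | refl | tri≈ _ e′ _ = same (cong (_ ,_) (toℕ-injective e′))

    Disjoint : Edge n → Edge n → Set
    Disjoint (i , j) (i′ , j′) = i ≢ i′ × i ≢ j′ × j ≢ i′ × j ≢ j′

    disjoint⇒ : ∀ {e f} → Disjoint e f → disjointE e f ≡ true
    disjoint⇒ {i , j} {i′ , j′} (a , b , c , d)
      rewrite ≢⇒=ᶠ a | ≢⇒=ᶠ b | ≢⇒=ᶠ c | ≢⇒=ᶠ d = refl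

    ⇒disjoint : ∀ {e f} → disjointE e f ≡ true → Disjoint e f
    ⇒disjoint {i , j} {i′ , j′} eq with i =ᶠ i′ in e₁ | i =ᶠ j′ in e₂ | j =ᶠ i′ in e₃ | j =ᶠ j′ in e₄
    ... | false | false | false | false =
      (λ { refl → no-refl i e₁ }) , (λ { refl → no-refl i e₂ }) , (λ { refl → no-refl j e₃ }) , (λ { refl → no-refl j e₄ })
      where
      no-refl : (i : Fin n) → (i =ᶠ i) ≡ false → ⊥
      no-refl i e with trans (sym (=ᶠ-refl i)) e
      ... | ()

    Follows : Edge n → Edge n → Set
    Follows e f = e <ₗ f × Disjoint e f

    data SortedMatching : List (Edge n) → Set where
      [] : SortedMatching []
      _∷_ : ∀ {i j σ} → (toℕ i < toℕ j × All (Follows (i , j)) σ) → SortedMatching σ →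
            SortedMatching ((i , j) ∷ σ)

    ∧-true : ∀ {a b} → a ∧ b ≡ true → a ≡ true × b ≡ true
    ∧-true {true} {true} _ = refl , refl

    isMatching⇒ : ∀ σ → isMatching σ ≡ true → SortedMatching σ
    isMatching⇒ [] _ = []
    isMatching⇒ ((i , j) ∷ σ) eq with ∧-true {toℕ i <ᵇ toℕ j} eq
    ... | e₁ , e₂ with ∧-true {allB _ σ} e₂
    ... | e₃ , e₄ = (<ᵇ⇒< _ _ (≡⇒T e₁) , go σ e₃) ∷ isMatching⇒ σ e₄
      where
      go : ∀ τ → allB (λ e′ → lexLt (i , j) e′ ∧ disjointE (i , j) e′) τ ≡ true → All (Follows (i , j)) τ
      go [] _ = []
      go (f ∷ τ) e with ∧-true {lexLt (i , j) f ∧ disjointE (i , j) f} e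
      ... | e₁ , e₂ with ∧-true {lexLt (i , j) f} e₁
      ... | e₃ , e₄ = (lexLt⇒<ₗ e₃ , ⇒disjoint e₄) ∷ go τ e₂

    ⇒isMatching : ∀ {σ} → SortedMatching σ → isMatching σ ≡ true
    ⇒isMatching [] = refl
    ⇒isMatching {(i , j) ∷ σ} ((lt , as) ∷ M) rewrite T⇒≡ (<⇒<ᵇ lt) | ⇒isMatching M = go as
      where
      go : ∀ {τ} → All (Follows (i , j)) τ →
        allB (λ e′ → lexLt (i , j) e′ ∧ disjointE (i , j) e′) τ ∧ true ≡ true
      go [] = refl
      go {f ∷ τ} ((a , b) ∷ as) rewrite <ₗ⇒lexLt {i , j} {f} a | disjoint⇒ {i , j} {f} b = go as

    isFace⇒ : ∀ {m σ} → isFace m σ ≡ true → SortedMatching σ × length σ ≡ m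
    isFace⇒ {m} {σ} eq with ∧-true {isMatching σ} eq
    ... | e₁ , e₂ = isMatching⇒ σ e₁ , ≡ᵇ⇒≡ (length σ) m (≡⇒T e₂)

    ⇒isFace : ∀ {m σ} → SortedMatching σ → length σ ≡ m → isFace m σ ≡ true
    ⇒isFace {m} M refl rewrite ⇒isMatching M = T⇒≡ (≡⇒≡ᵇ m m refl)

    SortedMatching-pick : ∀ {σ e τ} → SortedMatching σ → Pick σ e τ → SortedMatching τ
    SortedMatching-pick (_ ∷ M) here = M
    SortedMatching-pick ((lt , as) ∷ M) (there k) = (lt , proj₂ (All-pick as k)) ∷ SortedMatching-pick M k

    module Evaluate (K : Coefficients) where
      open Coefficients K
      open Functionals K

      ⟦_⟧ : Chain n → ℕ → (List (Edge n) → Carrier) → Carrier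
      ⟦ [] ⟧ m Ψ = 0#
      ⟦ (a , τ) ∷ c ⟧ m Ψ = on (isFace m τ) (a · Ψ τ) + ⟦ c ⟧ m Ψ

      ⟦⟧-++ : ∀ c d m Ψ → ⟦ c ++ d ⟧ m Ψ ≡ ⟦ c ⟧ m Ψ + ⟦ d ⟧ m Ψ
      ⟦⟧-++ [] d m Ψ = sym (identityˡ _)
      ⟦⟧-++ ((a , w) ∷ c) d m Ψ = trans (cong (on (isFace m w) (a · Ψ w) +_) (⟦⟧-++ c d m Ψ)) (sym (assoc _ _ _))

      ⟦⟧-neg : ∀ c m Ψ → ⟦ neg c ⟧ m Ψ ≡ - ⟦ c ⟧ m Ψ
      ⟦⟧-neg [] m Ψ = sym ε⁻¹≈ε
      ⟦⟧-neg ((a , w) ∷ c) m Ψ = trans (cong₂ _+_ (trans (cong (on (isFace m w)) (neg-· a (Ψ w))) (on-neg (isFace m w) _))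
        (⟦⟧-neg c m Ψ)) (sym (neg-+ _ _))

      ⟦⟧-cong : ∀ c m {Ψ Ψ′} → (∀ {τ} → SortedMatching τ → length τ ≡ m → Ψ τ ≡ Ψ′ τ) →
        ⟦ c ⟧ m Ψ ≡ ⟦ c ⟧ m Ψ′
      ⟦⟧-cong [] m e = refl
      ⟦⟧-cong ((a , τ) ∷ c) m {Ψ} {Ψ′} e = cong₂ _+_ head (⟦⟧-cong c m e)
        where
        head : on (isFace m τ) (a · Ψ τ) ≡ on (isFace m τ) (a · Ψ′ τ)
        head with isFace m τ in eq
        ... | false = refl
        ... | true with isFace⇒ {m} {τ} eq
        ... | M , l = cong (a ·_) (e M l)

      ⟦⟧-faces : ∀ {c m Ψ} → All (λ { (_ , τ) → SortedMatching τ × length τ ≡ m }) c → ⟦ c ⟧ m Ψ ≡ ⟪ c ⟫ Ψ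
      ⟦⟧-faces [] = refl
      ⟦⟧-faces {m = m} {Ψ} (_∷_ {a , τ} (M , l) as) rewrite ⇒isFace M l = cong (a · Ψ τ +_) (⟦⟧-faces as)

      ⟪⟫-map : ∀ e (c : Chain n) Ψ → ⟪ map (λ { (b , σ) → (b , e ∷ σ) }) c ⟫ Ψ ≡ ⟪ c ⟫ (Ψ ∘ (e ∷_))
      ⟪⟫-map e [] Ψ = refl
      ⟪⟫-map e ((a , σ) ∷ c) Ψ = cong (a · Ψ (e ∷ σ) +_) (⟪⟫-map e c Ψ)

      ⟪⟫-bdFace : ∀ a (τ : List (Edge n)) Ψ → ⟪ bdFace a τ ⟫ Ψ ≡ a · δ Ψ τ
      ⟪⟫-bdFace a [] Ψ = sym (·-0 a)
      ⟪⟫-bdFace a (e ∷ τ) Ψ = trans (cong (a · Ψ τ +_) (trans (⟪⟫-map e (bdFace (-ℤ a) τ) Ψ)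
        (trans (⟪⟫-bdFace (-ℤ a) τ (Ψ ∘ (e ∷_))) (trans (neg-· a _) (sym (·-neg a _))))))
        (sym (·-distrib a _ _))

      bdFace-picks : ∀ a (τ : List (Edge n)) → All (λ { (_ , σ) → ∃ λ e → Pick τ e σ }) (bdFace a τ)
      bdFace-picks a [] = []
      bdFace-picks a (e ∷ τ) = (e , here) ∷ go (bdFace-picks (-ℤ a) τ)
        where
        go : ∀ {c} → All (λ { (_ , σ) → ∃ λ e → Pick τ e σ }) c →
          All (λ { (_ , σ) → ∃ λ f → Pick (e ∷ τ) f σ }) (map (λ { (b , σ) → (b , e ∷ σ) }) c)
        go [] = []
        go ((f , k) ∷ as) = (f , there k) ∷ go as

      -- Adjointness of `∂` and `δ`, which turns statements about cycles and boundaries into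
      -- statements about functionals.
      ⟦⟧-∂ : ∀ c m Ψ → ⟦ ∂ (suc m) c ⟧ m Ψ ≡ ⟦ c ⟧ (suc m) (δ Ψ)
      ⟦⟧-∂ [] m Ψ = refl
      ⟦⟧-∂ ((a , τ) ∷ c) m Ψ = trans (⟦⟧-++ (if isFace (suc m) τ then bdFace a τ else []) _ m Ψ)
        (cong₂ _+_ head (⟦⟧-∂ c m Ψ))
        where
        head : ⟦ if isFace (suc m) τ then bdFace a τ else [] ⟧ m Ψ ≡ on (isFace (suc m) τ) (a · δ Ψ τ)
        head with isFace (suc m) τ in eq
        ... | false = refl
        ... | true with isFace⇒ {suc m} {τ} eq
        ... | M , l = trans (⟦⟧-faces (All.map (λ { (e , k) → SortedMatching-pick M k ,
                suc-injective (trans (sym (length-pick k)) l) }) (bdFace-picks a τ)))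
                (⟪⟫-bdFace a τ Ψ)

      ∑ˡ : List (List (Edge n)) → (List (Edge n) → Carrier) → Carrier
      ∑ˡ [] f = 0#
      ∑ˡ (τ ∷ L) f = f τ + ∑ˡ L f

      ∑ˡ-cong : ∀ L {f g} → (∀ τ → f τ ≡ g τ) → ∑ˡ L f ≡ ∑ˡ L g
      ∑ˡ-cong [] e = refl
      ∑ˡ-cong (τ ∷ L) e = cong₂ _+_ (e τ) (∑ˡ-cong L e)

      ∑ˡ-0 : ∀ L {f} → All (λ τ → f τ ≡ 0#) L → ∑ˡ L f ≡ 0#
      ∑ˡ-0 [] [] = refl
      ∑ˡ-0 (τ ∷ L) (e ∷ es) = trans (cong₂ _+_ e (∑ˡ-0 L es)) (identityˡ _)

      ∑ˡ-+ : ∀ L f g → ∑ˡ L (λ τ → f τ + g τ) ≡ ∑ˡ L f + ∑ˡ L g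
      ∑ˡ-+ [] f g = sym (identityˡ _)
      ∑ˡ-+ (τ ∷ L) f g = trans (cong ((f τ + g τ) +_) (∑ˡ-+ L f g)) (interchange _ _ _ _)

      select : ∀ m a τ σ (Ψ : List (Edge n) → Carrier) → (if isFace m τ ∧ does (τ ≟ʷ σ) then a else 0ℤ) · Ψ σ ≡
        on (does (τ ≟ʷ σ)) (on (isFace m τ) (a · Ψ τ))
      select m a τ σ Ψ with τ ≟ʷ σ
      ... | no _ rewrite ∧-zeroʳ (isFace m τ) = refl
      ... | yes refl with isFace m τ
      ... | true = refl
      ... | false = refl

      ∑ˡ-select : ∀ {L τ} x → Unique L → τ ∈ L → ∑ˡ L (λ σ → on (does (τ ≟ʷ σ)) x) ≡ x
      ∑ˡ-select {τ ∷ L} x (u ∷ us) (here refl) rewrite dec-true (τ ≟ʷ τ) refl =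
        trans (cong (x +_) (∑ˡ-0 L (All.map (λ {σ} ne → cong (λ b → on b x) (dec-false (τ ≟ʷ σ) ne)) u))) (identityʳ x)
      ∑ˡ-select {σ ∷ L} {τ} x (u ∷ us) (there τ∈L)
        rewrite dec-false (τ ≟ʷ σ) (λ { refl → All.lookup u τ∈L refl }) = trans (identityˡ _) (∑ˡ-select x us τ∈L)

      -- A formal sum may repeat a face. Grouping its terms along a list without duplicates recovers
      -- the coefficients.
      ⟦⟧-coeff : ∀ {L} → Unique L → ∀ c m Ψ → All (λ { (_ , τ) → τ ∈ L }) c →
        ⟦ c ⟧ m Ψ ≡ ∑ˡ L (λ σ → coeff m c σ · Ψ σ)
      ⟦⟧-coeff {L} u [] m Ψ [] = sym (∑ˡ-0 L (All.universal (λ _ → refl) L))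
      ⟦⟧-coeff {L} u ((a , τ) ∷ c) m Ψ (τ∈L ∷ as) = sym
        (trans (∑ˡ-cong L (λ σ → trans (·-+ (if isFace m τ ∧ does (τ ≟ʷ σ) then a else 0ℤ) (coeff m c σ) (Ψ σ))
                                       (cong (_+ (coeff m c σ · Ψ σ)) (select m a τ σ Ψ))))
        (trans (∑ˡ-+ L (λ σ → on (does (τ ≟ʷ σ)) (on (isFace m τ) (a · Ψ τ))) (λ σ → coeff m c σ · Ψ σ))
               (cong₂ _+_ (∑ˡ-select (on (isFace m τ) (a · Ψ τ)) u τ∈L) (sym (⟦⟧-coeff u c m Ψ as)))))

      -- Equality of integer coefficients is transported to every coefficient group; over F₃ this
      -- lets a cocycle modulo 3 test integral homology.
      ⟦⟧-≈ : ∀ {c c′ m} → c ≈[ m ] c′ → ∀ Ψ → ⟦ c ⟧ m Ψ ≡ ⟦ c′ ⟧ m Ψ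
      ⟦⟧-≈ {c} {c′} {m} eq Ψ = trans (⟦⟧-coeff u c m Ψ (All.tabulate (λ k → ∈-deduplicate⁺ _≟ʷ_ (∈-map⁺ proj₂ (∈-++⁺ˡ k)))))
        (trans (∑ˡ-cong L (λ σ → cong (_· Ψ σ) (eq σ)))
          (sym (⟦⟧-coeff u c′ m Ψ (All.tabulate (λ k → ∈-deduplicate⁺ _≟ʷ_ (∈-map⁺ proj₂ (∈-++⁺ʳ c k)))))))
        where
        L : List (List (Edge n))
        L = deduplicate _≟ʷ_ (map proj₂ (c ++ c′))
        u : Unique L
        u = UniqueDec.deduplicate-! _≟ʷ_ (map proj₂ (c ++ c′))

-- Sorting words into oriented faces

module Normalisation where

  open Words
  open Faces
  open import Data.Nat.Properties using (<-asym)
  open import Function using (mk⇔)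
  open import Relation.Nullary.Decidable using (does-⇔)

  module _ {n : ℕ} where

    open Functionals ℤᴷ using (on; S-0; on-0; sub-0; Alternating; ∷-alternating; δ; δ-alternating; ⟪_⟫; module Contraction)
    open Alternating
    open Contraction {V = Fin n} (λ x y → does (x ≟ᶠ y)) renaming (same to sameᵉ)
    open Evaluate {n} ℤᴷ using (⟦_⟧; ⟦⟧-++; ⟦⟧-neg; ⟦⟧-cong; ⟦⟧-∂)
    open Reading (_≟ᶠ_ {n}) using (Matched; []; _∷_; Apart)
    private module ℤC = Coefficients ℤᴷ

    -- the coordinate of a word at a sorted matching, as an alternating functional
    κ : List (Edge n) → List (Edge n) → ℤ
    κ [] [] = 1ℤ
    κ [] (_ ∷ _) = 0ℤ
    κ (e ∷ σ) = contract e (κ σ)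

    κ-alternating : ∀ σ → Alternating (κ σ)
    κ-alternating [] = record
      { swap = λ { [] _ _ _ → refl ; (_ ∷ _) _ _ _ → refl }
      ; flip = λ { [] _ _ _ → refl ; (_ ∷ _) _ _ _ → refl } }
    κ-alternating (e ∷ σ) = contract-alternating e (κ-alternating σ)

    same-refl : (e : Edge n) → sameᵉ e e ≡ true
    same-refl (x , y) rewrite dec-true (x ≟ᶠ x) refl | dec-true (y ≟ᶠ y) refl = refl

    Proper : Edge n → Set
    Proper (i , j) = toℕ i < toℕ j

    ≢⇒¬same : ∀ {e f} → Proper e → Proper f → e ≢ f →
      sameᵉ e f ≡ false
    ≢⇒¬same {x , y} {a , b} x<y a<b e≢f with a ≟ᶠ x | b ≟ᶠ y | b ≟ᶠ x | a ≟ᶠ y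
    ... | yes refl | yes refl | _ | _ = ⊥-elim (e≢f refl)
    ... | _ | _ | yes refl | yes refl = ⊥-elim (<-asym x<y a<b)
    ... | yes _ | no _ | yes _ | no _ = refl
    ... | yes _ | no _ | no _ | yes _ = refl
    ... | yes _ | no _ | no _ | no _ = refl
    ... | no _ | yes _ | yes _ | no _ = refl
    ... | no _ | yes _ | no _ | yes _ = refl
    ... | no _ | yes _ | no _ | no _ = refl
    ... | no _ | no _ | yes _ | no _ = refl
    ... | no _ | no _ | no _ | yes _ = refl
    ... | no _ | no _ | no _ | no _ = refl

    SortedMatching-proper : ∀ {σ} → SortedMatching σ → All Proper σ
    SortedMatching-proper [] = []
    SortedMatching-proper ((p , _) ∷ M) = p ∷ SortedMatching-proper M

    -- A letter that differs from all edges of `σ` is never contracted, so it remains when `σ` is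
    -- used up, and the final `κ []` rejects a nonempty word.
    κ-0 : ∀ {σ f u w} → Proper f → All Proper σ → All (f ≢_) σ → Pick w f u → κ σ w ≡ 0ℤ
    κ-0 {[]} _ _ _ here = refl
    κ-0 {[]} _ _ _ (there _) = refl
    κ-0 {h ∷ σ} {f} {u} {w} pf (ph ∷ ps) (f≢h ∷ ne) k = S-0 w each
      where
      remains : ∀ {w f u g v} → Pick w f u → Pick w g v → g ≡ f ⊎ ∃ (Pick v f)
      remains here here = inj₁ refl
      remains here (there k) = inj₂ (_ , here)
      remains (there k) here = inj₂ (_ , k)
      remains (there k) (there l) with remains k l
      ... | inj₁ e = inj₁ e
      ... | inj₂ (_ , k′) = inj₂ (_ , there k′)
      each : ∀ {g v} → Pick w g v → on (sameᵉ h g) (κ σ v) ≡ 0ℤ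
      each {g} {v} l with remains k l
      ... | inj₁ refl rewrite ≢⇒¬same {h} {f} ph pf (f≢h ∘ sym) = refl
      ... | inj₂ (_ , k′) = trans (cong (on (sameᵉ h g)) (κ-0 pf ps ne k′)) (on-0 _)

    -- Compare the heads. If they agree, nothing later in `τ` equals `e`. A smaller `e` is missing
    -- from the whole other word. A smaller `f` differs from every edge to be contracted, and `κ-0`
    -- applies.
    κ-coeff : ∀ {σ τ} → SortedMatching σ → SortedMatching τ →
      κ σ τ ≡ (if does (τ ≟ʷ σ) then 1ℤ else 0ℤ)
    κ-coeff [] [] = refl
    κ-coeff [] (_ ∷ _) = refl
    κ-coeff (_ ∷ _) [] = refl
    κ-coeff {e ∷ σ} {f ∷ τ} (_∷_ {i} {j} (p , as) M) (_∷_ {k} {l} (q , bs) N) with cmpₗ e f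
    ... | same refl rewrite same-refl e = trans (cong (λ x → κ σ τ +ℤ (-ℤ x)) (S-0 τ later))
            (trans (sub-0 (κ σ τ)) (trans (κ-coeff M N) step))
      where
      later : ∀ {g v} → Pick τ g v → on (sameᵉ e g) (κ σ (e ∷ v)) ≡ 0ℤ
      later {g} t rewrite ≢⇒¬same {e} {g} p (proj₁ (All-pick (SortedMatching-proper N) t))
        (λ { refl → <ₗ-irrefl (proj₁ (proj₁ (All-pick bs t))) }) = refl
      step : (if does (τ ≟ʷ σ) then 1ℤ else 0ℤ) ≡ (if does ((e ∷ τ) ≟ʷ (e ∷ σ)) then 1ℤ else 0ℤ)
      step = cong (λ b → if b then 1ℤ else 0ℤ) (does-⇔ (mk⇔ (cong (e ∷_)) ∷-injectiveʳ) (τ ≟ʷ σ) ((e ∷ τ) ≟ʷ (e ∷ σ)))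
    ... | less e<f rewrite ≢⇒¬same {e} {f} p q (λ { refl → <ₗ-irrefl e<f }) =
            trans (cong (λ x → 0ℤ +ℤ (-ℤ x)) (S-0 τ later))
                  (cong (λ b → if b then 1ℤ else 0ℤ) (sym (dec-false ((f ∷ τ) ≟ʷ (e ∷ σ)) (λ { refl → <ₗ-irrefl e<f }))))
      where
      later : ∀ {g v} → Pick τ g v → on (sameᵉ e g) (κ σ (f ∷ v)) ≡ 0ℤ
      later {g} t rewrite ≢⇒¬same {e} {g} p (proj₁ (All-pick (SortedMatching-proper N) t))
        (λ { refl → <ₗ-irrefl (<ₗ-trans e<f (proj₁ (proj₁ (All-pick bs t)))) }) = refl
    ... | greater f<e rewrite ≢⇒¬same {e} {f} p q (λ { refl → <ₗ-irrefl f<e }) =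
            trans (cong (λ x → 0ℤ +ℤ (-ℤ x)) (S-0 τ later))
                  (cong (λ b → if b then 1ℤ else 0ℤ) (sym (dec-false ((f ∷ τ) ≟ʷ (e ∷ σ)) (λ { refl → <ₗ-irrefl f<e }))))
      where
      later : ∀ {g v} → Pick τ g v → on (sameᵉ e g) (κ σ (f ∷ v)) ≡ 0ℤ
      later {g} t = trans (cong (on (sameᵉ e g))
        (κ-0 q (SortedMatching-proper M) (All.map (λ { (e<h , _) refl → <ₗ-irrefl (<ₗ-trans f<e e<h) }) as) here)) (on-0 _)

    ×1 : ∀ k → pos k ℤC.· 1ℤ ≡ pos k
    ×1 zero = refl
    ×1 (suc k) = cong (1ℤ +ℤ_) (×1 k)

    ·1 : ∀ a → a ℤC.· 1ℤ ≡ a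
    ·1 (pos k) = ×1 k
    ·1 -[1+ k ] = cong -ℤ_ (×1 (suc k))

    coeff-⟦⟧ : ∀ c m σ → coeff m c σ ≡ ⟦ c ⟧ m (λ τ → if does (τ ≟ʷ σ) then 1ℤ else 0ℤ)
    coeff-⟦⟧ [] m σ = refl
    coeff-⟦⟧ ((a , τ) ∷ c) m σ = cong₂ _+ℤ_ head (coeff-⟦⟧ c m σ)
      where
      head : (if isFace m τ ∧ does (τ ≟ʷ σ) then a else 0ℤ) ≡
             on (isFace m τ) (a ℤC.· (if does (τ ≟ʷ σ) then 1ℤ else 0ℤ))
      head with isFace m τ | does (τ ≟ʷ σ)
      ... | false | _ = refl
      ... | true | true = sym (·1 a)
      ... | true | false = sym (ℤC.·-0 a)

    -- The coordinate at a matching is itself given by an alternating functional, `κ σ`, and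
    -- coefficients at other words are 0. This is what allows words to be reordered freely before
    -- they are sorted.
    ≈-⟦⟧ : ∀ c c′ m → (∀ Ψ → Alternating Ψ → ⟦ c ⟧ m Ψ ≡ ⟦ c′ ⟧ m Ψ) → c ≈[ m ] c′
    ≈-⟦⟧ c c′ m h σ with isMatching σ in eq
    ... | true = trans (via c) (trans (h (κ σ) (κ-alternating σ)) (sym (via c′)))
      where
      via : ∀ c → coeff m c σ ≡ ⟦ c ⟧ m (κ σ)
      via c = trans (coeff-⟦⟧ c m σ) (⟦⟧-cong c m (λ M _ → sym (κ-coeff (isMatching⇒ σ eq) M)))
    ... | false = trans (off c) (sym (off c′))
      where
      off : ∀ c → coeff m c σ ≡ 0ℤ
      off c = trans (coeff-⟦⟧ c m σ) (trans (⟦⟧-cong c m (λ {τ} M _ →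
          cong (λ b → if b then 1ℤ else 0ℤ) (dec-false (τ ≟ʷ σ) (λ { refl → absurd (⇒isMatching M) }))))
        (zero-⟦⟧ c))
        where
        absurd : isMatching σ ≡ true → ⊥
        absurd e with trans (sym e) eq
        ... | ()
        zero-⟦⟧ : ∀ c → ⟦ c ⟧ m (λ _ → 0ℤ) ≡ 0ℤ
        zero-⟦⟧ [] = refl
        zero-⟦⟧ ((a , τ) ∷ c) rewrite ℤC.·-0 a | on-0 (isFace m τ) | zero-⟦⟧ c = refl

    orient : Edge n → Edge n
    orient (i , j) = if toℕ i <ᵇ toℕ j then (i , j) else (j , i)

    insert : Edge n → ℤ → List (Edge n) → ℤ × List (Edge n)
    insert e a [] = a , e ∷ []
    insert e a (f ∷ σ) = if lexLt e f then (a , e ∷ f ∷ σ)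
      else (proj₁ (insert e (-ℤ a) σ) , f ∷ proj₂ (insert e (-ℤ a) σ))

    sort : ℤ → List (Edge n) → ℤ × List (Edge n)
    sort a [] = a , []
    sort a (e ∷ w) = insert (orient e) (proj₁ (sort a w)) (proj₂ (sort a w))

    module Sorting (K : Coefficients) where
      open Functionals K using () renaming (Alternating to Alternatingᴷ; ∷-alternating to ∷-alternatingᴷ)
      open Alternatingᴷ using () renaming (swap to swapᴷ; flip to flipᴷ)
      open Coefficients K

      insert-eval : ∀ {Ψ} → Alternatingᴷ Ψ → ∀ e a σ →
        proj₁ (insert e a σ) · Ψ (proj₂ (insert e a σ)) ≡ a · Ψ (e ∷ σ)
      insert-eval A e a [] = refl
      insert-eval {Ψ} A e a (f ∷ σ) with lexLt e f
      ... | true = refl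
      ... | false = trans (insert-eval (∷-alternatingᴷ A f) e (-ℤ a) σ)
        (trans (neg-· a _) (trans (sym (·-neg a _)) (cong (a ·_) (sym (swapᴷ A [] e f σ)))))

      sort-eval : ∀ {Ψ} → Alternatingᴷ Ψ → ∀ a w → proj₁ (sort a w) · Ψ (proj₂ (sort a w)) ≡ a · Ψ w
      sort-eval A a [] = refl
      sort-eval {Ψ} A a ((i , j) ∷ w) = trans (insert-eval A (orient (i , j)) (proj₁ (sort a w)) (proj₂ (sort a w)))
        (trans (sort-eval (∷-alternatingᴷ A (orient (i , j))) a w) (cong (a ·_) oriented))
        where
        oriented : Ψ (orient (i , j) ∷ w) ≡ Ψ ((i , j) ∷ w)
        oriented with toℕ i <ᵇ toℕ j
        ... | true = refl
        ... | false = flipᴷ A [] j i w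

    Disjoint-sym : ∀ {e f : Edge n} → Disjoint e f → Disjoint f e
    Disjoint-sym (a , b , c , d) = a ∘ sym , c ∘ sym , b ∘ sym , d ∘ sym

    All-insert : ∀ {P : Edge n → Set} {e a σ} → P e → All P σ → All P (proj₂ (insert e a σ))
    All-insert {σ = []} pe [] = pe ∷ []
    All-insert {e = e} {σ = f ∷ σ} pe (pf ∷ ps) with lexLt e f
    ... | true = pe ∷ pf ∷ ps
    ... | false = pf ∷ All-insert pe ps

    insert-sorted : ∀ {e a σ} → Proper e → All (Disjoint e) σ → SortedMatching σ →
      SortedMatching (proj₂ (insert e a σ))
    insert-sorted {σ = []} p [] [] = (p , []) ∷ []
    insert-sorted {e} {a} {f ∷ σ} p (d ∷ ds) ((q , as) ∷ M) with lexLt e f in eq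
    ... | true = (p , (lexLt⇒<ₗ eq , d) ∷ All.zipWith (λ { ((f<g , _) , d′) → <ₗ-trans (lexLt⇒<ₗ eq) f<g , d′ }) (as , ds))
                 ∷ (q , as) ∷ M
    ... | false = (q , All-insert (f<e , Disjoint-sym d) as) ∷ insert-sorted p ds M
      where
      f<e : f <ₗ e
      f<e with cmpₗ e f
      ... | same refl = ⊥-elim (proj₁ d refl)
      ... | greater l = l
      ... | less l with trans (sym (<ₗ⇒lexLt l)) eq
      ... | ()

    insert-length : ∀ e a σ → length (proj₂ (insert e a σ)) ≡ suc (length σ)
    insert-length e a [] = refl
    insert-length e a (f ∷ σ) with lexLt e f
    ... | true = refl
    ... | false = cong suc (insert-length e (-ℤ a) σ)

    sort-length : ∀ a w → length (proj₂ (sort a w)) ≡ length w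
    sort-length a [] = refl
    sort-length a (e ∷ w) = trans (insert-length (orient e) _ (proj₂ (sort a w))) (cong suc (sort-length a w))

    orient-proper : ∀ {i j} → i ≢ j → Proper (orient (i , j))
    orient-proper {i} {j} i≢j with <-cmp (toℕ i) (toℕ j)
    ... | tri< l _ _ rewrite T⇒≡ {n} (<⇒<ᵇ l) = l
    ... | tri≈ _ e _ = ⊥-elim (i≢j (toℕ-injective e))
    ... | tri> nl _ g with toℕ i <ᵇ toℕ j in eq
    ... | true = ⊥-elim (nl (<ᵇ⇒< _ _ (≡⇒T {n} eq)))
    ... | false = g

    All-sort : ∀ {P : Edge n → Set} a {w} → All (P ∘ orient) w → All P (proj₂ (sort a w))
    All-sort a [] = []
    All-sort a (p ∷ ps) = All-insert p (All-sort a ps)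

    sort-sorted : ∀ a {w} → Matched w → SortedMatching (proj₂ (sort a w))
    sort-sorted a [] = []
    sort-sorted a (_∷_ {i} {j} (i≢j , as , bs) M) = insert-sorted (orient-proper i≢j)
      (All-sort a (All.zipWith (λ { {f} (x , y) → disj f x y }) (as , bs))) (sort-sorted a M)
      where
      disj : ∀ f → Apart i f → Apart j f → Disjoint (orient (i , j)) (orient f)
      disj (c , d) (c≢i , d≢i) (c≢j , d≢j) with toℕ i <ᵇ toℕ j | toℕ c <ᵇ toℕ d
      ... | true | true = c≢i ∘ sym , d≢i ∘ sym , c≢j ∘ sym , d≢j ∘ sym
      ... | true | false = d≢i ∘ sym , c≢i ∘ sym , d≢j ∘ sym , c≢j ∘ sym
      ... | false | true = c≢j ∘ sym , d≢j ∘ sym , c≢i ∘ sym , d≢i ∘ sym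
      ... | false | false = d≢j ∘ sym , c≢j ∘ sym , d≢i ∘ sym , c≢i ∘ sym

    MatchedOf : ℕ → Chain n → Set
    MatchedOf m = All (λ { (_ , w) → Matched w × length w ≡ m })

    -- Chains of the complex ignore words that are not lexicographically increasing, so a chain
    -- written in a convenient order must be sorted, with signs, before its boundary means anything.
    normal : Chain n → Chain n
    normal = map (λ { (a , w) → sort a w })

    module _ (K : Coefficients) where
      open Evaluate {n} K using () renaming (⟦_⟧ to ⟦_⟧ᴷ; ⟦⟧-faces to ⟦⟧-facesᴷ)
      open Functionals K using () renaming (⟪_⟫ to ⟪_⟫ᴷ; Alternating to Alternatingᴷ)

      ⟦⟧-normal : ∀ {c m Ψ} → MatchedOf m c → Alternatingᴷ Ψ → ⟦ normal c ⟧ᴷ m Ψ ≡ ⟪ c ⟫ᴷ Ψ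
      ⟦⟧-normal {c} {m} {Ψ} Ms A = trans (⟦⟧-facesᴷ (faces Ms)) (values c)
        where
        faces : ∀ {c} → MatchedOf m c → All (λ { (_ , τ) → SortedMatching τ × length τ ≡ m }) (normal c)
        faces [] = []
        faces (_∷_ {a , w} (M , l) Ms) = (sort-sorted a M , trans (sort-length a w) l) ∷ faces Ms
        values : ∀ c → ⟪ normal c ⟫ᴷ Ψ ≡ ⟪ c ⟫ᴷ Ψ
        values [] = refl
        values ((a , w) ∷ c) = cong₂ (Coefficients._+_ K) (Sorting.sort-eval K A a w) (values c)

    normal-cycle : ∀ {d c} → MatchedOf (suc d) c → (∀ Ψ → ⟪ c ⟫ (δ Ψ) ≡ 0ℤ) → IsCycle n d (normal c)
    normal-cycle {d} {c} Ms h = ≈-⟦⟧ (∂ (suc d) (normal c)) [] d (λ Ψ A →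
      trans (⟦⟧-∂ (normal c) d Ψ) (trans (⟦⟧-normal ℤᴷ Ms (δ-alternating A)) (h Ψ)))

    normal-homologous : ∀ {d} b x y → MatchedOf (suc (suc d)) b →
      (∀ Ψ → Alternating Ψ → ⟪ b ⟫ (δ Ψ) ≡ ⟦ x ⟧ (suc d) Ψ +ℤ (-ℤ ⟦ y ⟧ (suc d) Ψ)) → Homologous n d x y
    normal-homologous {d} b x y Ms h = normal b , ≈-⟦⟧ (∂ (suc (suc d)) (normal b)) (x ++ neg y) (suc d) (λ Ψ A →
      trans (⟦⟧-∂ (normal b) (suc d) Ψ) (trans (⟦⟧-normal ℤᴷ Ms (δ-alternating A))
        (trans (h Ψ A) (sym (trans (⟦⟧-++ x (neg y) (suc d) Ψ) (cong (⟦ x ⟧ (suc d) Ψ +ℤ_) (⟦⟧-neg y (suc d) Ψ)))))))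

    module _ (K : Coefficients) where
      open Coefficients K
      open Functionals K using () renaming (δ to δᴷ)
      open Evaluate {n} K renaming (⟦_⟧ to ⟦_⟧ᴷ; ⟦⟧-≈ to ⟦⟧-≈ᴷ; ⟦⟧-∂ to ⟦⟧-∂ᴷ; ⟦⟧-cong to ⟦⟧-congᴷ; ⟦⟧-++ to ⟦⟧-++ᴷ; ⟦⟧-neg to ⟦⟧-negᴷ) hiding (∑ˡ)

      homologous-eval : ∀ {d} x y → Homologous n d x y → ∀ Ψ →
        (∀ {τ} → SortedMatching τ → length τ ≡ suc (suc d) → δᴷ Ψ τ ≡ 0#) →
        ⟦ x ⟧ᴷ (suc d) Ψ + - ⟦ y ⟧ᴷ (suc d) Ψ ≡ 0#
      homologous-eval {d} x y (b , eq) Ψ cocycle =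
        trans (sym (trans (⟦⟧-++ᴷ x (neg y) (suc d) Ψ) (cong (⟦ x ⟧ᴷ (suc d) Ψ +_) (⟦⟧-negᴷ y (suc d) Ψ))))
        (trans (sym (⟦⟧-≈ᴷ {∂ (suc (suc d)) b} {x ++ neg y} {suc d} eq Ψ)) (trans (⟦⟧-∂ᴷ b (suc d) Ψ) (trans (⟦⟧-congᴷ b (suc (suc d)) cocycle) (zero-eval b))))
        where
        zero-eval : ∀ b → ⟦ b ⟧ᴷ (suc (suc d)) (λ _ → 0#) ≡ 0#
        zero-eval [] = refl
        zero-eval ((a , τ) ∷ b) = trans (cong₂ _+_ (trans (cong (Functionals.on K (isFace (suc (suc d)) τ)) (·-0 a))
          (Functionals.on-0 K (isFace (suc (suc d)) τ))) (zero-eval b)) (identityˡ _)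

    SortedMatching-matched : ∀ {σ} → SortedMatching σ → Matched σ
    SortedMatching-matched [] = []
    SortedMatching-matched ((l , as) ∷ M) = ((λ { refl → <-irrefl refl l }) ,
      All.map (λ { (_ , (a , b , c , d)) → a ∘ sym , b ∘ sym }) as ,
      All.map (λ { (_ , (a , b , c , d)) → c ∘ sym , d ∘ sym }) as) ∷ SortedMatching-matched M

-- Recovering coefficients from the values of contractions

module Independence {V : Set} (_≟_ : DecidableEquality V) where

  open LoopedMatchings hiding (L; interchange)
  open Words
  open Chessboard
  open Reading _≟_
  open import Data.List using (foldl; foldr; reverse)
  open import Data.List.Membership.Propositional using (find)
  open import Data.List.Properties using (reverse-foldl; length-reverse; ++-identityʳ)
  open import Data.List.Relation.Binary.Permutation.Propositional using (↭⇒↭ₛ)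
  open import Data.List.Relation.Binary.Permutation.Propositional.Properties using (↭-singleton-inv;
    drop-∷; ++⁺; ↭-reverse)
  open import Data.List.Relation.Unary.All.Properties using (¬All⇒Any¬; All¬⇒¬Any; ++⁻ˡ)
  open import Data.Nat.Properties using (suc-injective)
  open import Relation.Binary.PropositionalEquality using (setoid)
  open import Data.List.Membership.DecPropositional _≟_ using (_∈?_)
  open import Algebra.Solver.CommutativeMonoid (++-commutativeMonoid {A = V}) using (solve; _⊜_) renaming (_⊕_ to _⊹_)

  open Chessboards F₃ᴷ {V}
  open Contraction _≡ᵇ_

  private
    opaque
      unfolding _⊞_ ⊟_
      -- The Booleans tell which of the three points lie in T. A point of T kills the removals of
      -- the other two, because what remains still contains it; hence at most one of `ry`, `rn`,
      -- `rw` survives, and each case is an identity in one variable.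
      double-remove-law : ∀ a b c (ry rn rw : F₃) → (a ≡ false → ry ≡ 0₃) → (b ≡ false → rn ≡ 0₃) → (c ≡ false → rw ≡ 0₃) →
        (a ≡ true → rn ≡ 0₃ × rw ≡ 0₃) → (b ≡ true → ry ≡ 0₃ × rw ≡ 0₃) → (c ≡ true → ry ≡ 0₃ × rn ≡ 0₃) →
        ry ⊞ ry ≡ ((on (not a) rn ⊞ on (not b) ry) ⊞ (on (not a) rw ⊞ on (not c) ry)) ⊞ ⊟ (on (not b) rw ⊞ on (not c) rn)
      double-remove-law true true c _ _ _ _ _ _ ta tb _ with ta refl | tb refl
      double-remove-law true true true _ _ _ _ _ _ _ _ _ | refl , refl | refl , _ = refl
      double-remove-law true true false _ _ _ _ _ _ _ _ _ | refl , refl | refl , _ = refl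
      double-remove-law true false true _ _ _ _ _ _ ta _ tc with ta refl | tc refl
      ... | refl , refl | refl , _ = refl
      double-remove-law true false false ry _ _ _ _ _ ta _ _ with ta refl
      ... | refl , refl = law (λ { (r ∷ []) → r ⊞ r }) (λ { (r ∷ []) → ((0₃ ⊞ r) ⊞ (0₃ ⊞ r)) ⊞ ⊟ (0₃ ⊞ 0₃) }) (ry ∷ [])
      double-remove-law false true true _ _ _ fa _ _ _ tb tc with tb refl | tc refl
      ... | refl , refl | _ , refl = refl
      double-remove-law false true false _ rn _ _ _ _ _ tb _ with tb refl
      ... | refl , refl = law (λ _ → 0₃) (λ { (r ∷ []) → ((r ⊞ 0₃) ⊞ (0₃ ⊞ 0₃)) ⊞ ⊟ (0₃ ⊞ r) }) (rn ∷ [])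
      double-remove-law false false true _ _ rw _ _ _ _ _ tc with tc refl
      ... | refl , refl = law (λ _ → 0₃) (λ { (r ∷ []) → ((0₃ ⊞ 0₃) ⊞ (r ⊞ 0₃)) ⊞ ⊟ (r ⊞ 0₃) }) (rw ∷ [])
      double-remove-law false false false _ _ _ fa fb fc _ _ _ with fa refl | fb refl | fc refl
      ... | refl | refl | refl = refl

    module F = Coefficients F₃ᴷ

  Unique-resp-↭ : ∀ {xs ys : List V} → xs ↭ ys → Unique xs → Unique ys
  Unique-resp-↭ r = SetoidPermutation.Unique-resp-↭ (setoid V) (↭⇒↭ₛ r)

  Pick-↭ : ∀ {xs : List V} {y ys} → Pick xs y ys → xs ↭ y ∷ ys
  Pick-↭ here = ↭-refl
  Pick-↭ (there {x = x} {y = y} k) = ↭-trans (prep x (Pick-↭ k)) (Perm.swap x y ↭-refl)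

  ∈⇒Pick : ∀ {x} {xs : List V} → x ∈ xs → ∃ (Pick xs x)
  ∈⇒Pick (here refl) = _ , here
  ∈⇒Pick (there i) with ∈⇒Pick i
  ... | _ , k = _ , there k

  Pick-∈ : ∀ {xs : List V} {y ys} → Pick xs y ys → y ∈ xs
  Pick-∈ here = here refl
  Pick-∈ (there k) = there (Pick-∈ k)

  Pick-keeps : ∀ {xs : List V} {y ys x} → Pick xs y ys → x ≢ y → x ∈ xs → x ∈ ys
  Pick-keeps k x≢y i with ∈-resp-↭ (Pick-↭ k) i
  ... | here e = ⊥-elim (x≢y e)
  ... | there j = j

  Pick-⊆ : ∀ {xs : List V} {y ys x} → Pick xs y ys → x ∈ ys → x ∈ xs
  Pick-⊆ k i = ∈-resp-↭ (↭-sym (Pick-↭ k)) (there i)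

  Fn : Set
  Fn = List V → F₃

  mem : V → List V → Bool
  mem x T = does (x ∈? T)

  mem-true : ∀ {x T} → mem x T ≡ true → x ∈ T
  mem-true {x} {T} e with x ∈? T
  ... | yes i = i

  mem-false : ∀ {x T} → mem x T ≡ false → x ∉ T
  mem-false {x} {T} e with x ∈? T
  ... | no n = n

  remove : V → Fn → Fn
  remove x g T = S T (λ b T′ → on (b ≡ᵇ x) (g T′))

  -- The factor contributed by a contracted edge xy: one end is a row and the other lies in T, and
  -- it is taken out of T with the sign of its position.
  step : V → V → Fn → Fn
  step x y g T = on (not (mem x T)) (remove y g T) ⊞ on (not (mem y T)) (remove x g T)

  edges : List (V × V) → Fn → Fn
  edges [] g = g
  edges ((x , y) ∷ E) g = step x y (edges E g)

  empty : Fn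
  empty [] = 1₃
  empty (_ ∷ _) = 0₃

  -- As a left fold it puts the first point innermost, next to `g`, where `double-remove` can trade
  -- it for an edge; linearity carries the relation through the outer points.
  points : List V → Fn → Fn
  points ys g = foldl (λ h y → remove y h) g ys

  remove-cong : ∀ x {g h : Fn} T → (∀ {T′} → Pick T x T′ → g T′ ≡ h T′) → remove x g T ≡ remove x h T
  remove-cong x {g} {h} T e = S-cong T each
    where
    each : ∀ {b T′} → Pick T b T′ → on (b ≡ᵇ x) (g T′) ≡ on (b ≡ᵇ x) (h T′)
    each {b} k with b ≟ x
    ... | yes refl = e k
    ... | no _ = refl

  remove-0 : ∀ x {g : Fn} T → (∀ {T′} → Pick T x T′ → g T′ ≡ 0₃) → remove x g T ≡ 0₃
  remove-0 x {g} T e = trans (remove-cong x {g} {λ _ → 0₃} T e) (S-0 T (λ {b} _ → on-0 (b ≡ᵇ x)))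

  remove-absent : ∀ x {g : Fn} T → x ∉ T → remove x g T ≡ 0₃
  remove-absent x T x∉ = remove-0 x T (λ k → ⊥-elim (x∉ (Pick-∈ k)))

  remove-⊞ : ∀ x (g h : Fn) T → remove x (λ T → g T ⊞ h T) T ≡ remove x g T ⊞ remove x h T
  remove-⊞ x g h T = trans (S-cong T (λ {b} _ → on-⊞ (b ≡ᵇ x) _ _)) (S-+ T _ _)

  remove-⊟ : ∀ x (g : Fn) T → remove x (λ T → ⊟ g T) T ≡ ⊟ remove x g T
  remove-⊟ x g T = trans (S-cong T (λ {b} _ → on-neg (b ≡ᵇ x) _)) (S-neg T _)

  Vanishing : V → Fn → Set
  Vanishing x g = ∀ T → x ∈ T → g T ≡ 0₃

  remove-vanishing : ∀ {x y g} → y ≢ x → Vanishing y g → Vanishing y (remove x g)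
  remove-vanishing {x} y≢x v T y∈ = remove-0 x T (λ {T′} k → v T′ (Pick-keeps k y≢x y∈))

  step-vanishing : ∀ {x y t g} → t ≢ x → t ≢ y → Vanishing t g → Vanishing t (step x y g)
  step-vanishing {x} {y} t≢x t≢y v T t∈ = trans (cong₂ _⊞_
    (trans (cong (on (not (mem x T))) (remove-vanishing t≢y v T t∈)) (on-0 _))
    (trans (cong (on (not (mem y T))) (remove-vanishing t≢x v T t∈)) (on-0 _))) 0⊞0

  verts : List (V × V) → List V
  verts [] = []
  verts ((x , y) ∷ E) = x ∷ y ∷ verts E

  edges-vanishing : ∀ E {t g} → t ∉ verts E → Vanishing t g → Vanishing t (edges E g)
  edges-vanishing [] t∉ v = v
  edges-vanishing ((x , y) ∷ E) t∉ v =
    step-vanishing (λ e → t∉ (here e)) (λ e → t∉ (there (here e)))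
      (edges-vanishing E (λ i → t∉ (there (there i))) v)

  empty-vanishing : ∀ {t} → Vanishing t empty
  empty-vanishing (_ ∷ _) _ = refl

  -- Twice a point is a combination of edges: (y|n) + (y|w) − (n|w) = 2 y, where (a|b) stands for a + b.
  double-remove : ∀ {y n w g} → y ≢ n → y ≢ w → n ≢ w → Vanishing y g → Vanishing n g → Vanishing w g →
    ∀ T → remove y g T ⊞ remove y g T ≡ (step y n g T ⊞ step y w g T) ⊞ ⊟ step n w g T
  double-remove {y} {n} {w} {g} y≢n y≢w n≢w vy vn vw T =
    double-remove-law (mem y T) (mem n T) (mem w T) _ _ _
      (remove-absent y {g} T ∘ mem-false) (remove-absent n {g} T ∘ mem-false) (remove-absent w {g} T ∘ mem-false)
      (λ e → remove-vanishing {n} {y} {g} y≢n vy T (mem-true e) , remove-vanishing {w} {y} {g} y≢w vy T (mem-true e))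
      (λ e → remove-vanishing {y} {n} {g} (y≢n ∘ sym) vn T (mem-true e) , remove-vanishing {w} {n} {g} n≢w vn T (mem-true e))
      (λ e → remove-vanishing {y} {w} {g} (y≢w ∘ sym) vw T (mem-true e) , remove-vanishing {n} {w} {g} (n≢w ∘ sym) vw T (mem-true e))

  points-cong : ∀ ys {g h : Fn} → (∀ T → g T ≡ h T) → ∀ T → points ys g T ≡ points ys h T
  points-cong [] e = e
  points-cong (y ∷ ys) {g} {h} e = points-cong ys (λ T → remove-cong y {g} {h} T (λ {T′} _ → e T′))

  points-⊞ : ∀ ys (g h : Fn) T → points ys (λ T → g T ⊞ h T) T ≡ points ys g T ⊞ points ys h T
  points-⊞ [] g h T = refl
  points-⊞ (y ∷ ys) g h T = trans (points-cong ys (remove-⊞ y g h) T) (points-⊞ ys (remove y g) (remove y h) T)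

  points-⊟ : ∀ ys (g : Fn) T → points ys (λ T → ⊟ g T) T ≡ ⊟ points ys g T
  points-⊟ [] g T = refl
  points-⊟ (y ∷ ys) g T = trans (points-cong ys (remove-⊟ y g) T) (points-⊟ ys (remove y g) T)

  step-cong : ∀ x y {g h : Fn} → (∀ T → g T ≡ h T) → ∀ T → step x y g T ≡ step x y h T
  step-cong x y {g} {h} e T = cong₂ _⊞_ (cong (on (not (mem x T))) (remove-cong y {g} {h} T (λ {T′} _ → e T′)))
    (cong (on (not (mem y T))) (remove-cong x {g} {h} T (λ {T′} _ → e T′)))

  step-⊞ : ∀ x y (g h : Fn) T → step x y (λ T → g T ⊞ h T) T ≡ step x y g T ⊞ step x y h T
  step-⊞ x y g h T = trans (cong₂ _⊞_
    (trans (cong (on (not (mem x T))) (remove-⊞ y g h T)) (on-⊞ (not (mem x T)) _ _))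
    (trans (cong (on (not (mem y T))) (remove-⊞ x g h T)) (on-⊞ (not (mem y T)) _ _))) (LoopedMatchings.interchange _ _ _ _)

  step-⊟ : ∀ x y (g : Fn) T → step x y (λ T → ⊟ g T) T ≡ ⊟ step x y g T
  step-⊟ x y g T = trans (cong₂ _⊞_
    (trans (cong (on (not (mem x T))) (remove-⊟ y g T)) (on-neg (not (mem x T)) _))
    (trans (cong (on (not (mem y T))) (remove-⊟ x g T)) (on-neg (not (mem y T)) _))) (sym (⊟-⊞ _ _))

  Family : Set
  Family = List (ℤ × List V)

  ∑ᶠ : Family → Fn → F₃
  ∑ᶠ [] f = 0₃
  ∑ᶠ ((k , T) ∷ cs) f = k F.· f T ⊞ ∑ᶠ cs f

  ∑ᶠ-cong : ∀ cs {f g : Fn} → All (λ { (_ , T) → f T ≡ g T }) cs → ∑ᶠ cs f ≡ ∑ᶠ cs g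
  ∑ᶠ-cong [] [] = refl
  ∑ᶠ-cong ((k , T) ∷ cs) (e ∷ es) = cong₂ (λ x y → k F.· x ⊞ y) e (∑ᶠ-cong cs es)

  ∑ᶠ-⊞ : ∀ cs (f g : Fn) → ∑ᶠ cs (λ T → f T ⊞ g T) ≡ ∑ᶠ cs f ⊞ ∑ᶠ cs g
  ∑ᶠ-⊞ [] f g = sym 0⊞0
  ∑ᶠ-⊞ ((k , T) ∷ cs) f g = trans (cong₂ _⊞_ (F.·-distrib k (f T) (g T)) (∑ᶠ-⊞ cs f g)) (LoopedMatchings.interchange _ _ _ _)

  ∑ᶠ-⊟ : ∀ cs (f : Fn) → ∑ᶠ cs (λ T → ⊟ f T) ≡ ⊟ ∑ᶠ cs f
  ∑ᶠ-⊟ [] f = sym ⊟0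
  ∑ᶠ-⊟ ((k , T) ∷ cs) f = trans (cong₂ _⊞_ (F.·-neg k (f T)) (∑ᶠ-⊟ cs f)) (sym (⊟-⊞ _ _))

  ∑ᶠ-0 : ∀ cs {f : Fn} → All (λ { (_ , T) → f T ≡ 0₃ }) cs → ∑ᶠ cs f ≡ 0₃
  ∑ᶠ-0 [] [] = refl
  ∑ᶠ-0 ((k , T) ∷ cs) (e ∷ es) = trans (cong₂ (λ x y → k F.· x ⊞ y) e (∑ᶠ-0 cs es)) (trans (cong (_⊞ 0₃) (F.·-0 k)) 0⊞0)

  opaque
    unfolding _⊞_
    halve : ∀ {x} → x ⊞ x ≡ 0₃ → x ≡ 0₃
    halve {0₃} _ = refl

  All⇒∉ : ∀ {x : V} {xs} → All (x ≢_) xs → x ∉ xs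
  All⇒∉ = All¬⇒¬Any

  Unique-++⁻ˡ : ∀ (xs : List V) {ys} → Unique (xs ++ ys) → Unique xs
  Unique-++⁻ˡ [] _ = []
  Unique-++⁻ˡ (x ∷ xs) (h ∷ u) = ++⁻ˡ xs h ∷ Unique-++⁻ˡ xs u

  Unique-++⁻ʳ : ∀ (xs : List V) {ys} → Unique (xs ++ ys) → Unique ys
  Unique-++⁻ʳ [] u = u
  Unique-++⁻ʳ (_ ∷ xs) (_ ∷ u) = Unique-++⁻ʳ xs u

  Unique-++⇒∉ : ∀ (xs : List V) {ys x} → Unique (xs ++ ys) → x ∈ xs → x ∉ ys
  Unique-++⇒∉ (x ∷ xs) (h ∷ _) (here refl) j = All⇒∉ h (∈-++⁺ʳ xs j)
  Unique-++⇒∉ (x ∷ xs) (_ ∷ u) (there i) j = Unique-++⇒∉ xs u i j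

  module _ (p₀ : V) (P : List V) (P! : Unique P) (cs : Family)
    (annihilated : ∀ u t E → u ∷ t ∷ verts E ↭ P → ∑ᶠ cs (step p₀ u (edges E empty)) ≡ 0₃) where

    -- Points still to be traded are in `ys`, spare vertices in `N`. A trade involves a point y and
    -- two spares n, w; each of its three terms joins two of them and returns the third to the
    -- spares, so both lists shrink by one. The excess of one in `N` is the vertex `t` of the
    -- hypothesis.
    annihilated′ : ∀ ys u N E → u ∷ (N ++ ys ++ verts E) ↭ P → length N ≡ suc (length ys) →
      ∑ᶠ cs (step p₀ u (points ys (edges E empty))) ≡ 0₃
    annihilated′ [] u (t ∷ []) E r _ = annihilated u t E r
    annihilated′ (y ∷ ys) u (n ∷ w ∷ N) E r l = halve (trans (sym (∑ᶠ-⊞ cs q₀ q₀))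
      (trans (∑ᶠ-cong cs (All.universal (λ { (_ , T) → pointwise T }) cs))
      (trans (∑ᶠ-⊞ cs _ _) (trans (cong₂ _⊞_ (∑ᶠ-⊞ cs _ _) (∑ᶠ-⊟ cs _))
      (trans (cong₂ _⊞_ (cong₂ _⊞_
          (annihilated′ ys u (w ∷ N) ((y , n) ∷ E) (↭-trans shuffle₁ r) l′)
          (annihilated′ ys u (n ∷ N) ((y , w) ∷ E) (↭-trans shuffle₂ r) l′))
        (cong ⊟_ (annihilated′ ys u (y ∷ N) ((n , w) ∷ E) (↭-trans shuffle₃ r) l′)))
        (trans (cong₂ (λ a b → a ⊞ b) 0⊞0 ⊟0) 0⊞0))))))
      where
      l′ : suc (length N) ≡ suc (length ys)
      l′ = suc-injective l
      shuffle₁ : u ∷ ((w ∷ N) ++ ys ++ verts ((y , n) ∷ E)) ↭ u ∷ ((n ∷ w ∷ N) ++ (y ∷ ys) ++ verts E)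
      shuffle₁ = solve 7 (λ u n w N y ys E → (u ⊹ (w ⊹ N) ⊹ ys ⊹ y ⊹ n ⊹ E) ⊜ (u ⊹ (n ⊹ w ⊹ N) ⊹ (y ⊹ ys) ⊹ E))
        ↭-refl [ u ] [ n ] [ w ] N [ y ] ys (verts E)
      shuffle₂ : u ∷ ((n ∷ N) ++ ys ++ verts ((y , w) ∷ E)) ↭ u ∷ ((n ∷ w ∷ N) ++ (y ∷ ys) ++ verts E)
      shuffle₂ = solve 7 (λ u n w N y ys E → (u ⊹ (n ⊹ N) ⊹ ys ⊹ y ⊹ w ⊹ E) ⊜ (u ⊹ (n ⊹ w ⊹ N) ⊹ (y ⊹ ys) ⊹ E))
        ↭-refl [ u ] [ n ] [ w ] N [ y ] ys (verts E)
      shuffle₃ : u ∷ ((y ∷ N) ++ ys ++ verts ((n , w) ∷ E)) ↭ u ∷ ((n ∷ w ∷ N) ++ (y ∷ ys) ++ verts E)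
      shuffle₃ = solve 7 (λ u n w N y ys E → (u ⊹ (y ⊹ N) ⊹ ys ⊹ n ⊹ w ⊹ E) ⊜ (u ⊹ (n ⊹ w ⊹ N) ⊹ (y ⊹ ys) ⊹ E))
        ↭-refl [ u ] [ n ] [ w ] N [ y ] ys (verts E)
      shuffle₄ : u ∷ ((n ∷ w ∷ N) ++ (y ∷ ys) ++ verts E) ↭ y ∷ n ∷ w ∷ (verts E ++ u ∷ N ++ ys)
      shuffle₄ = solve 7 (λ u n w N y ys E → (u ⊹ (n ⊹ w ⊹ N) ⊹ (y ⊹ ys) ⊹ E) ⊜ (y ⊹ n ⊹ w ⊹ (E ⊹ u ⊹ N ⊹ ys)))
        ↭-refl [ u ] [ n ] [ w ] N [ y ] ys (verts E)
      g q₀ q₁ q₂ q₃ : Fn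
      g = edges E empty
      q₀ = step p₀ u (points (y ∷ ys) g)
      q₁ = step p₀ u (points ys (step y n g))
      q₂ = step p₀ u (points ys (step y w g))
      q₃ = step p₀ u (points ys (step n w g))
      distinct : Unique (y ∷ n ∷ w ∷ (verts E ++ u ∷ N ++ ys))
      distinct = Unique-resp-↭ (↭-trans (↭-sym r) shuffle₄) P!
      local : ∀ T → remove y g T ⊞ remove y g T ≡ (step y n g T ⊞ step y w g T) ⊞ ⊟ step n w g T
      local with distinct
      ... | (y≢n ∷ y≢w ∷ hy) ∷ (n≢w ∷ hn) ∷ hw ∷ _ = double-remove y≢n y≢w n≢w
        (edges-vanishing E (All⇒∉ hy ∘ ∈-++⁺ˡ) empty-vanishing)
        (edges-vanishing E (All⇒∉ hn ∘ ∈-++⁺ˡ) empty-vanishing)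
        (edges-vanishing E (All⇒∉ hw ∘ ∈-++⁺ˡ) empty-vanishing)
      pointwise : ∀ T → q₀ T ⊞ q₀ T ≡ (q₁ T ⊞ q₂ T) ⊞ ⊟ q₃ T
      pointwise T = trans (sym (step-⊞ p₀ u f₀ f₀ T))
        (trans (step-cong p₀ u (λ T → trans (sym (points-⊞ ys (remove y g) (remove y g) T))
           (trans (points-cong ys local T) (trans (points-⊞ ys _ _ T)
             (cong₂ _⊞_ (points-⊞ ys (step y n g) (step y w g) T) (points-⊟ ys (step n w g) T))))) T)
        (trans (step-⊞ p₀ u (λ T → points ys (step y n g) T ⊞ points ys (step y w g) T) (λ T → ⊟ points ys (step n w g) T) T)
          (cong₂ _⊞_ (step-⊞ p₀ u (points ys (step y n g)) (points ys (step y w g)) T)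
                     (step-⊟ p₀ u (points ys (step n w g)) T))))
        where
        f₀ : Fn
        f₀ = points (y ∷ ys) g

  remove-head : ∀ {y T} (g : Fn) → y ∉ T → remove y g (y ∷ T) ≡ g T
  remove-head {y} {T} g y∉ rewrite ≡ᵇ-refl y =
    trans (cong (λ x → g T ⊞ ⊟ x) (remove-absent y {λ T′ → g (y ∷ T′)} T y∉)) (sub-0 (g T))

  removeAll : List V → Fn
  removeAll = foldr remove empty

  removeAll-self : ∀ {T} → Unique T → removeAll T T ≡ 1₃
  removeAll-self [] = refl
  removeAll-self {y ∷ T} (h ∷ u) = trans (remove-head (removeAll T) (All⇒∉ h)) (removeAll-self u)

  removeAll-missing : ∀ {x ys T} → x ∈ ys → x ∉ T → removeAll ys T ≡ 0₃
  removeAll-missing {T = T} (here refl) x∉ = remove-absent _ T x∉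
  removeAll-missing {ys = y ∷ ys} {T} (there i) x∉ =
    remove-0 y T (λ k → removeAll-missing i (x∉ ∘ Pick-⊆ k))

  removeAll-surplus : ∀ {x ys} → x ∉ ys → Vanishing x (removeAll ys)
  removeAll-surplus {ys = []} x∉ = empty-vanishing
  removeAll-surplus {ys = y ∷ ys} x∉ = remove-vanishing (λ e → x∉ (here e)) (removeAll-surplus (λ i → x∉ (there i)))

  data Split : List V → List V → List V → Set where
    [] : Split [] [] []
    left : ∀ {x P A B} → Split P A B → Split (x ∷ P) (x ∷ A) B
    right : ∀ {x P A B} → Split P A B → Split (x ∷ P) A (x ∷ B)

  Split-↭ : ∀ {P A B} → Split P A B → A ++ B ↭ P
  Split-↭ [] = ↭-refl
  Split-↭ (left s) = prep _ (Split-↭ s)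
  Split-↭ (right {x} {P} {A} {B} s) = ↭-trans (shift x A B) (prep x (Split-↭ s))

  Split-⊆ : ∀ {P A B x} → Split P A B → x ∈ B → x ∈ P
  Split-⊆ {A = A} s i = ∈-resp-↭ (Split-↭ s) (∈-++⁺ʳ A i)

  -- Both parts list their elements in the order of the duplicate-free list `P`, so they are
  -- determined by their sets of elements.
  Split-antisym : ∀ {P A B A′ B′} → Unique P → Split P A B → Split P A′ B′ →
    (∀ {x} → x ∈ B → x ∈ B′) → (∀ {x} → x ∈ B′ → x ∈ B) → B ≡ B′
  Split-antisym _ [] [] _ _ = refl
  Split-antisym (h ∷ u) (left s) (left t) f g = Split-antisym u s t f g
  Split-antisym (h ∷ u) (left s) (right t) f g = ⊥-elim (All⇒∉ h (Split-⊆ s (g (here refl))))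
  Split-antisym (h ∷ u) (right s) (left t) f g = ⊥-elim (All⇒∉ h (Split-⊆ t (f (here refl))))
  Split-antisym {x ∷ P} {B = x ∷ B} {B′ = x ∷ B′} (h ∷ u) (right s) (right t) f g =
    cong (x ∷_) (Split-antisym u s t (below f (All⇒∉ h ∘ Split-⊆ s)) (below g (All⇒∉ h ∘ Split-⊆ t)))
    where
    below : ∀ {C D : List V} → (∀ {y} → y ∈ x ∷ C → y ∈ x ∷ D) → x ∉ C → ∀ {y} → y ∈ C → y ∈ D
    below f x∉ i with f (there i)
    ... | here refl = ⊥-elim (x∉ i)
    ... | there j = j

  separate : ∀ (B B′ : List V) → ¬ ((∀ {x} → x ∈ B → x ∈ B′) × (∀ {x} → x ∈ B′ → x ∈ B)) →
    (∃ λ x → x ∈ B × x ∉ B′) ⊎ (∃ λ x → x ∈ B′ × x ∉ B)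
  separate B B′ h with All.all? (_∈? B′) B | All.all? (_∈? B) B′
  ... | yes f | yes g = ⊥-elim (h (All.lookup f , All.lookup g))
  ... | no f | _ with find (¬All⇒Any¬ (_∈? B′) B f)
  ... | x , i , n = inj₁ (x , i , n)
  separate B B′ h | yes _ | no g with find (¬All⇒Any¬ (_∈? B) B′ g)
  ... | x , i , n = inj₂ (x , i , n)

  ∑ᶠ-only : ∀ cs {k T} {f : Fn} → AllPairs (λ { (_ , T) (_ , T′) → T ≢ T′ }) cs → (k , T) ∈ cs →
    All (λ { (_ , T′) → T′ ≢ T → f T′ ≡ 0₃ }) cs → ∑ᶠ cs f ≡ k F.· f T
  ∑ᶠ-only ((k , T) ∷ cs) {f = f} (h ∷ u) (here refl) (_ ∷ es) = trans (cong (k F.· f T ⊞_)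
    (∑ᶠ-0 cs (All.zipWith (λ { (ne , e) → e (ne ∘ sym) }) (h , es)))) (⊞-identityʳ _)
  ∑ᶠ-only ((k′ , T′) ∷ cs) {k} {T} {f} (h ∷ u) (there i) (e ∷ es) = trans (cong₂ _⊞_
    (trans (cong (k′ F.·_) (e (All.lookup h i))) (F.·-0 k′)) (∑ᶠ-only cs u i es)) (⊞-identityˡ _)

  step-outer : ∀ {x y T} (g : Fn) → x ∉ T → step x y g T ≡ remove y g T
  step-outer {x} {y} {T} g x∉ rewrite dec-false (x ∈? T) x∉ =
    trans (cong (λ r → remove y g T ⊞ on (not (mem y T)) r) (remove-absent x {g} T x∉))
          (trans (cong (remove y g T ⊞_) (on-0 _)) (⊞-identityʳ _))

  module _ (p₀ : V) (P : List V) (P! : Unique P) (p₀∉P : p₀ ∉ P) (cs : Family)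
    (splits : All (λ { (_ , T) → ∃ λ A → Split P A T × length A ≡ length T }) cs)
    (distinct : AllPairs (λ { (_ , T) (_ , T′) → T ≢ T′ }) cs)
    (annihilated : ∀ u t E → u ∷ t ∷ verts E ↭ P → ∑ᶠ cs (step p₀ u (edges E empty)) ≡ 0₃) where

    -- Since p₀ lies in no member, `step p₀ u` is removal of `u`. With the complement `A` as spares
    -- and the rest of T as points, the functional becomes `removeAll (u ∷ ys)`: it is 1 on this T
    -- and 0 on every other member. The reversal turns the left fold of `points` into the right fold
    -- of `removeAll`.
    coefficient-0 : ∀ {k u ys} → (k , u ∷ ys) ∈ cs → k F.· 1₃ ≡ 0₃
    coefficient-0 {k} {u} {ys} i with All.lookup splits i
    ... | A , s , l = trans (cong (k F.·_) (sym (removeAll-self T!))) (trans (sym (∑ᶠ-only cs distinct i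
          (All.map (λ { {_ , T′} (A′ , s′ , _) ne → other s′ ne }) splits)))
        (trans (∑ᶠ-cong cs (All.map (λ { {_ , T′} (A′ , s′ , _) → sym (trans (step-outer (points (reverse ys) empty) (p₀∉P ∘ Split-⊆ s′))
            (cong (λ g → remove u g T′) (reverse-foldl (λ h y → remove y h) empty ys))) }) splits))
        (annihilated′ p₀ P P! cs annihilated (reverse ys) u A [] perm (trans l (cong suc (sym (length-reverse ys)))))))
      where
      T! : Unique (u ∷ ys)
      T! = Unique-++⁻ʳ A (Unique-resp-↭ (↭-sym (Split-↭ s)) P!)
      other : ∀ {A′ T′} → Split P A′ T′ → T′ ≢ u ∷ ys → removeAll (u ∷ ys) T′ ≡ 0₃
      other {T′ = T′} s′ ne with separate (u ∷ ys) T′ (λ { (f , g) → ne (sym (Split-antisym P! s s′ f g)) })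
      ... | inj₁ (x , i , n) = removeAll-missing i n
      ... | inj₂ (x , i , n) = removeAll-surplus n T′ i
      perm : u ∷ (A ++ reverse ys ++ []) ↭ P
      perm = ↭-trans (prep u (++⁺ (↭-refl {x = A}) (subst (_↭ ys) (sym (++-identityʳ (reverse ys))) (↭-reverse ys))))
        (↭-trans (↭-sym (shift u A ys)) (Split-↭ s))

  contracts : List (V × V) → (List (V × V) → F₃) → List (V × V) → F₃
  contracts [] Ψ = Ψ
  contracts (e ∷ E) Ψ = contract e (contracts E Ψ)

  U-absent : ∀ x A {f : Fn} → x ∉ A → U A (λ a A′ → on (a ≡ᵇ x) (f A′)) ≡ 0₃
  U-absent x A {f} x∉ = U-0 A (λ {a} {A′} k → cong (λ b → on b (f A′)) (≢⇒≡ᵇ (λ { refl → x∉ (Pick-∈ k) })))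

  U-present : ∀ {x A A₀} {f : Fn} → Unique A → Pick A x A₀ → U A (λ a A′ → on (a ≡ᵇ x) (f A′)) ≡ f A₀
  U-present {x} {_ ∷ A} {f = f} (h ∷ u) here rewrite ≡ᵇ-refl x =
    trans (cong (f A ⊞_) (U-absent x A {λ A′ → f (x ∷ A′)} (All⇒∉ h))) (⊞-identityʳ _)
  U-present {x} {a ∷ A} {f = f} (h ∷ u) (there k) rewrite ≢⇒≡ᵇ {a} {x} (λ { refl → All⇒∉ h (Pick-∈ k) }) =
    trans (⊞-identityˡ _) (U-present u k)

  on-same : ∀ {x y} a b c → x ≢ y → on (same (x , y) (a , b)) c ≡ on (a ≡ᵇ x) (on (b ≡ᵇ y) c) ⊞ on (a ≡ᵇ y) (on (b ≡ᵇ x) c)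
  on-same {x} {y} a b c x≢y with a ≟ x | a ≟ y | b ≟ x | b ≟ y
  ... | yes refl | yes refl | _ | _ = ⊥-elim (x≢y refl)
  ... | yes _ | no _ | _ | yes _ = sym (⊞-identityʳ c)
  ... | yes _ | no _ | yes _ | no _ = sym 0⊞0
  ... | yes _ | no _ | no _ | no _ = sym 0⊞0
  ... | no _ | yes _ | yes _ | _ = sym (⊞-identityˡ c)
  ... | no _ | yes _ | no _ | _ = sym 0⊞0
  ... | no _ | no _ | yes _ | _ = sym 0⊞0
  ... | no _ | no _ | no _ | _ = sym 0⊞0

  module _ (t q s : V) (Ψ : List (V × V) → F₃) (value : Z (t ∷ []) (q ∷ s ∷ []) Ψ ≡ 1₃) where

    -- No contracted edge meets q or s, so one of its ends must be a row and the other a column from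
    -- T. `Z-contract` charges a sign for the column only, which reproduces the recursion of
    -- `edges`. When the edges are used up, the row t and the columns q, s remain.
    Z-contracts : ∀ E A T → A ++ T ↭ t ∷ verts E → Unique (q ∷ s ∷ t ∷ verts E) → length A ≡ suc (length E) →
      Z A (T ++ q ∷ s ∷ []) (contracts E Ψ) ≡ edges E empty T
    Z-contracts [] (a ∷ []) T r _ _ with ↭-singleton-inv r
    ... | refl = value
    Z-contracts ((x , y) ∷ E) A T r u@(q∉ ∷ s∉ ∷ u′) l = trans (Z-contract _≡ᵇ_ (x , y) A (T ++ q ∷ s ∷ []) (contracts E Ψ))
      (trans (U-cong A (λ {a} {A′} _ → trans (S-cong (T ++ q ∷ s ∷ []) (λ {b} {B′} _ → on-same a b _ x≢y))
          (trans (S-+ (T ++ q ∷ s ∷ []) _ _) (cong₂ _⊞_ (S-on (a ≡ᵇ x) (T ++ q ∷ s ∷ []) _) (S-on (a ≡ᵇ y) (T ++ q ∷ s ∷ []) _)))))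
      (trans (U-+ A _ _) (cong₂ _⊞_
        (part x y (λ e → nth q∉ (there (there (there (here refl)))) (sym e)) (λ e → nth s∉ (there (there (here refl))) (sym e)) forward)
        (part y x (λ e → nth q∉ (there (there (here refl))) (sym e)) (λ e → nth s∉ (there (here refl)) (sym e)) backward))))
      where
      nth : ∀ {c xs} → All (c ≢_) xs → ∀ {d} → d ∈ xs → c ≢ d
      nth h i = All.lookup h i
      x≢y : x ≢ y
      x≢y = second u′
        where
        second : ∀ {a b c : V} {cs} → Unique (a ∷ b ∷ c ∷ cs) → b ≢ c
        second (_ ∷ (h ∷ _) ∷ _) = h
      forward : A ++ T ↭ x ∷ y ∷ t ∷ verts E
      forward = ↭-trans r (solve 4 (λ t x y E → (t ⊹ x ⊹ y ⊹ E) ⊜ (x ⊹ y ⊹ t ⊹ E)) ↭-refl [ t ] [ x ] [ y ] (verts E))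
      backward : A ++ T ↭ y ∷ x ∷ t ∷ verts E
      backward = ↭-trans forward (Perm.swap x y ↭-refl)
      AT! : Unique (A ++ T)
      AT! = Unique-resp-↭ (↭-sym r) u′
      A! : Unique A
      A! = Unique-++⁻ˡ A AT!
      next! : Unique (q ∷ s ∷ t ∷ verts E)
      next! = thin u
        where
        thin : ∀ {q s t x y : V} {cs} → Unique (q ∷ s ∷ t ∷ x ∷ y ∷ cs) → Unique (q ∷ s ∷ t ∷ cs)
        thin ((a ∷ b ∷ _ ∷ _ ∷ c) ∷ (d ∷ _ ∷ _ ∷ e) ∷ (_ ∷ _ ∷ f) ∷ _ ∷ _ ∷ g) = (a ∷ b ∷ c) ∷ (d ∷ e) ∷ f ∷ g
      part : ∀ x y → y ≢ q → y ≢ s → A ++ T ↭ x ∷ y ∷ t ∷ verts E →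
        U A (λ a A′ → on (a ≡ᵇ x) (S (T ++ q ∷ s ∷ []) (λ b B′ → on (b ≡ᵇ y) (Z A′ B′ (contracts E Ψ))))) ≡
        on (not (mem x T)) (remove y (edges E empty) T)
      part x y y≢q y≢s r with x ∈? T
      ... | yes x∈T = U-absent x A (λ x∈A → Unique-++⇒∉ A AT! x∈A x∈T)
      ... | no x∉T with ∈-++⁻ A (∈-resp-↭ (↭-sym r) (here refl))
      ... | inj₂ i = ⊥-elim (x∉T i)
      ... | inj₁ x∈A with ∈⇒Pick x∈A
      ... | A₀ , k = trans (U-present A! k) (trans (S-++ T (q ∷ s ∷ []) _)
            (trans (cong₂ _⊞_ (remove-cong y {λ T′ → Z A₀ (T′ ++ q ∷ s ∷ []) (contracts E Ψ)} T inner) outer)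
                   (⊞-identityʳ _)))
        where
        inner : ∀ {T′} → Pick T y T′ → Z A₀ (T′ ++ q ∷ s ∷ []) (contracts E Ψ) ≡ edges E empty T′
        inner {T′} k′ = Z-contracts E A₀ T′ (drop-∷ (drop-∷ (↭-trans (↭-sym rearr) r))) next!
          (suc-injective (trans (sym (↭-length (Pick-↭ k))) l))
          where
          rearr : A ++ T ↭ x ∷ y ∷ (A₀ ++ T′)
          rearr = ↭-trans (++⁺ (Pick-↭ k) (Pick-↭ k′)) (prep x (shift y A₀ T′))
        outer : neg^ T (S (q ∷ s ∷ []) (λ b B′ → on (b ≡ᵇ y) (Z A₀ (T ++ B′) (contracts E Ψ)))) ≡ 0₃
        outer rewrite ≢⇒≡ᵇ (y≢q ∘ sym) | ≢⇒≡ᵇ (y≢s ∘ sym) = trans (cong (neg^ T)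
          (trans (cong (0₃ ⊞_) (trans (cong ⊟_ (sub-0 0₃)) ⊟0)) 0⊞0)) (neg^-0 T)

-- The detecting cocycles and their values

module Detection {V : Set} (_≟_ : DecidableEquality V) where

  open LoopedMatchings hiding (L; interchange)
  open Words
  open Chessboard
  open Reading _≟_
  open Independence _≟_
  open import Data.Fin.Properties using (0≢1+n)
  open import Data.Nat using (_*_)

  open Chessboards F₃ᴷ {V}
  open Contraction _≡ᵇ_

  private
    Fn′ : Set
    Fn′ = List (V × V) → F₃
    module F = Coefficients F₃ᴷ

  contracts-alternating : ∀ E {Ψ} → Alternating Ψ → Alternating (contracts E Ψ)
  contracts-alternating [] a = a
  contracts-alternating (e ∷ E) a = contract-alternating e (contracts-alternating E a)

  -- Words avoiding Y form the matching complex of the other vertices. A cocycle there becomes one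
  -- of a larger complex by contraction, since an occurrence of the edge xy forces the rest of a
  -- matching to avoid x and y.
  VanishesOff : List V → Fn′ → Set
  VanishesOff Y Ψ = ∀ {w} → Matched w → (∀ {y} → y ∈ Y → All (Apart y) w) → Ψ w ≡ 0₃

  same⇒ : ∀ {x y a b} → same (x , y) (a , b) ≡ true → (a ≡ x × b ≡ y) ⊎ (b ≡ x × a ≡ y)
  same⇒ {x} {y} {a} {b} e with a ≟ x | b ≟ y | b ≟ x | a ≟ y
  ... | yes h | yes k | _ | _ = inj₁ (h , k)
  ... | yes _ | no _ | yes h | yes k = inj₂ (h , k)
  ... | no _ | _ | yes h | yes k = inj₂ (h , k)

  contract-vanishes : ∀ {x y Y Ψ} → VanishesOff (x ∷ y ∷ Y) (δ Ψ) → VanishesOff Y (δ (contract (x , y) Ψ))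
  contract-vanishes {x} {y} {Y} {Ψ} h {w} M off = trans (δ-contract (x , y) Ψ w) (trans (cong ⊟_ (S-0 w each)) ⊟0)
    where
    each : ∀ {f v} → Pick w f v → on (same (x , y) f) (δ Ψ v) ≡ 0₃
    each {a , b} {v} k with same (x , y) (a , b) in e
    ... | false = refl
    ... | true with Matched-pick M k
    ... | M′ , _ , as , bs = h M′ avoid
      where
      avoid : ∀ {t} → t ∈ x ∷ y ∷ Y → All (Apart t) v
      avoid i with same⇒ {x} {y} {a} {b} e | i
      ... | inj₁ (refl , refl) | here refl = as
      ... | inj₁ (refl , refl) | there (here refl) = bs
      ... | inj₂ (refl , refl) | here refl = bs
      ... | inj₂ (refl , refl) | there (here refl) = as
      ... | _ | there (there j) = proj₂ (All-pick (off j) k)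

  contracts-vanishes : ∀ E {Y Ψ} → VanishesOff (verts E ++ Y) (δ Ψ) → VanishesOff Y (δ (contracts E Ψ))
  contracts-vanishes [] h = h
  contracts-vanishes ((x , y) ∷ E) {Y} {Ψ} h = contract-vanishes (contracts-vanishes E {x ∷ y ∷ Y}
    (λ M off → h M (λ i → off (move i))))
    where
    move : ∀ {t} → t ∈ x ∷ y ∷ verts E ++ Y → t ∈ verts E ++ x ∷ y ∷ Y
    move (here e) = ∈-++⁺ʳ (verts E) (here e)
    move (there (here e)) = ∈-++⁺ʳ (verts E) (there (here e))
    move (there (there i)) with ∈-++⁻ (verts E) i
    ... | inj₁ j = ∈-++⁺ˡ j
    ... | inj₂ j = ∈-++⁺ʳ (verts E) (there (there j))

  -- A word can spell only free vertices and edges, so reading never meets a face with a loop.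
  Φ-loopless : ∀ n X {θ} → (∀ {F} → Loopless F → θ F ≡ 0₃) → ∀ w → Φ n X θ w ≡ 0₃
  Π-loopless : ∀ n X {θ} → (∀ {F} → Loopless F → θ F ≡ 0₃) → ∀ y w → Π n X θ y w ≡ 0₃
  Φ-loopless zero [] h [] = h nilˡ
  Φ-loopless zero [] h (_ ∷ _) = refl
  Φ-loopless (suc n) (x ∷ X) h w = trans (cong₂ _⊞_
    (trans (cong (on (absent x w)) (Φ-loopless n X (λ l → h (freeˡ l)) w)) (on-0 (absent x w)))
    (S-0 w (λ { {a , b} {v} _ → trans (cong₂ _⊞_
      (trans (cong (on (a ≡ᵇ x)) (Π-loopless n X h b v)) (on-0 (a ≡ᵇ x)))
      (trans (cong (on (b ≡ᵇ x)) (Π-loopless n X h a v)) (on-0 (b ≡ᵇ x)))) 0⊞0 }))) 0⊞0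
  Π-loopless zero X h y w = refl
  Π-loopless (suc n) X h y w = ∑-0 (suc n) (λ j →
    trans (cong (on (lookup X j ≡ᵇ y)) (Φ-loopless n (removeAt X j) (λ l → h (edgeˡ j l)) w)) (on-0 (lookup X j ≡ᵇ y)))

  Φλ-vanishes : ∀ i {n} (X : Vec V n) {Y} → Distinct X → (∀ t → t ∈ Y ⊎ t ∈ᵛ X) →
    VanishesOff Y (δ (Φ n X (λᵉ i)))
  Φλ-vanishes i {n} X {Y} d cover {w} M off = trans (Φ-δ n X (λᵉ i) d M (All.tabulate within))
    (Φ-loopless n X (λᵉ-cocycle i) w)
    where
    within : ∀ {e} → e ∈ w → Within X e
    within {a , b} k = side proj₁ (λ ap → proj₁ ap) , side proj₂ (λ ap → proj₂ ap)
      where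
      side : (π : V × V → V) → (∀ {t} → Apart t (a , b) → π (a , b) ≢ t) → π (a , b) ∈ᵛ X
      side π h with cover (π (a , b))
      ... | inj₂ j = j
      ... | inj₁ i = ⊥-elim (h (All.lookup (off i) k) refl)

  TailApart : V → WordChain → Set
  TailApart x = All (λ { (_ , v) → All (Apart x) v })

  contract-cong : ∀ e {Ψ Ψ′} → (∀ w → Ψ w ≡ Ψ′ w) → ∀ w → contract e Ψ w ≡ contract e Ψ′ w
  contract-cong e h w = S-cong w (λ {f} {v} _ → cong (on (same e f)) (h v))

  ⟪⟫-on : ∀ (c : WordChain) b (Ψ : Fn′) → ⟪ c ⟫ (λ v → on b (Ψ v)) ≡ on b (⟪ c ⟫ Ψ)
  ⟪⟫-on c true Ψ = refl
  ⟪⟫-on [] false Ψ = refl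
  ⟪⟫-on ((k , w) ∷ c) false Ψ = trans (cong₂ _⊞_ (F.·-0 k) (⟪⟫-on c false Ψ)) 0⊞0

  tail-contract : ∀ {x y t} → TailApart x t → TailApart y t → ∀ Ψ w →
    tail t (contract (x , y) Ψ) w ≡ contract (x , y) (tail t Ψ) w
  tail-contract {x} {y} {t} ax ay Ψ w = trans (⟪⟫-cong t (All.zipWith (λ { {k , v} (h , h′) → split v h h′ }) (ax , ay)))
    (trans (⟪⟫-S t w (λ f u v → on (same (x , y) f) (Ψ (u ++ v))))
      (S-cong w (λ {f} {u} _ → ⟪⟫-on t (same (x , y) f) (λ v → Ψ (u ++ v)))))
    where
    split : ∀ v → All (Apart x) v → All (Apart y) v →
      contract (x , y) Ψ (w ++ v) ≡ S w (λ f u → on (same (x , y) f) (Ψ (u ++ v)))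
    split v ax ay = trans (S-++ w v _) (trans (cong (S w (λ f u → on (same (x , y) f) (Ψ (u ++ v))) ⊞_)
      (trans (cong (neg^ w) (S-0 v each)) (neg^-0 w))) (⊞-identityʳ _))
      where
      each : ∀ {f u} → Pick v f u → on (same (x , y) f) (Ψ (w ++ u)) ≡ 0₃
      each {a , b} {u} k with same (x , y) (a , b) in e
      ... | false = refl
      ... | true with same⇒ {x} {y} {a} {b} e | proj₁ (All-pick ax k)
      ... | inj₁ (h , _) | n , _ = ⊥-elim (n h)
      ... | inj₂ (h , _) | _ , n = ⊥-elim (n h)

  -- The tail touches no vertex of the contracted edges, so these can only be found in `w`.
  tail-contracts : ∀ E {t} → (∀ {x} → x ∈ verts E → TailApart x t) → ∀ Ψ w →
    tail t (contracts E Ψ) w ≡ contracts E (tail t Ψ) w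
  tail-contracts [] h Ψ w = refl
  tail-contracts ((x , y) ∷ E) h Ψ w = trans (tail-contract (h (here refl)) (h (there (here refl))) (contracts E Ψ) w)
    (contract-cong (x , y) (tail-contracts E (λ i → h (there (there i))) Ψ) w)

  flat : ∀ {r} → Vec (V × V × V) r → Vec V (r * 3)
  flat [] = []
  flat ((a , b , c) ∷ ts) = a ∷ b ∷ c ∷ flat ts

  Within-there : ∀ {n x} {X : Vec V n} {w} → All (Within X) w → All (Within (x ∷ X)) w
  Within-there = All.map (λ { ((i , e) , (j , f)) → (suc i , e) , (suc j , f) })

  ∫-cong : ∀ {r} (ts : Vec (V × V × V) r) {Ψ Ψ′ : Fn′} →
    (∀ {w} → All (Within (flat ts)) w → Ψ w ≡ Ψ′ w) → ∫ ts Ψ ≡ ∫ ts Ψ′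
  ∫-cong [] h = h []
  ∫-cong ((a , b , c) ∷ ts) h = cong₂ (λ x y → x ⊞ ⊟ y)
    (∫-cong ts (λ W → h (((zero , refl) , (suc zero , refl)) ∷ Within-there (Within-there (Within-there W)))))
    (∫-cong ts (λ W → h (((suc zero , refl) , (suc (suc zero) , refl)) ∷ Within-there (Within-there (Within-there W)))))

  Within-apart : ∀ {n x} {X : Vec V n} → Distinct (x ∷ X) → ∀ {w} → All (Within X) w → All (Apart x) w
  Within-apart d = All.map (λ { ((i , refl) , (j , refl)) → (λ e → 0≢1+n (sym (d (suc i) zero e))) , (λ e → 0≢1+n (sym (d (suc j) zero e))) })

  Φ-free : ∀ {n} x (X : Vec V n) θ {w} → All (Apart x) w → Φ (suc n) (x ∷ X) θ w ≡ Φ n X (θ ∘ free) w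
  Φ-free x X θ as = Φ-skip _ (x ∷ X) zero θ as

  Φ-edge : ∀ {n} a b (X : Vec V n) θ {w} → Distinct (a ∷ b ∷ X) → All (Apart a) w →
    Φ (suc (suc n)) (a ∷ b ∷ X) θ ((a , b) ∷ w) ≡ Φ n X (θ ∘ edge zero) w
  Φ-edge {n} a b X θ {w} d as
    rewrite ≡ᵇ-refl a | ≢⇒≡ᵇ {b} {a} (λ e → 0≢1+n (sym (d (suc zero) zero e))) =
    trans (⊞-identityˡ _) (trans (cong₂ (λ x y → (x ⊞ 0₃) ⊞ ⊟ y)
      (∑-only (suc n) zero (λ j → on (lookup (b ∷ X) j ≡ᵇ b) (Φ n (removeAt (b ∷ X) j) (θ ∘ edge j) w))
        (λ j ne → cong (λ t → on t (Φ n (removeAt (b ∷ X) j) (θ ∘ edge j) w)) (≢⇒≡ᵇ (λ e → ne (Distinct-tail {x = a} d j zero e)))))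
      (S-0 w (λ {e} {v} k → mate-apart (λ y → Π (suc n) (b ∷ X) θ y ((a , b) ∷ v)) (proj₁ (All-pick as k)))))
    (trans (sub-0 _) (trans (⊞-identityʳ _) (cong (λ t → on t (Φ n X (θ ∘ edge zero) w)) (≡ᵇ-refl b)))))

  ∫-Φ : ∀ {r} (ts : Vec (V × V × V) r) θ → Distinct (flat ts) → ∫ ts (Φ (r * 3) (flat ts) θ) ≡ ∫γ r θ
  ∫-Φ [] θ d = refl
  ∫-Φ {suc r} ((a , b , c) ∷ ts) θ d = cong₂ (λ x y → x ⊞ ⊟ y)
    (trans (∫-cong ts (λ W →
        let dc = Distinct-tail {x = b} (Distinct-tail {x = a} d)
            ac = Within-apart dc W
        in trans (Φ-edge a b (c ∷ flat ts) θ d (Within-apart d (Within-there (Within-there W))))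
                 (Φ-free c (flat ts) (θ ∘ edge zero) ac)))
      (∫-Φ ts (θ ∘ edge zero ∘ free) d₃))
    (trans (∫-cong ts (λ W →
        let db = Distinct-tail {x = a} d
        in trans (Φ-free a (b ∷ c ∷ flat ts) θ
                   (Within-apart d (((zero , refl) , (suc zero , refl)) ∷ Within-there (Within-there W))))
                 (Φ-edge b c (flat ts) (θ ∘ free) db (Within-apart db (Within-there W)))))
      (∫-Φ ts (θ ∘ free ∘ edge zero) d₃))
    where
    d₃ : Distinct (flat ts)
    d₃ = Distinct-tail {x = c} (Distinct-tail {x = b} (Distinct-tail {x = a} d))

  ∫-λ : ∀ {r} v (ts : Vec (V × V × V) r) → Distinct (v ∷ flat ts) →
    ∫ ts (Φ (suc (r * 3)) (v ∷ flat ts) (λᵉ r)) ≡ 1₃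
  ∫-λ {r} v ts d = trans (∫-cong ts (λ W → Φ-free v (flat ts) (λᵉ r) (Within-apart d W)))
    (trans (∫-Φ ts (λᵉ r ∘ free) (Distinct-tail {x = v} d)) (∫γ-λ r))

  -- The chessboard with row t and columns q, s is tq - ts, which after reversing an edge is the
  -- factor of the triple (q, t, s). It supplies one factor more than `ts` has, hence the index
  -- `suc r`.
  Z-value : ∀ {r} v q t s (ts : Vec (V × V × V) r) → Distinct (v ∷ q ∷ t ∷ s ∷ flat ts) →
    Z (t ∷ []) (q ∷ s ∷ []) (tail (γ ts) (Φ _ (v ∷ q ∷ t ∷ s ∷ flat ts) (λᵉ (suc r)))) ≡ 1₃
  Z-value {r} v q t s ts d = trans (cong₂ (λ x y → x ⊞ ⊟ y)
      (trans (⟪⟫-γ ts _) (∫-cong ts (λ {w} _ → flip A [] t q w)))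
      (trans (cong₂ (λ x y → x ⊞ ⊟ y) (⟪⟫-γ ts _) refl) (sub-0 _)))
    (∫-λ v ((q , t , s) ∷ ts) d)
    where
    A : Alternating (Φ _ (v ∷ q ∷ t ∷ s ∷ flat ts) (λᵉ (suc r)))
    A = Φ-alternating _ (v ∷ q ∷ t ∷ s ∷ flat ts) (λᵉ (suc r))

-- Supports and sizes of the words

module Supports {V : Set} (_≟_ : DecidableEquality V) where

  open Words
  open Chessboard
  open Reading _≟_ using (Matched; []; _∷_; Apart)
  open Independence _≟_ using (Pick-↭; Unique-resp-↭; All⇒∉)
  open Detection _≟_ using (flat)
  open import Data.List.Relation.Binary.Permutation.Propositional.Properties using () renaming (++⁺
    to ++⁺↭)
  open import Data.List.Relation.Unary.All.Properties using (++⁺)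
  open import Data.Nat using (_+_)

  -- Terms that are not matchings of the right size count for nothing in the complex, so every word
  -- of a constructed chain has to be certified. The vertex list is carried along to prove
  -- disjointness when words are joined.
  record GoodWord (X : List V) (m : ℕ) (w : List (V × V)) : Set where
    constructor good
    field
      matched : Matched w
      inside : All (λ { (a , b) → a ∈ X × b ∈ X }) w
      size : length w ≡ m
  open GoodWord public

  Good : List V → ℕ → WordChain → Set
  Good X m = All (λ { (_ , w) → GoodWord X m w })

  weaken : ∀ {X Y m w} → (∀ {x} → x ∈ X → x ∈ Y) → GoodWord X m w → GoodWord Y m w
  weaken f (good M I l) = good M (All.map (λ { (i , j) → f i , f j }) I) l

  apart : ∀ {x X w} → x ∉ X → All (λ { (a , b) → a ∈ X × b ∈ X }) w → All (Apart x) w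
  apart x∉ = All.map (λ { (i , j) → (λ { refl → x∉ i }) , (λ { refl → x∉ j }) })

  cons-good : ∀ {X m a b w} → a ∉ X → b ∉ X → a ≢ b → GoodWord X m w → GoodWord (a ∷ b ∷ X) (suc m) ((a , b) ∷ w)
  cons-good a∉ b∉ a≢b (good M I l) = good ((a≢b , apart a∉ I , apart b∉ I) ∷ M)
    ((here refl , there (here refl)) ∷ All.map (λ { (i , j) → there (there i) , there (there j) }) I) (cong suc l)

  append-good : ∀ {X Y m k w v} → (∀ {x} → x ∈ Y → x ∉ X) → GoodWord Y k w → GoodWord X m v →
    GoodWord (Y ++ X) (k + m) (w ++ v)
  append-good {X} {Y} {m} {k} {w} {v} disj (good M I l) (good N J l′) = good (join M I)
    (++⁺ (All.map (λ { (i , j) → ∈-++⁺ˡ i , ∈-++⁺ˡ j }) I) (All.map (λ { (i , j) → ∈-++⁺ʳ Y i , ∈-++⁺ʳ Y j }) J))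
    (trans (length-++ w) (cong₂ _+_ l l′))
    where
    join : ∀ {w} → Matched w → All (λ { (a , b) → a ∈ Y × b ∈ Y }) w → Matched (w ++ v)
    join [] [] = N
    join ((a≢b , as , bs) ∷ M) ((i , j) ∷ I) =
      (a≢b , ++⁺ as (apart (disj i) J) , ++⁺ bs (apart (disj j) J)) ∷ join M I

  neg-all : ∀ {P : List (V × V) → Set} {c} → All (λ { (_ , w) → P w }) c → All (λ { (_ , w) → P w }) (negᶜ c)
  neg-all [] = []
  neg-all (h ∷ hs) = h ∷ neg-all hs

  prepend-all : ∀ {P Q : List (V × V) → Set} {e c} → (∀ {w} → P w → Q (e ∷ w)) →
    All (λ { (_ , w) → P w }) c → All (λ { (_ , w) → Q w }) (prepend e c)
  prepend-all f [] = []
  prepend-all f (h ∷ hs) = f h ∷ prepend-all f hs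

  Sᶜ-all : ∀ {P : List (V × V) → Set} B {g : V → List V → WordChain} →
    (∀ {b B′} → Pick B b B′ → All (λ { (_ , w) → P w }) (g b B′)) → All (λ { (_ , w) → P w }) (Sᶜ B g)
  Sᶜ-all [] h = []
  Sᶜ-all {P} (b ∷ B) h = ++⁺ (h here) (neg-all {P} (Sᶜ-all {P} B (λ k → h (there k))))

  chessboard-good : ∀ A B X {m t} → Unique (A ++ B ++ X) → Good X m t →
    Good (A ++ B ++ X) (length A + m) (chessboard A B t)
  chessboard-good [] B X u g = All.map (weaken (∈-++⁺ʳ B)) g
  chessboard-good (a ∷ A) B X {m} {t} u g = Sᶜ-all {GoodWord (a ∷ A ++ B ++ X) (suc (length A + m))} B each
    where
    each : ∀ {b B′} → Pick B b B′ →
      Good (a ∷ A ++ B ++ X) (suc (length A + m)) (prepend (a , b) (chessboard A B′ t))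
    each {b} {B′} k with Unique-resp-↭ perm u
      where
      perm : a ∷ A ++ B ++ X ↭ a ∷ b ∷ (A ++ B′ ++ X)
      perm = prep a (↭-trans (++⁺↭ (↭-refl {x = A}) (++⁺↭ (Pick-↭ k) (↭-refl {x = X}))) (shift b A (B′ ++ X)))
    ... | (a≢b ∷ ha) ∷ hb ∷ u′ = prepend-all {GoodWord (A ++ B′ ++ X) (length A + m)}
          (λ h → weaken (∈-resp-↭ (↭-sym perm)) (cons-good (All⇒∉ ha) (All⇒∉ hb) a≢b h))
          (chessboard-good A B′ X u′ g)
      where
      perm : a ∷ A ++ B ++ X ↭ a ∷ b ∷ (A ++ B′ ++ X)
      perm = prep a (↭-trans (++⁺↭ (↭-refl {x = A}) (++⁺↭ (Pick-↭ k) (↭-refl {x = X}))) (shift b A (B′ ++ X)))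

  γ-good : ∀ {r} (ts : Vec (V × V × V) r) → Unique (toList (flat ts)) → Good (toList (flat ts)) r (γ ts)
  γ-good [] u = good [] [] refl ∷ []
  γ-good {suc r} ((a , b , c) ∷ ts) ((a≢b ∷ _ ∷ ha) ∷ (b≢c ∷ hb) ∷ hc ∷ u) = ++⁺
    (prepend-all {GoodWord X r} (λ h → weaken fst (cons-good (All⇒∉ ha) (All⇒∉ hb) a≢b h)) (γ-good ts u))
    (neg-all {GoodWord (a ∷ b ∷ c ∷ X) (suc r)} (prepend-all {GoodWord X r}
      (λ h → weaken there (cons-good (All⇒∉ hb) (All⇒∉ hc) b≢c h)) (γ-good ts u)))
    where
    X : List V
    X = toList (flat ts)
    fst : ∀ {x} → x ∈ a ∷ b ∷ X → x ∈ a ∷ b ∷ c ∷ X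
    fst (here e) = here e
    fst (there (here e)) = there (here e)
    fst (there (there i)) = there (there (there i))

  signed-all : ∀ {P : List (V × V) → Set} s {c} → All (λ { (_ , w) → P w }) c → All (λ { (_ , w) → P w }) (signed s c)
  signed-all true h = h
  signed-all {P} false h = neg-all {P} h

  combine-good : ∀ {X Y m k} l {t} → (∀ {x} → x ∈ Y → x ∉ X) → All (λ { (_ , w) → GoodWord Y k w }) l →
    Good X m t → Good (Y ++ X) (k + m) (combine l t)
  combine-good [] disj [] g = []
  combine-good {X} {Y} {m} {k} ((s , w) ∷ l) {t} disj (h ∷ hs) g =
    ++⁺ (signed-all {GoodWord (Y ++ X) (k + m)} s (go w (λ v → append-good disj h v) g)) (combine-good l disj hs g)
    where
    go : ∀ {P : List (V × V) → Set} w → (∀ {v} → GoodWord X m v → P (w ++ v)) → ∀ {t} → Good X m t →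
      All (λ { (_ , u) → P u }) (prependAll w t)
    go [] f {t} g = All.map f g
    go {P} (e ∷ w) f g = prepend-all {λ v → P (e ∷ v)} {P} (λ h → h) (go w f g)

-- Three times a product of two factors bounds on seven vertices

module SevenVertices where

  open Words
  open Chessboard
  open Faces
  open import Data.Bool.Properties using () renaming (_≟_ to _≟ᵇ_)
  open import Data.Integer using (-1ℤ) renaming (_≟_ to _≟ℤ_)
  open import Data.Integer.Properties using (i-j≡0⇒i≡j)
  open import Data.List.Relation.Unary.All.Properties using (++⁺)
  open import Relation.Nullary.Decidable using (from-yes)

  term : Bool → (a b c d e f : Fin 7) → Bool × List (Fin 7 × Fin 7)
  term s a b c d e f = s , (a , b) ∷ (c , d) ∷ (e , f) ∷ []

  -- A solution of ∂ b₇ = 3 γ₆ in the chains of M₇, found by linear algebra over ℤ; true means sign +.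
  opaque
    b₇ : List (Bool × List (Fin 7 × Fin 7))
    b₇ =
      term false (# 0) (# 1) (# 2) (# 3) (# 4) (# 5) ∷
      term false (# 0) (# 1) (# 2) (# 3) (# 4) (# 5) ∷
      term true (# 0) (# 1) (# 2) (# 3) (# 5) (# 6) ∷
      term true (# 0) (# 1) (# 2) (# 3) (# 5) (# 6) ∷
      term false (# 0) (# 1) (# 2) (# 5) (# 3) (# 4) ∷
      term false (# 0) (# 1) (# 2) (# 5) (# 3) (# 4) ∷
      term true (# 0) (# 1) (# 2) (# 5) (# 3) (# 6) ∷
      term true (# 0) (# 1) (# 2) (# 5) (# 3) (# 6) ∷
      term false (# 0) (# 1) (# 3) (# 4) (# 5) (# 6) ∷
      term false (# 0) (# 1) (# 3) (# 4) (# 5) (# 6) ∷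
      term true (# 0) (# 1) (# 3) (# 6) (# 4) (# 5) ∷
      term true (# 0) (# 1) (# 3) (# 6) (# 4) (# 5) ∷
      term true (# 0) (# 4) (# 1) (# 2) (# 3) (# 6) ∷
      term false (# 0) (# 4) (# 1) (# 2) (# 5) (# 6) ∷
      term true (# 0) (# 4) (# 1) (# 6) (# 2) (# 3) ∷
      term false (# 0) (# 4) (# 1) (# 6) (# 2) (# 5) ∷
      term true (# 0) (# 4) (# 2) (# 3) (# 5) (# 6) ∷
      term false (# 0) (# 4) (# 2) (# 5) (# 3) (# 6) ∷
      term false (# 0) (# 5) (# 1) (# 2) (# 3) (# 4) ∷
      term true (# 0) (# 5) (# 1) (# 2) (# 3) (# 6) ∷
      term true (# 0) (# 5) (# 1) (# 4) (# 2) (# 3) ∷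
      term false (# 0) (# 5) (# 1) (# 4) (# 3) (# 6) ∷
      term false (# 0) (# 5) (# 1) (# 6) (# 2) (# 3) ∷
      term true (# 0) (# 5) (# 1) (# 6) (# 3) (# 4) ∷
      term false (# 0) (# 6) (# 1) (# 2) (# 3) (# 4) ∷
      term true (# 0) (# 6) (# 1) (# 2) (# 4) (# 5) ∷
      term false (# 0) (# 6) (# 1) (# 4) (# 2) (# 3) ∷
      term true (# 0) (# 6) (# 1) (# 4) (# 2) (# 5) ∷
      term false (# 0) (# 6) (# 2) (# 3) (# 4) (# 5) ∷
      term true (# 0) (# 6) (# 2) (# 5) (# 3) (# 4) ∷
      term true (# 1) (# 2) (# 3) (# 4) (# 5) (# 6) ∷
      term true (# 1) (# 2) (# 3) (# 4) (# 5) (# 6) ∷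
      term false (# 1) (# 2) (# 3) (# 6) (# 4) (# 5) ∷
      term false (# 1) (# 2) (# 3) (# 6) (# 4) (# 5) ∷
      term false (# 1) (# 4) (# 2) (# 5) (# 3) (# 6) ∷
      term true (# 1) (# 6) (# 2) (# 5) (# 3) (# 4) ∷
      []

  unit : Bool → ℤ
  unit true = 1ℤ
  unit false = -1ℤ

  toChain : List (Bool × List (Fin 7 × Fin 7)) → Chain 7
  toChain = map (λ { (s , w) → (unit s , w) })

  -- Vertex 0 belongs to neither triple; it is the place of v₀.
  γ₆ : Chain 7
  γ₆ = γ ((# 1 , # 2 , # 3) ∷ (# 4 , # 5 , # 6) ∷ [])

  defect : Chain 7
  defect = ∂ 3 (toChain b₇) ++ neg (γ₆ ++ γ₆ ++ γ₆)

  opaque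
    unfolding b₇
    -- Checking the faces that occur in `defect` suffices, because `⟦⟧-coeff` evaluates along any
    -- list that contains them.
    defect-0 : All (λ σ → coeff 2 defect σ ≡ 0ℤ) (deduplicate _≟ʷ_ (map proj₂ defect))
    defect-0 = from-yes (All.all? (λ σ → coeff 2 defect σ ≟ℤ 0ℤ) (deduplicate _≟ʷ_ (map proj₂ defect)))

  opaque
    unfolding b₇
    b₇-faces : All (λ { (_ , τ) → isFace 3 τ ≡ true }) (toChain b₇)
    b₇-faces = from-yes (All.all? (λ { (_ , τ) → isFace 3 τ ≟ᵇ true }) (toChain b₇))

  γ₆-faces : All (λ { (_ , τ) → isFace 2 τ ≡ true }) γ₆
  γ₆-faces = from-yes (All.all? (λ { (_ , τ) → isFace 2 τ ≟ᵇ true }) γ₆)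

  module _ {V : Set} where
    open Coefficients ℤᴷ using (_·_; identityʳ)
    open Functionals ℤᴷ using (S; δ; ⟪_⟫)
    open Chessboards ℤᴷ

    image : Vec V 7 → List (Fin 7 × Fin 7) → List (V × V)
    image vs = map (λ { (i , j) → (lookup vs i , lookup vs j) })

    images : Vec V 7 → List (Bool × List (V × V))
    images vs = map (λ { (s , w) → (s , image vs w) }) b₇

    S-map : ∀ {A B : Set} (f : A → B) w (H : List B → ℤ) →
      S (map f w) (λ _ → H) ≡ S w (λ _ v → H (map f v))
    S-map f [] H = refl
    S-map f (x ∷ w) H = cong (λ y → H (map f w) +ℤ (-ℤ y)) (S-map f w (λ v → H (f x ∷ v)))

    ∑±-image : ∀ vs l (H : List (V × V) → ℤ) →
      ∑± (map (λ { (s , w) → (s , image vs w) }) l) (δ H) ≡ ⟪ toChain l ⟫ (δ (λ w → H (image vs w)))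
    ∑±-image vs [] H = refl
    ∑±-image vs ((s , w) ∷ l) H = cong₂ _+ℤ_ (trans (cong (± s) (S-map _ w H)) (sym (unit-· s _))) (∑±-image vs l H)
      where
      unit-· : ∀ s x → unit s · x ≡ ± s x
      unit-· true x = identityʳ x
      unit-· false x = cong -ℤ_ (identityʳ x)

    -- The relation was verified between sorted faces, hence as an equality of combinations of
    -- words. It therefore survives any functional `H` on words and any substitution of vertices.
    b₇-boundary : ∀ (vs : Vec V 7) (H : List (V × V) → ℤ) →
      ∑± (images vs) (δ H) ≡ ⟪ γ₆ ++ γ₆ ++ γ₆ ⟫ (λ w → H (image vs w))
    b₇-boundary vs H = trans (∑±-image vs b₇ H) (trans (sym expand)
      (zero-difference (⟦ ∂ 3 (toChain b₇) ⟧ 2 H′) (trans (sym (trans (⟦⟧-++ (∂ 3 (toChain b₇)) (neg (γ₆ ++ γ₆ ++ γ₆)) 2 H′)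
        (cong (⟦ ∂ 3 (toChain b₇) ⟧ 2 H′ +ℤ_) (trans (⟦⟧-neg (γ₆ ++ γ₆ ++ γ₆) 2 H′) (cong -ℤ_ collect))))) vanish)))
      where
      open Evaluate {7} ℤᴷ
      H′ : List (Fin 7 × Fin 7) → ℤ
      H′ w = H (image vs w)
      vanish : ⟦ defect ⟧ 2 H′ ≡ 0ℤ
      vanish = trans (⟦⟧-coeff (UniqueDec.deduplicate-! _≟ʷ_ (map proj₂ defect)) defect 2 H′
        (All.tabulate (λ k → ∈-deduplicate⁺ _≟ʷ_ (∈-map⁺ proj₂ k))))
        (∑ˡ-0 _ (All.map (λ {σ} e → cong (_· H′ σ) e) defect-0))
      expand : ⟦ ∂ 3 (toChain b₇) ⟧ 2 H′ ≡ ⟪ toChain b₇ ⟫ (δ H′)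
      expand = trans (⟦⟧-∂ (toChain b₇) 2 H′) (⟦⟧-faces {c = toChain b₇} {Ψ = δ H′} (All.map (λ { {_ , τ} e → isFace⇒ {7} {3} {τ} e }) b₇-faces))
      collect : ⟦ γ₆ ++ γ₆ ++ γ₆ ⟧ 2 H′ ≡ ⟪ γ₆ ++ γ₆ ++ γ₆ ⟫ H′
      collect = ⟦⟧-faces {c = γ₆ ++ γ₆ ++ γ₆} {Ψ = H′} (++⁺ faces (++⁺ faces faces))
        where
        faces : All (λ { (_ , τ) → SortedMatching τ × length τ ≡ 2 }) γ₆
        faces = All.map (λ { {_ , τ} e → isFace⇒ {7} {2} {τ} e }) γ₆-faces
      zero-difference : ∀ x {y} → x +ℤ (-ℤ y) ≡ 0ℤ → x ≡ y
      zero-difference x {y} e = i-j≡0⇒i≡j x y e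

-- Chains bounding three times a cycle

module Bounding where

  open Words
  open Chessboard
  open Faces
  open Normalisation
  open SevenVertices using (images; b₇; image; b₇-boundary; toChain; b₇-faces; γ₆)
  open import Data.Nat using (_+_)

  private
    module Zᴷ = Coefficients ℤᴷ
    module Fᶻ = Functionals ℤᴷ

  module _ {V : Set} where
    open Chessboards ℤᴷ {V}
    open Functionals ℤᴷ using (δ; ⟪_⟫; ⟪⟫-++)

    ∑±-cong : ∀ l {Ψ Ψ′ : List (V × V) → ℤ} → (∀ w → Ψ w ≡ Ψ′ w) → ∑± l Ψ ≡ ∑± l Ψ′
    ∑±-cong [] e = refl
    ∑±-cong ((s , w) ∷ l) e = cong₂ (λ x y → ± s x +ℤ y) (e w) (∑±-cong l e)

    combine-boundary : ∀ {r} v t₁ t₂ (ts : Vec (V × V × V) r) Ψ →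
      let vs = v ∷ proj₁ t₁ ∷ proj₁ (proj₂ t₁) ∷ proj₂ (proj₂ t₁) ∷ proj₁ t₂ ∷ proj₁ (proj₂ t₂) ∷ proj₂ (proj₂ t₂) ∷ []
          x = ⟪ γ (t₁ ∷ t₂ ∷ ts) ⟫ Ψ
      in ⟪ combine (images vs) (γ ts) ⟫ (δ Ψ) ≡ x +ℤ (x +ℤ x)
    combine-boundary {r} v t₁@(a , b , c) t₂@(d , e , f) ts Ψ = trans (⟪⟫-combine (images vs) (γ ts) (δ Ψ))
      (trans (∑±-cong (images vs) {tail (γ ts) (δ Ψ)} {δ (tail (γ ts) Ψ)} (tail-δ-cycle {γ ts} (γ-cycle ts) Ψ))
      (trans (b₇-boundary vs H) (trans (⟪⟫-++ γ₆ (γ₆ ++ γ₆) H′)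
        (cong₂ _+ℤ_ part (trans (⟪⟫-++ γ₆ γ₆ H′) (cong₂ _+ℤ_ part part))))))
      where
      vs : Vec V 7
      vs = v ∷ a ∷ b ∷ c ∷ d ∷ e ∷ f ∷ []
      H : List (V × V) → ℤ
      H = tail (γ ts) Ψ
      H′ : List (Fin 7 × Fin 7) → ℤ
      H′ w = H (image vs w)
      part : ⟪ γ₆ ⟫ H′ ≡ ⟪ γ (t₁ ∷ t₂ ∷ ts) ⟫ Ψ
      part = trans (Chessboards.⟪⟫-γ ℤᴷ ((# 1 , # 2 , # 3) ∷ (# 4 , # 5 , # 6) ∷ []) H′) (sym (trans (⟪⟫-γ (t₁ ∷ t₂ ∷ ts) Ψ)
        (cong₂ (λ x y → x +ℤ (-ℤ y)) (inner (a , b)) (inner (b , c)))))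
        where
        inner : ∀ g → ∫ (t₂ ∷ ts) (Ψ ∘ (g ∷_)) ≡ H (g ∷ (d , e) ∷ []) +ℤ (-ℤ H (g ∷ (e , f) ∷ []))
        inner g = cong₂ (λ x y → x +ℤ (-ℤ y)) (sym (⟪⟫-γ ts _)) (sym (⟪⟫-γ ts _))

    neg^ᶜ : List V → WordChain {V} → WordChain
    neg^ᶜ [] c = c
    neg^ᶜ (_ ∷ A) c = negᶜ (neg^ᶜ A c)

    ⟪⟫-neg^ᶜ : ∀ A c Ψ → ⟪ neg^ᶜ A c ⟫ Ψ ≡ Fᶻ.neg^ A (⟪ c ⟫ Ψ)
    ⟪⟫-neg^ᶜ [] c Ψ = refl
    ⟪⟫-neg^ᶜ (a ∷ A) c Ψ = trans (⟪⟫-neg (neg^ᶜ A c) Ψ) (cong -ℤ_ (⟪⟫-neg^ᶜ A c Ψ))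

    neg^-neg^ : ∀ (A : List V) x → Fᶻ.neg^ A (Fᶻ.neg^ A x) ≡ x
    neg^-neg^ [] x = refl
    neg^-neg^ (a ∷ A) x = trans (cong -ℤ_ (neg-inside A _)) (trans (Zᴷ.⁻¹-involutive _) (neg^-neg^ A x))
      where
      neg-inside : ∀ (A : List V) x → Fᶻ.neg^ A (-ℤ x) ≡ -ℤ Fᶻ.neg^ A x
      neg-inside [] x = refl
      neg-inside (a ∷ A) x = cong -ℤ_ (neg-inside A x)

    -- `neg^ᶜ A` compensates the sign that `chessboard-∂` produces when the boundary passes the rows
    -- of the chessboard.
    bounding : ∀ {r} → List V → List V → V → V × V × V → V × V × V → Vec (V × V × V) r → WordChain {V}
    bounding A B v (a , b , c) (d , e , f) ts =
      neg^ᶜ A (chessboard A B (combine (images (v ∷ a ∷ b ∷ c ∷ d ∷ e ∷ f ∷ [])) (γ ts)))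

    bounding-∂ : ∀ {r} A B v t₁ t₂ (ts : Vec (V × V × V) r) Ψ → length B ≡ suc (length A) →
      let x = ⟪ chessboard A B (γ (t₁ ∷ t₂ ∷ ts)) ⟫ Ψ in ⟪ bounding A B v t₁ t₂ ts ⟫ (δ Ψ) ≡ x +ℤ (x +ℤ x)
    bounding-∂ A B v t₁ t₂ ts Ψ l = trans (⟪⟫-neg^ᶜ A _ (δ Ψ)) (trans (cong (Fᶻ.neg^ A)
        (chessboard-∂ A B _ Ψ l)) (trans (neg^-neg^ A _)
      (trans (Z-cong A B (λ w → combine-boundary v t₁ t₂ ts (λ u → Ψ (w ++ u))))
      (trans (Z-+ A B _ _) (trans (cong (Z A B (tail c Ψ) +ℤ_) (Z-+ A B _ _))
        (cong (λ x → x +ℤ (x +ℤ x)) (sym (⟪⟫-chessboard A B c Ψ))))))))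
      where
      c : WordChain {V}
      c = γ (t₁ ∷ t₂ ∷ ts)

  module _ {n : ℕ} where
    open Reading (_≟ᶠ_ {n}) using (Distinct; _∈ᵛ_; Matched; []; _∷_; Apart)
    open Independence (_≟ᶠ_ {n})
    open Detection (_≟ᶠ_ {n})
    open Supports (_≟ᶠ_ {n})

    ∈-lookup-toList : ∀ {k} (X : Vec (Fin n) k) j → lookup X j ∈ toList X
    ∈-lookup-toList (x ∷ X) zero = here refl
    ∈-lookup-toList (x ∷ X) (suc j) = there (∈-lookup-toList X j)

    Distinct-toList : ∀ {k} (X : Vec (Fin n) k) → Unique (toList X) → Distinct X
    Distinct-toList (x ∷ X) u zero zero e = refl
    Distinct-toList (x ∷ X) (h ∷ u) zero (suc j) e = ⊥-elim (All⇒∉ h (subst (_∈ toList X) (sym e) (∈-lookup-toList X j)))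
    Distinct-toList (x ∷ X) (h ∷ u) (suc i) zero e = ⊥-elim (All⇒∉ h (subst (_∈ toList X) e (∈-lookup-toList X i)))
    Distinct-toList (x ∷ X) (h ∷ u) (suc i) (suc j) e = cong suc (Distinct-toList X u i j e)

    toList-∈ᵛ : ∀ {k x} (X : Vec (Fin n) k) → x ∈ toList X → x ∈ᵛ X
    toList-∈ᵛ (y ∷ X) (here e) = zero , sym e
    toList-∈ᵛ (y ∷ X) (there i) with toList-∈ᵛ X i
    ... | j , e = suc j , e

    images-good : ∀ (vs : Vec (Fin n) 7) → Unique (toList vs) →
      All (λ { (_ , w) → GoodWord (toList vs) 3 w }) (images vs)
    images-good vs u = go b₇ b₇-faces
      where
      module R₇ = Reading (_≟ᶠ_ {7})
      d : Distinct vs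
      d = Distinct-toList vs u
      transport : ∀ {w} → R₇.Matched w → GoodWord (toList vs) (length w) (image vs w)
      transport R₇.[] = good [] [] refl
      transport (R₇._∷_ {a} {b} (a≢b , as , bs) M) with transport M
      ... | good N I l = good (((λ e → a≢b (d _ _ e)) , shiftA as , shiftA bs) ∷ N)
              ((∈-lookup-toList vs a , ∈-lookup-toList vs b) ∷ I) (cong suc l)
        where
        shiftA : ∀ {x w} → All (R₇.Apart x) w → All (Apart (lookup vs x)) (image vs w)
        shiftA [] = []
        shiftA ((f , g) ∷ hs) = ((λ e → f (d _ _ e)) , (λ e → g (d _ _ e))) ∷ shiftA hs
      go : ∀ l → All (λ { (_ , τ) → isFace 3 τ ≡ true }) (toChain l) →
        All (λ { (_ , w) → GoodWord (toList vs) 3 w }) (map (λ { (s , w) → (s , image vs w) }) l)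
      go [] [] = []
      go ((s , τ) ∷ l) (e ∷ es) with isFace⇒ {7} {3} {τ} e
      ... | M , len = subst (λ k → GoodWord (toList vs) k (image vs τ)) len (transport (SortedMatching-matched M)) ∷ go l es

    neg^-good : ∀ {X m} (A : List (Fin n)) {c} → Good X m c → Good X m (neg^ᶜ A c)
    neg^-good [] g = g
    neg^-good {X} {m} (a ∷ A) g = neg-all {GoodWord X m} (neg^-good A g)

    good-matched : ∀ {X m c} → Good X m c → MatchedOf m c
    good-matched = All.map (λ h → matched h , size h)

    digit : Fin 3 → Chain n → Chain n
    digit zero c = []
    digit (suc zero) c = c
    digit (suc (suc zero)) c = c ++ c

    -- Digits are added modulo 3, but their cycles are added as integral chains. The two sums differ
    -- by three copies of the cycle exactly when there is a carry, and there a bounding chain has to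
    -- enter.
    carry : Fin 3 → Fin 3 → Bool
    carry zero b = false
    carry (suc zero) zero = false
    carry (suc zero) (suc zero) = false
    carry (suc zero) (suc (suc zero)) = true
    carry (suc (suc zero)) zero = false
    carry (suc (suc zero)) (suc b) = true

    module Weights (K : Coefficients) where
      open Coefficients K renaming (_+_ to _+ᴷ_)
      open Functionals K using (⟪_⟫; ⟪⟫-++)

      weigh : Fin 3 → Carrier → Carrier
      weigh zero x = 0#
      weigh (suc zero) x = x
      weigh (suc (suc zero)) x = x +ᴷ x

      ⟪⟫-digit : ∀ a (c : Chain n) Ψ → ⟪ digit a c ⟫ Ψ ≡ weigh a (⟪ c ⟫ Ψ)
      ⟪⟫-digit zero c Ψ = refl
      ⟪⟫-digit (suc zero) c Ψ = refl
      ⟪⟫-digit (suc (suc zero)) c Ψ = ⟪⟫-++ c c Ψ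

      weigh-0 : ∀ a → weigh a 0# ≡ 0#
      weigh-0 zero = refl
      weigh-0 (suc zero) = refl
      weigh-0 (suc (suc zero)) = identityˡ 0#

      weigh-· : ∀ a x → weigh a x ≡ pos (toℕ a) · x
      weigh-· zero x = refl
      weigh-· (suc zero) x = sym (identityʳ x)
      weigh-· (suc (suc zero)) x = cong (x +ᴷ_) (sym (identityʳ x))

-- The homomorphism from the elementary abelian group and its injectivity

module Classes where

  open LoopedMatchings using (F₃; 0₃; 1₃; _⊞_; ⊟_; ⊞-inverseʳ; λᵉ)
  open Words
  open Chessboard
  open Faces
  open Normalisation
  open Bounding
  open import Data.List.Properties using (++-assoc)
  open import Data.List.Relation.Binary.Permutation.Propositional.Properties using (++⁺ʳ)
  open import Data.List.Relation.Unary.All.Properties using (++⁺)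
  open import Data.Nat using (_*_; _+_)
  open import Data.Nat.Properties using (suc-injective; +-comm)

  double-injective : ∀ a b → a + a ≡ b + b → a ≡ b
  double-injective zero zero _ = refl
  double-injective (suc a) (suc b) e = cong suc (double-injective a b
    (suc-injective (suc-injective (trans (cong suc (sym (+-suc a a))) (trans e (cong suc (+-suc b b)))))))

  module _ {n : ℕ} where
    private
      module R = Reading (_≟ᶠ_ {n})
      module M = Functionals R.F₃ᴷ
      module Zᶠ = Functionals ℤᴷ
    open R using (Distinct; _∈ᵛ_; Φ; Φ-alternating; F₃ᴷ)
    open Independence (_≟ᶠ_ {n})
    open Detection (_≟ᶠ_ {n})
    open Supports (_≟ᶠ_ {n})
    open import Algebra.Solver.CommutativeMonoid (++-commutativeMonoid {A = Fin n}) using (_⊜_) renaming (_⊕_ to _⊹_; solve to solve↭)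
    private
      V = Fin n
      Part = List V × List V
      module Wᶻ = Weights {n} ℤᴷ
      module Wᶠ = Weights {n} F₃ᴷ
      module F = Coefficients F₃ᴷ

    opaque
      unfolding _⊞_ ⊟_
      digit-injective : (a b : Fin 3) → (pos (toℕ a) +ℤ (-ℤ pos (toℕ b))) F.· 1₃ ≡ 0₃ → a ≡ b
      digit-injective zero zero _ = refl
      digit-injective (suc zero) (suc zero) _ = refl
      digit-injective (suc (suc zero)) (suc (suc zero)) _ = refl
      digit-injective zero (suc zero) ()
      digit-injective zero (suc (suc zero)) ()
      digit-injective (suc zero) zero ()
      digit-injective (suc zero) (suc (suc zero)) ()
      digit-injective (suc (suc zero)) zero ()
      digit-injective (suc (suc zero)) (suc zero) ()

    carry-law : (a b : Fin 3) (x : ℤ) → (if carry {n} a b then -ℤ (x +ℤ (x +ℤ x)) else 0ℤ) ≡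
      Wᶻ.weigh (a +₃ b) x +ℤ (-ℤ (Wᶻ.weigh a x +ℤ Wᶻ.weigh b x))
    carry-law zero zero x = refl
    carry-law zero (suc zero) x = solve 1 (λ x → con 0ℤ := x :+ (:- (con 0ℤ :+ x))) refl x
      where open +-*-Solver
    carry-law zero (suc (suc zero)) x = solve 1 (λ x → con 0ℤ := (x :+ x) :+ (:- (con 0ℤ :+ (x :+ x)))) refl x
      where open +-*-Solver
    carry-law (suc zero) zero x = solve 1 (λ x → con 0ℤ := x :+ (:- (x :+ con 0ℤ))) refl x
      where open +-*-Solver
    carry-law (suc zero) (suc zero) x = solve 1 (λ x → con 0ℤ := (x :+ x) :+ (:- (x :+ x))) refl x
      where open +-*-Solver
    carry-law (suc zero) (suc (suc zero)) x =
      solve 1 (λ x → :- (x :+ (x :+ x)) := con 0ℤ :+ (:- (x :+ (x :+ x)))) refl x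
      where open +-*-Solver
    carry-law (suc (suc zero)) zero x = solve 1 (λ x → con 0ℤ := (x :+ x) :+ (:- ((x :+ x) :+ con 0ℤ))) refl x
      where open +-*-Solver
    carry-law (suc (suc zero)) (suc zero) x =
      solve 1 (λ x → :- (x :+ (x :+ x)) := con 0ℤ :+ (:- ((x :+ x) :+ x))) refl x
      where open +-*-Solver
    carry-law (suc (suc zero)) (suc (suc zero)) x =
      solve 1 (λ x → :- (x :+ (x :+ x)) := x :+ (:- ((x :+ x) :+ (x :+ x)))) refl x
      where open +-*-Solver

    length-verts : ∀ (E : List (V × V)) → length (verts E) ≡ length E + length E
    length-verts [] = refl
    length-verts (e ∷ E) = cong suc (trans (cong suc (length-verts E)) (sym (+-suc (length E) (length E))))

    module Construction (k r : ℕ) (P : List V) (p₀ q s v₀ : V) (t₁ t₂ : V × V × V) (ts : Vec (V × V × V) r)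
      (|P| : length P ≡ k + k) where

      TS : Vec (V × V × V) (suc (suc r))
      TS = t₁ ∷ t₂ ∷ ts

      fl : List V
      fl = toList (flat TS)

      -- The chessboard contributes k + 1 edges and the triples r + 2, one more in all than the
      -- dimension.
      d : ℕ
      d = k + suc (suc r)

      module _ (vs! : Unique (P ++ p₀ ∷ q ∷ s ∷ v₀ ∷ fl)) (cover : ∀ x → x ∈ P ++ p₀ ∷ q ∷ s ∷ v₀ ∷ fl) where

        IsPart : Part → Set
        IsPart (A , T) = Split P A T × length A ≡ k × length T ≡ k

        -- The sign of `bound` fits additivity as it is stated: the value for the sum minus the sum
        -- of the values is -3 times the cycle in case of a carry.
        cycle bound : Part → Chain n
        cycle (A , T) = chessboard (p₀ ∷ A) (T ++ q ∷ s ∷ []) (γ TS)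
        bound (A , T) = negᶜ (bounding (p₀ ∷ A) (T ++ q ∷ s ∷ []) v₀ t₁ t₂ ts)

        rows : ∀ {A T} → IsPart (A , T) → length (T ++ q ∷ s ∷ []) ≡ suc (length (p₀ ∷ A))
        rows {A} {T} (_ , lA , lT) = trans (length-++ T) (trans (+-comm (length T) 2) (cong (λ l → suc (suc l)) (trans lT (sym lA))))

        cycle-matched : ∀ {x} → IsPart x → MatchedOf (suc d) (cycle x)
        cycle-matched {A , T} (sp , lA , lT) = subst (λ l → MatchedOf (suc (l + suc (suc r))) (cycle (A , T))) lA
          (good-matched (chessboard-good (p₀ ∷ A) (T ++ q ∷ s ∷ []) fl
            (Unique-++⁻ʳ [ v₀ ] (Unique-resp-↭ perm vs!)) (γ-good TS (Unique-++⁻ʳ (P ++ p₀ ∷ q ∷ s ∷ [ v₀ ]) (subst Unique regroup vs!)))))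
          where
          perm : P ++ p₀ ∷ q ∷ s ∷ v₀ ∷ fl ↭ v₀ ∷ ((p₀ ∷ A) ++ (T ++ q ∷ s ∷ []) ++ fl)
          perm = ↭-trans (++⁺ʳ _ (↭-sym (Split-↭ sp)))
            (solve↭ 7 (λ A T p₀ q s v₀ fl → ((A ⊹ T) ⊹ p₀ ⊹ q ⊹ s ⊹ v₀ ⊹ fl) ⊜ (v₀ ⊹ (p₀ ⊹ A) ⊹ (T ⊹ q ⊹ s) ⊹ fl))
              ↭-refl A T [ p₀ ] [ q ] [ s ] [ v₀ ] fl)
          regroup : P ++ p₀ ∷ q ∷ s ∷ v₀ ∷ fl ≡ (P ++ p₀ ∷ q ∷ s ∷ [ v₀ ]) ++ fl
          regroup = sym (++-assoc P (p₀ ∷ q ∷ s ∷ [ v₀ ]) fl)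

        bound-matched : ∀ {x} → IsPart x → MatchedOf (suc (suc d)) (bound x)
        bound-matched {A , T} (sp , lA , lT) = good-matched (neg-all {GoodWord X (suc (suc d))} (subst (λ l → Good X l c) len
          (neg^-good (p₀ ∷ A) (chessboard-good (p₀ ∷ A) (T ++ q ∷ s ∷ []) (v₀ ∷ fl)
            (Unique-resp-↭ perm vs!)
            (combine-good _ (λ i → Unique-++⇒∉ (toList six) six! i) (images-good six (Unique-++⁻ˡ (toList six) six!)) (γ-good ts (Unique-++⁻ʳ (toList six) six!)))))))
          where
          X : List V
          X = (p₀ ∷ A) ++ (T ++ q ∷ s ∷ []) ++ v₀ ∷ fl
          c : Chain n
          c = bounding (p₀ ∷ A) (T ++ q ∷ s ∷ []) v₀ t₁ t₂ ts
          six : Vec V 7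
          six = v₀ ∷ proj₁ t₁ ∷ proj₁ (proj₂ t₁) ∷ proj₂ (proj₂ t₁) ∷ proj₁ t₂ ∷ proj₁ (proj₂ t₂) ∷ proj₂ (proj₂ t₂) ∷ []
          six! : Unique (toList six ++ toList (flat ts))
          six! = Unique-++⁻ʳ (P ++ p₀ ∷ q ∷ [ s ]) (subst Unique (sym (++-assoc P (p₀ ∷ q ∷ [ s ]) (v₀ ∷ fl))) vs!)
          len : length (p₀ ∷ A) + suc (suc (suc r)) ≡ suc (suc d)
          len = cong suc (trans (cong (_+ suc (suc (suc r))) lA) (+-suc k (suc (suc r))))
          perm : P ++ p₀ ∷ q ∷ s ∷ v₀ ∷ fl ↭ (p₀ ∷ A) ++ (T ++ q ∷ s ∷ []) ++ v₀ ∷ fl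
          perm = ↭-trans (++⁺ʳ _ (↭-sym (Split-↭ sp)))
            (solve↭ 7 (λ A T p₀ q s v₀ fl → ((A ⊹ T) ⊹ p₀ ⊹ q ⊹ s ⊹ v₀ ⊹ fl) ⊜ ((p₀ ⊹ A) ⊹ (T ⊹ q ⊹ s) ⊹ v₀ ⊹ fl))
              ↭-refl A T [ p₀ ] [ q ] [ s ] [ v₀ ] fl)

        sum : ∀ {m} → Vec (Fin 3) m → List Part → Chain n
        sum [] L = []
        sum (a ∷ as) [] = []
        sum (a ∷ as) (x ∷ L) = digit a (cycle x) ++ sum as L

        carries : ∀ {m} → Vec (Fin 3) m → Vec (Fin 3) m → List Part → Chain n
        carries [] [] L = []
        carries (a ∷ as) (b ∷ bs) [] = []
        carries (a ∷ as) (b ∷ bs) (x ∷ L) = (if carry {n} a b then bound x else []) ++ carries as bs L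

        digit-all : ∀ {Q : ℤ × List (V × V) → Set} a {c : Chain n} → All Q c → All Q (digit a c)
        digit-all zero h = []
        digit-all (suc zero) h = h
        digit-all (suc (suc zero)) h = ++⁺ h h

        sum-matched : ∀ {m} (as : Vec (Fin 3) m) {L} → All IsPart L → MatchedOf (suc d) (sum as L)
        sum-matched [] hs = []
        sum-matched (a ∷ as) [] = []
        sum-matched (a ∷ as) {x ∷ L} (h ∷ hs) = ++⁺ (digit-all a (cycle-matched {x} h)) (sum-matched as hs)

        carries-matched : ∀ {m} (as bs : Vec (Fin 3) m) {L} → All IsPart L → MatchedOf (suc (suc d)) (carries as bs L)
        carries-matched [] [] hs = []
        carries-matched (a ∷ as) (b ∷ bs) [] = []
        carries-matched (a ∷ as) (b ∷ bs) {x ∷ L} (h ∷ hs) = ++⁺ head (carries-matched as bs hs)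
          where
          head : MatchedOf (suc (suc d)) (if carry {n} a b then bound x else [])
          head with carry {n} a b
          ... | true = bound-matched {x} h
          ... | false = []

        cycle-closed : ∀ {x} → IsPart x → ∀ Ψ → Zᶠ.⟪ cycle x ⟫ (Zᶠ.δ Ψ) ≡ 0ℤ
        cycle-closed {A , T} h = Chessboards.chessboard-cycle ℤᴷ (p₀ ∷ A) (T ++ q ∷ s ∷ []) {γ TS} (rows {A} {T} h)
          (Chessboards.γ-cycle ℤᴷ TS)

        bound-boundary : ∀ {x} → IsPart x → ∀ Ψ → let y = Zᶠ.⟪ cycle x ⟫ Ψ in
          Zᶠ.⟪ bound x ⟫ (Zᶠ.δ Ψ) ≡ -ℤ (y +ℤ (y +ℤ y))
        bound-boundary {A , T} h Ψ = trans (Chessboards.⟪⟫-neg ℤᴷ (bounding (p₀ ∷ A) (T ++ q ∷ s ∷ []) v₀ t₁ t₂ ts) (Zᶠ.δ Ψ))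
          (cong -ℤ_ (bounding-∂ (p₀ ∷ A) (T ++ q ∷ s ∷ []) v₀ t₁ t₂ ts Ψ (rows {A} {T} h)))

        sum-closed : ∀ {m} (as : Vec (Fin 3) m) {L} → All IsPart L → ∀ Ψ → Zᶠ.⟪ sum as L ⟫ (Zᶠ.δ Ψ) ≡ 0ℤ
        sum-closed [] hs Ψ = refl
        sum-closed (a ∷ as) [] Ψ = refl
        sum-closed (a ∷ as) {x ∷ L} (h ∷ hs) Ψ = trans (Zᶠ.⟪⟫-++ (digit a (cycle x)) (sum as L) (Zᶠ.δ Ψ))
          (cong₂ _+ℤ_ (trans (Wᶻ.⟪⟫-digit a (cycle x) (Zᶠ.δ Ψ)) (trans (cong (Wᶻ.weigh a) (cycle-closed {x} h Ψ)) (Wᶻ.weigh-0 a)))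
            (sum-closed as hs Ψ))

        carries-boundary : ∀ {m} (as bs : Vec (Fin 3) m) {L} → All IsPart L → ∀ Ψ →
          Zᶠ.⟪ carries as bs L ⟫ (Zᶠ.δ Ψ) ≡
          Zᶠ.⟪ sum (as ⊕ bs) L ⟫ Ψ +ℤ (-ℤ (Zᶠ.⟪ sum as L ⟫ Ψ +ℤ Zᶠ.⟪ sum bs L ⟫ Ψ))
        carries-boundary [] [] hs Ψ = refl
        carries-boundary (a ∷ as) (b ∷ bs) [] Ψ = refl
        carries-boundary (a ∷ as) (b ∷ bs) {x ∷ L} (h ∷ hs) Ψ =
          trans (Zᶠ.⟪⟫-++ (if carry {n} a b then bound x else []) (carries as bs L) (Zᶠ.δ Ψ))
          (trans (cong₂ _+ℤ_ (trans head (carry-law a b y)) (carries-boundary as bs hs Ψ))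
          (trans (solve 6 (λ c a b C A B → (c :+ (:- (a :+ b))) :+ (C :+ (:- (A :+ B))) := (c :+ C) :+ (:- ((a :+ A) :+ (b :+ B)))) refl
              (Wᶻ.weigh (a +₃ b) y) (Wᶻ.weigh a y) (Wᶻ.weigh b y) _ _ _)
            (sym (cong₂ (λ u v → u +ℤ (-ℤ v)) (expand (a +₃ b) (as ⊕ bs)) (cong₂ _+ℤ_ (expand a as) (expand b bs))))))
          where
          open +-*-Solver
          y : ℤ
          y = Zᶠ.⟪ cycle x ⟫ Ψ
          head : Zᶠ.⟪ if carry {n} a b then bound x else [] ⟫ (Zᶠ.δ Ψ) ≡ (if carry {n} a b then -ℤ (y +ℤ (y +ℤ y)) else 0ℤ)
          head with carry {n} a b
          ... | true = bound-boundary {x} h Ψ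
          ... | false = refl
          expand : ∀ a as → Zᶠ.⟪ digit a (cycle x) ++ sum as L ⟫ Ψ ≡ Wᶻ.weigh a y +ℤ Zᶠ.⟪ sum as L ⟫ Ψ
          expand a as = trans (Zᶠ.⟪⟫-++ (digit a (cycle x)) (sum as L) Ψ) (cong (_+ℤ Zᶠ.⟪ sum as L ⟫ Ψ) (Wᶻ.⟪⟫-digit a (cycle x) Ψ))

        module Pairing (t : V) (E : List (V × V)) (tE : t ∷ verts E ↭ p₀ ∷ P) where

          -- These are the 3(r + 3) + 1 vertices off the contracted edges: v₀ to be read as the free
          -- first vertex, then (q, t, s) as the triple formed by the remaining chessboard, then the
          -- r + 2 given triples. This fixes the index of `λᵉ` below.
          X : Vec V (suc (suc (suc (suc (suc (suc r) * 3)))))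
          X = v₀ ∷ q ∷ t ∷ s ∷ flat TS

          Ψ₀ Ψ : List (V × V) → F₃
          Ψ₀ = Φ _ X (λᵉ (suc (suc (suc r))))
          Ψ = contracts E Ψ₀

          all↭ : P ++ p₀ ∷ q ∷ s ∷ v₀ ∷ fl ↭ verts E ++ toList X
          all↭ = ↭-trans (solve↭ 6 (λ P p₀ q s v₀ fl → (P ⊹ p₀ ⊹ q ⊹ s ⊹ v₀ ⊹ fl) ⊜ ((p₀ ⊹ P) ⊹ v₀ ⊹ q ⊹ s ⊹ fl))
              ↭-refl P [ p₀ ] [ q ] [ s ] [ v₀ ] fl)
            (↭-trans (++⁺ʳ (v₀ ∷ q ∷ s ∷ fl) (↭-sym tE))
              (solve↭ 6 (λ t E q s v₀ fl → ((t ⊹ E) ⊹ v₀ ⊹ q ⊹ s ⊹ fl) ⊜ (E ⊹ v₀ ⊹ q ⊹ t ⊹ s ⊹ fl))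
                ↭-refl [ t ] (verts E) [ q ] [ s ] [ v₀ ] fl))

          all! : Unique (verts E ++ toList X)
          all! = Unique-resp-↭ all↭ vs!

          X! : Distinct X
          X! = Distinct-toList X (Unique-++⁻ʳ (verts E) all!)

          cocycle : ∀ {τ} → SortedMatching τ → length τ ≡ suc (suc d) → M.δ Ψ τ ≡ 0₃
          cocycle S _ = contracts-vanishes E {[]} (Φλ-vanishes (suc (suc (suc r))) X X! covered) (SortedMatching-matched S) (λ ())
            where
            covered : ∀ x → x ∈ verts E ++ [] ⊎ x ∈ᵛ X
            covered x with ∈-++⁻ (verts E) (∈-resp-↭ all↭ (cover x))
            ... | inj₁ i = inj₁ (∈-++⁺ˡ i)
            ... | inj₂ j = inj₂ (toList-∈ᵛ X j)

          alternating : M.Alternating Ψ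
          alternating = contracts-alternating E (Φ-alternating _ X (λᵉ (suc (suc (suc r)))))

          value : ∀ {x} → IsPart x → M.⟪ cycle x ⟫ Ψ ≡ edges E empty (proj₂ x)
          value {A , T} (sp , lA , lT) = trans (Chessboards.⟪⟫-chessboard F₃ᴷ (p₀ ∷ A) (T ++ q ∷ s ∷ []) (γ TS) Ψ)
            (trans (Chessboards.Z-cong F₃ᴷ (p₀ ∷ A) (T ++ q ∷ s ∷ []) (tail-contracts E {γ TS} apart-tail Ψ₀))
              (Z-contracts t q s _ (Z-value v₀ q t s TS X!) E (p₀ ∷ A) T
                (↭-trans (prep p₀ (Split-↭ sp)) (↭-sym tE)) few! (cong suc (trans lA (double-injective k (length E) halves)))))
            where
            apart-tail : ∀ {x} → x ∈ verts E → TailApart x (γ TS)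
            apart-tail i = All.map (λ h → apart (λ j → Unique-++⇒∉ (verts E) all! i (there (there (there (there j))))) (inside h))
              (γ-good TS (Unique-++⁻ʳ (verts E ++ v₀ ∷ q ∷ t ∷ [ s ]) (subst Unique (sym (++-assoc (verts E) (v₀ ∷ q ∷ t ∷ [ s ]) fl)) all!)))
            few! : Unique (q ∷ s ∷ t ∷ verts E)
            few! = Unique-++⁻ʳ (v₀ ∷ fl) (Unique-resp-↭ (solve↭ 6 (λ t E q s v₀ fl → (E ⊹ v₀ ⊹ q ⊹ t ⊹ s ⊹ fl) ⊜ ((v₀ ⊹ fl) ⊹ q ⊹ s ⊹ t ⊹ E))
                ↭-refl [ t ] (verts E) [ q ] [ s ] [ v₀ ] fl) all!)
            halves : k + k ≡ length E + length E
            halves = trans (sym |P|) (trans (sym (suc-injective (↭-length tE))) (length-verts E))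

        family : ∀ {m} → Vec (Fin 3) m → Vec (Fin 3) m → List Part → Family
        family [] [] L = []
        family (a ∷ as) (b ∷ bs) [] = []
        family (a ∷ as) (b ∷ bs) ((A , T) ∷ L) = (pos (toℕ a) +ℤ (-ℤ pos (toℕ b)) , T) ∷ family as bs L

        family-all : ∀ {Q : List V → Set} {m} (as bs : Vec (Fin 3) m) {L} → All (Q ∘ proj₂) L → All (λ { (_ , T) → Q T }) (family as bs L)
        family-all [] [] hs = []
        family-all (a ∷ as) (b ∷ bs) [] = []
        family-all {Q} (a ∷ as) (b ∷ bs) (h ∷ hs) = h ∷ family-all {Q} as bs hs

        family-distinct : ∀ {m} (as bs : Vec (Fin 3) m) {L} → AllPairs (λ x y → proj₂ x ≢ proj₂ y) L →
          AllPairs (λ { (_ , T) (_ , T′) → T ≢ T′ }) (family as bs L)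
        family-distinct [] [] us = []
        family-distinct (a ∷ as) (b ∷ bs) [] = []
        family-distinct (a ∷ as) (b ∷ bs) {(A , T) ∷ L} (h ∷ us) = family-all {T ≢_} as bs h ∷ family-distinct as bs us

        family-equal : ∀ {m} (as bs : Vec (Fin 3) m) {L} → length L ≡ m →
          All (λ { (c , _) → c F.· 1₃ ≡ 0₃ }) (family as bs L) → as ≡ bs
        family-equal [] [] l hs = refl
        family-equal (a ∷ as) (b ∷ bs) {_ ∷ L} l (h ∷ hs) =
          cong₂ _∷_ (digit-injective a b h) (family-equal as bs (suc-injective l) hs)

        sum-difference : ∀ {m} (as bs : Vec (Fin 3) m) {L} Ψ (f : List V → F₃) → All (λ x → M.⟪ cycle x ⟫ Ψ ≡ f (proj₂ x)) L →
          M.⟪ sum as L ⟫ Ψ ⊞ ⊟ M.⟪ sum bs L ⟫ Ψ ≡ ∑ᶠ (family as bs L) f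
        sum-difference [] [] Ψ f hs = ⊞-inverseʳ 0₃
        sum-difference (a ∷ as) (b ∷ bs) Ψ f [] = ⊞-inverseʳ 0₃
        sum-difference (a ∷ as) (b ∷ bs) {x ∷ L} Ψ f (h ∷ hs) = trans (cong₂ (λ u v → u ⊞ ⊟ v) (expand a as) (expand b bs))
          (trans (M.interchange⁻ᴷ _ _ _ _) (cong₂ _⊞_
            (trans (cong₂ (λ u v → u ⊞ ⊟ v) (Wᶠ.weigh-· a (f (proj₂ x))) (Wᶠ.weigh-· b (f (proj₂ x))))
              (sym (trans (F.·-+ (pos (toℕ a)) (-ℤ pos (toℕ b)) (f (proj₂ x)))
                (cong (pos (toℕ a) F.· f (proj₂ x) ⊞_) (F.neg-· (pos (toℕ b)) (f (proj₂ x)))))))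
            (sum-difference as bs Ψ f hs)))
          where
          expand : ∀ a as → M.⟪ digit a (cycle x) ++ sum as L ⟫ Ψ ≡ Wᶠ.weigh a (f (proj₂ x)) ⊞ M.⟪ sum as L ⟫ Ψ
          expand a as = trans (M.⟪⟫-++ (digit a (cycle x)) (sum as L) Ψ)
            (cong (_⊞ M.⟪ sum as L ⟫ Ψ) (trans (Wᶠ.⟪⟫-digit a (cycle x) Ψ) (cong (Wᶠ.weigh a) h)))

        module _ (L : List Part) (parts : All IsPart L) (distinct : AllPairs (λ x y → proj₂ x ≢ proj₂ y) L) where

          f : Vec (Fin 3) (length L) → Chain n
          f as = normal (sum as L)

          f-cycle : ∀ as → IsCycle n d (f as)
          f-cycle as = normal-cycle (sum-matched as parts) (sum-closed as parts)

          f-additive : ∀ as bs → Homologous n d (f (as ⊕ bs)) (f as ++ f bs)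
          f-additive as bs = normal-homologous (carries as bs L) (f (as ⊕ bs)) (f as ++ f bs) (carries-matched as bs parts)
            (λ Ψ alt → trans (carries-boundary as bs parts Ψ) (sym (cong₂ (λ u v → u +ℤ (-ℤ v)) (value (as ⊕ bs) Ψ alt)
              (trans (Evaluate.⟦⟧-++ ℤᴷ (f as) (f bs) (suc d) Ψ) (cong₂ _+ℤ_ (value as Ψ alt) (value bs Ψ alt))))))
            where
            value : ∀ as Ψ → Zᶠ.Alternating Ψ → Evaluate.⟦_⟧ ℤᴷ (f as) (suc d) Ψ ≡ Zᶠ.⟪ sum as L ⟫ Ψ
            value as Ψ alt = ⟦⟧-normal ℤᴷ (sum-matched as parts) alt

          f-injective : ∀ as bs → Homologous n d (f as) (f bs) → as ≡ bs
          f-injective as bs hom = family-equal as bs refl (All.tabulate zero-coefficient)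
            where
            detect : ∀ t E → t ∷ verts E ↭ p₀ ∷ P → ∑ᶠ (family as bs L) (edges E empty) ≡ 0₃
            detect t E tE = trans (sym (sum-difference as bs Ψ (edges E empty) (All.map (λ {x} → value {x}) parts)))
              (trans (cong₂ (λ u v → u ⊞ ⊟ v) (sym (⟦⟧-normal F₃ᴷ (sum-matched as parts) alternating))
                                              (sym (⟦⟧-normal F₃ᴷ (sum-matched bs parts) alternating)))
                (homologous-eval F₃ᴷ (f as) (f bs) hom Ψ cocycle))
              where open Pairing t E tE
            P! : Unique P
            P! = Unique-++⁻ʳ (p₀ ∷ q ∷ s ∷ v₀ ∷ fl) (Unique-resp-↭ (solve↭ 2 (λ P R → (P ⊹ R) ⊜ (R ⊹ P)) ↭-refl P (p₀ ∷ q ∷ s ∷ v₀ ∷ fl)) vs!)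
            p₀∉P : p₀ ∉ P
            p₀∉P i = Unique-++⇒∉ P vs! i (here refl)
            zero-coefficient : ∀ {x} → x ∈ family as bs L → proj₁ x F.· 1₃ ≡ 0₃
            zero-coefficient {c , u ∷ ys} i = coefficient-0 p₀ P P! p₀∉P (family as bs L)
              (family-all {λ T → ∃ λ A → Split P A T × length A ≡ length T} as bs
                (All.map (λ { {A , T} (sp , lA , lT) → A , sp , trans lA (sym lT) }) parts))
              (family-distinct as bs distinct)
              (λ u t E r → detect t ((p₀ , u) ∷ E) (↭-trans (solve↭ 4 (λ t p₀ u E → (t ⊹ p₀ ⊹ u ⊹ E) ⊜ (p₀ ⊹ u ⊹ t ⊹ E))
                 ↭-refl [ t ] [ p₀ ] [ u ] (verts E)) (prep p₀ r))) i
            -- An empty T means k = 0. There is no u to join to p₀; instead p₀ is itself the vertex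
            -- left out, and no edge is contracted.
            zero-coefficient {c , []} i = trans (sym (∑ᶠ-only (family as bs L) (family-distinct as bs distinct) i
                (All.map (λ { {_ , T} lT T≢[] → ⊥-elim (T≢[] (none T (trans lT (sym (empty-part i))))) })
                  (family-all {λ T → length T ≡ k} as bs (All.map (λ { (_ , _ , lT) → lT }) parts)))))
              (detect p₀ [] (subst (λ Q → p₀ ∷ [] ↭ p₀ ∷ Q) (sym (none P (trans |P| (cong (λ l → l + l) (sym (empty-part i)))))) ↭-refl))
              where
              none : ∀ (T : List V) → length T ≡ 0 → T ≡ []
              none [] _ = refl
              empty-part : ∀ {c} → (c , []) ∈ family as bs L → 0 ≡ k
              empty-part i = All.lookup (family-all {λ T → length T ≡ k} as bs (All.map (λ { (_ , _ , lT) → lT }) parts)) i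

          subgroup : HasZ3PowerSubgroup n d (length L)
          subgroup = f , f-cycle , f-additive , f-injective

-- Choice of the sets T, elements of order 3, and bounds for binomial coefficients

open Words
open Faces
open Normalisation
open Classes
open import Data.List using (allFin; take; drop)
open import Data.List.Membership.Propositional.Properties using (∈-allFin)
open import Data.List.Properties using (length-map; length-take; length-drop; take++drop≡id;
  length-tabulate)
open import Data.List.Relation.Unary.Unique.Propositional.Properties using (allFin⁺)
open import Data.Nat using (_*_; _+_; _∸_; _≤_; s≤s; ⌊_/2⌋)
open import Data.Nat.Combinatorics using (_C_; nCk+nC[k+1]≡[n+1]C[k+1])
open import Data.Nat.Properties using (suc-injective; +-assoc; +-identityʳ; +-cancelʳ-≡; ≤-refl;
  ≤-trans; ≤-reflexive; m≤m+n; m≤n+m; m≤n⇒m⊓n≡m; m+n∸m≡n; m∸n+n≡m; ⌊n/2⌋≤n)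
open import Data.Nat.Tactic.RingSolver using (solve-∀)
open import Relation.Binary.PropositionalEquality using (subst₂)

nC0≡1 : ∀ m → m C 0 ≡ 1
nC0≡1 zero = refl
nC0≡1 (suc m) = refl

module _ {n : ℕ} where
  open Independence (_≟ᶠ_ {n}) using (Split; []; left; right; Split-↭; Split-⊆; All⇒∉)
  private
    V = Fin n

  choose : ℕ → List V → List (List V × List V)
  choose zero P = (P , []) ∷ []
  choose (suc j) [] = []
  choose (suc j) (x ∷ P) = map (λ { (A , T) → (A , x ∷ T) }) (choose j P) ++
                           map (λ { (A , T) → (x ∷ A , T) }) (choose (suc j) P)

  length-choose : ∀ j P → length (choose j P) ≡ length P C j
  length-choose zero P = sym (nC0≡1 (length P))
  length-choose (suc j) [] = refl
  length-choose (suc j) (x ∷ P) = trans (length-++ (map _ (choose j P)))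
    (trans (cong₂ _+_ (trans (length-map _ (choose j P)) (length-choose j P))
                      (trans (length-map _ (choose (suc j) P)) (length-choose (suc j) P)))
      (nCk+nC[k+1]≡[n+1]C[k+1] (length P) j))

  choose-split : ∀ j P → All (λ { (A , T) → Split P A T × length T ≡ j }) (choose j P)
  choose-split zero P = (all-left P , refl) ∷ []
    where
    all-left : ∀ P → Split P P []
    all-left [] = []
    all-left (x ∷ P) = left (all-left P)
  choose-split (suc j) [] = []
  choose-split (suc j) (x ∷ P) = AllP.++⁺
    (AllP.map⁺ (All.map (λ { (s , l) → right s , cong suc l }) (choose-split j P)))
    (AllP.map⁺ (All.map (λ { (s , l) → left s , l }) (choose-split (suc j) P)))

  choose-distinct : ∀ j P → Unique P → AllPairs (λ x y → proj₂ x ≢ proj₂ y) (choose j P)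
  choose-distinct zero P u = [] ∷ []
  choose-distinct (suc j) [] u = []
  choose-distinct (suc j) (x ∷ P) (h ∷ u) = AllPairsP.++⁺
    (AllPairsP.map⁺ (AllPairs.map (λ ne e → ne (∷-injectiveʳ e)) (choose-distinct j P u)))
    (AllPairsP.map⁺ (choose-distinct (suc j) P u))
    (AllP.map⁺ (All.universal (λ _ → AllP.map⁺ (All.map (λ { (s , _) e → All⇒∉ h (Split-⊆ s (subst (x ∈_) e (here refl))) })
      (choose-split (suc j) P))) (choose j P)))

  triples : ∀ r (xs : List V) → length xs ≡ r * 3 → ∃ λ (ts : Vec (V × V × V) r) → toList (Detection.flat _≟ᶠ_ ts) ≡ xs
  triples zero [] _ = [] , refl
  triples (suc r) (a ∷ b ∷ c ∷ xs) l with triples r xs (suc-injective (suc-injective (suc-injective l)))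
  ... | ts , refl = (a , b , c) ∷ ts , refl

  -- In this form bounding chains can be added and negated, and what remains is an identity between
  -- integers.
  ⟦⟧-boundary : ∀ {d x y} → Homologous n d x y → ∃ λ b → ∀ Ψ →
    Evaluate.⟦_⟧ ℤᴷ b (suc (suc d)) (Functionals.δ ℤᴷ Ψ) ≡
    Evaluate.⟦_⟧ ℤᴷ x (suc d) Ψ +ℤ (-ℤ Evaluate.⟦_⟧ ℤᴷ y (suc d) Ψ)
  ⟦⟧-boundary {d} {x} {y} (b , e) = b , λ Ψ → trans (sym (⟦⟧-∂ b (suc d) Ψ))
    (trans (⟦⟧-≈ {∂ (suc (suc d)) b} {x ++ neg y} e Ψ) (trans (⟦⟧-++ x (neg y) (suc d) Ψ)
      (cong (⟦ x ⟧ (suc d) Ψ +ℤ_) (⟦⟧-neg y (suc d) Ψ))))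
    where open Evaluate ℤᴷ

  boundary-⟦⟧ : ∀ {d} b x y → (∀ Ψ →
    Evaluate.⟦_⟧ ℤᴷ b (suc (suc d)) (Functionals.δ ℤᴷ Ψ) ≡
    Evaluate.⟦_⟧ ℤᴷ x (suc d) Ψ +ℤ (-ℤ Evaluate.⟦_⟧ ℤᴷ y (suc d) Ψ)) → Homologous n d x y
  boundary-⟦⟧ {d} b x y h = b , ≈-⟦⟧ (∂ (suc (suc d)) b) (x ++ neg y) (suc d) (λ Ψ _ →
    trans (⟦⟧-∂ b (suc d) Ψ) (trans (h Ψ) (sym (trans (⟦⟧-++ x (neg y) (suc d) Ψ)
      (cong (⟦ x ⟧ (suc d) Ψ +ℤ_) (⟦⟧-neg y (suc d) Ψ))))))
    where open Evaluate ℤᴷ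

  -- The map `f` respects sums only up to boundaries, and `f nought` need not be the empty chain.
  -- The chains `b₀`, `b₂`, `b₃` bound -f(0), f(2) - 2 f(1) and f(0) - f(1) - f(2); combinations of
  -- them reduce the two claims of nonvanishing to injectivity and bound 3 f(1).
  order-3 : ∀ {d} → HasZ3PowerSubgroup n d 1 → HasElementOfOrder3 n d
  order-3 {d} (f , cyc , hom , inj) = f one , cyc one ,
    (λ h → absurd₁ (inj one nought (with-bound h))) , (λ h → absurd₂ (inj two nought (with-bound₂ h))) , thrice
    where
    open Evaluate ℤᴷ
    open Functionals ℤᴷ using (δ)
    open +-*-Solver using (solve; con; _:+_; :-_; _:=_)
    nought one two : Vec (Fin 3) 1
    nought = zero ∷ []
    one = suc zero ∷ []
    two = suc (suc zero) ∷ []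
    absurd₁ : one ≢ nought
    absurd₁ ()
    absurd₂ : two ≢ nought
    absurd₂ ()
    b₀ = ⟦⟧-boundary {x = f nought} {f nought ++ f nought} (hom nought nought)
    b₂ = ⟦⟧-boundary {x = f two} {f one ++ f one} (hom one one)
    b₃ = ⟦⟧-boundary {x = f nought} {f one ++ f two} (hom one two)
    ⟦⟧-sum : ∀ x y z Ψ → ⟦ x ++ y ++ z ⟧ (suc (suc d)) Ψ ≡ ⟦ x ⟧ (suc (suc d)) Ψ +ℤ (⟦ y ⟧ (suc (suc d)) Ψ +ℤ ⟦ z ⟧ (suc (suc d)) Ψ)
    ⟦⟧-sum x y z Ψ = trans (⟦⟧-++ x (y ++ z) _ Ψ) (cong (⟦ x ⟧ (suc (suc d)) Ψ +ℤ_) (⟦⟧-++ y z _ Ψ))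
    with-bound : Homologous n d (f one) [] → Homologous n d (f one) (f nought)
    with-bound h with ⟦⟧-boundary {x = f one} {[]} h
    ... | b , e = boundary-⟦⟧ (b ++ proj₁ b₀) (f one) (f nought) (λ Ψ → trans (⟦⟧-++ b (proj₁ b₀) _ (δ Ψ))
      (trans (cong₂ _+ℤ_ (e Ψ) (trans (proj₂ b₀ Ψ) (cong (λ u → ⟦ f nought ⟧ (suc d) Ψ +ℤ (-ℤ u)) (⟦⟧-++ (f nought) (f nought) (suc d) Ψ))))
        (solve 2 (λ x y → (x :+ (:- con 0ℤ)) :+ (y :+ (:- (y :+ y))) := x :+ (:- y)) refl (⟦ f one ⟧ (suc d) Ψ) (⟦ f nought ⟧ (suc d) Ψ))))
    with-bound₂ : Homologous n d (f one ++ f one) [] → Homologous n d (f two) (f nought)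
    with-bound₂ h with ⟦⟧-boundary {x = f one ++ f one} {[]} h
    ... | b , e = boundary-⟦⟧ (b ++ proj₁ b₂ ++ proj₁ b₀) (f two) (f nought) (λ Ψ → trans (⟦⟧-sum b (proj₁ b₂) (proj₁ b₀) (δ Ψ))
      (trans (cong₂ _+ℤ_ (trans (e Ψ) (cong (_+ℤ (-ℤ 0ℤ)) (⟦⟧-++ (f one) (f one) (suc d) Ψ)))
          (cong₂ _+ℤ_ (trans (proj₂ b₂ Ψ) (cong (λ u → ⟦ f two ⟧ (suc d) Ψ +ℤ (-ℤ u)) (⟦⟧-++ (f one) (f one) (suc d) Ψ)))
                      (trans (proj₂ b₀ Ψ) (cong (λ u → ⟦ f nought ⟧ (suc d) Ψ +ℤ (-ℤ u)) (⟦⟧-++ (f nought) (f nought) (suc d) Ψ)))))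
        (solve 3 (λ x y w → ((x :+ x) :+ (:- con 0ℤ)) :+ ((w :+ (:- (x :+ x))) :+ (y :+ (:- (y :+ y)))) := w :+ (:- y)) refl
          (⟦ f one ⟧ (suc d) Ψ) (⟦ f nought ⟧ (suc d) Ψ) (⟦ f two ⟧ (suc d) Ψ))))
    thrice : Homologous n d (f one ++ f one ++ f one) []
    thrice = boundary-⟦⟧ (neg (proj₁ b₀) ++ neg (proj₁ b₂) ++ neg (proj₁ b₃)) (f one ++ f one ++ f one) [] (λ Ψ →
      trans (⟦⟧-sum (neg (proj₁ b₀)) (neg (proj₁ b₂)) (neg (proj₁ b₃)) (δ Ψ))
      (trans (cong₂ _+ℤ_ (minus (proj₁ b₀) Ψ (trans (proj₂ b₀ Ψ) (cong (λ u → ⟦ f nought ⟧ (suc d) Ψ +ℤ (-ℤ u)) (⟦⟧-++ (f nought) (f nought) (suc d) Ψ))))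
          (cong₂ _+ℤ_ (minus (proj₁ b₂) Ψ (trans (proj₂ b₂ Ψ) (cong (λ u → ⟦ f two ⟧ (suc d) Ψ +ℤ (-ℤ u)) (⟦⟧-++ (f one) (f one) (suc d) Ψ))))
                      (minus (proj₁ b₃) Ψ (trans (proj₂ b₃ Ψ) (cong (λ u → ⟦ f nought ⟧ (suc d) Ψ +ℤ (-ℤ u)) (⟦⟧-++ (f one) (f two) (suc d) Ψ))))))
      (trans (solve 3 (λ x y w → (:- (y :+ (:- (y :+ y)))) :+ ((:- (w :+ (:- (x :+ x)))) :+ (:- (y :+ (:- (x :+ w))))) :=
                  (x :+ (x :+ x)) :+ (:- con 0ℤ)) refl
          (⟦ f one ⟧ (suc d) Ψ) (⟦ f nought ⟧ (suc d) Ψ) (⟦ f two ⟧ (suc d) Ψ))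
        (cong (_+ℤ (-ℤ 0ℤ)) (sym (trans (⟦⟧-++ (f one) (f one ++ f one) (suc d) Ψ)
          (cong (⟦ f one ⟧ (suc d) Ψ +ℤ_) (⟦⟧-++ (f one) (f one) (suc d) Ψ))))))))
      where
      minus : ∀ b Ψ {x} → ⟦ b ⟧ (suc (suc d)) (δ Ψ) ≡ x → ⟦ neg b ⟧ (suc (suc d)) (δ Ψ) ≡ -ℤ x
      minus b Ψ e = trans (⟦⟧-neg b (suc (suc d)) (δ Ψ)) (cong -ℤ_ e)

-- Here `r` is counted from 3, so that there are `r` + 2 triples. Keeping only the first `m` of all
-- partitions lets one construction serve the three assertions.
subgroups : ∀ k r m → m ≤ (2 * k) C k → HasZ3PowerSubgroup (2 * k + 1 + 3 * suc (suc (suc r))) (k + suc (suc r)) m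
subgroups k r m m≤ = from-vertices (drop (k + k) vs) rest-length refl
  where
  n : ℕ
  n = 2 * k + 1 + 3 * suc (suc (suc r))
  size : ∀ k r → 2 * k + 1 + 3 * suc (suc (suc r)) ≡ (k + k) + suc (suc (suc (suc (suc (suc r) * 3))))
  size = solve-∀
  vs P : List (Fin n)
  vs = allFin n
  P = take (k + k) vs
  vs-length : length vs ≡ (k + k) + suc (suc (suc (suc (suc (suc r) * 3))))
  vs-length = trans (length-tabulate (λ i → i)) (size k r)
  rest-length : length (drop (k + k) vs) ≡ suc (suc (suc (suc (suc (suc r) * 3))))
  rest-length = trans (length-drop (k + k) vs) (trans (cong (_∸ (k + k)) vs-length) (m+n∸m≡n (k + k) _))
  P-length : length P ≡ k + k
  P-length = trans (length-take (k + k) vs) (m≤n⇒m⊓n≡m (subst (k + k ≤_) (sym vs-length) (m≤m+n (k + k) _)))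
  from-vertices : ∀ rest → length rest ≡ suc (suc (suc (suc (suc (suc r) * 3)))) → drop (k + k) vs ≡ rest →
    HasZ3PowerSubgroup n (k + suc (suc r)) m
  from-vertices (p₀ ∷ q ∷ s ∷ v₀ ∷ xs) l e with triples (suc (suc r)) xs
    (suc-injective (suc-injective (suc-injective (suc-injective l))))
  ... | t₁ ∷ t₂ ∷ ts , refl = subst (HasZ3PowerSubgroup n (k + suc (suc r))) L-length
        (subgroup vs! cover L (AllP.take⁺ m parts) (AllPairsP.take⁺ m (choose-distinct k P P!)))
    where
    open Construction {n} k r P p₀ q s v₀ t₁ t₂ ts P-length
    open Independence (_≟ᶠ_ {n}) using (Split-↭)
    decomposition : vs ≡ P ++ p₀ ∷ q ∷ s ∷ v₀ ∷ fl
    decomposition = trans (sym (take++drop≡id (k + k) vs)) (cong (P ++_) e)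
    vs! : Unique (P ++ p₀ ∷ q ∷ s ∷ v₀ ∷ fl)
    vs! = subst Unique decomposition (allFin⁺ n)
    cover : ∀ x → x ∈ P ++ p₀ ∷ q ∷ s ∷ v₀ ∷ fl
    cover x = subst (x ∈_) decomposition (∈-allFin x)
    P! : Unique P
    P! = AllPairsP.take⁺ (k + k) (allFin⁺ n)
    L : List (List (Fin n) × List (Fin n))
    L = take m (choose k P)
    parts : All (IsPart vs! cover) (choose k P)
    parts = All.map (λ { {A , T} (sp , lT) → sp , +-cancelʳ-≡ k (length A) k (trans (cong (length A +_) (sym lT))
      (trans (sym (length-++ A)) (trans (↭-length (Split-↭ sp)) P-length))) , lT }) (choose-split k P)
    L-length : length L ≡ m
    L-length = trans (length-take m (choose k P)) (m≤n⇒m⊓n≡m (subst (m ≤_) (sym (trans (length-choose k P)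
      (cong (_C k) (trans P-length (cong (k +_) (sym (+-identityʳ k))))))) m≤))

C-up : ∀ m j → m C suc j ≤ suc m C suc j
C-up m j = subst (m C suc j ≤_) (nCk+nC[k+1]≡[n+1]C[k+1] m j) (m≤n+m _ _)

C-diagonal : ∀ m j → m C j ≤ suc m C suc j
C-diagonal m j = subst (m C j ≤_) (nCk+nC[k+1]≡[n+1]C[k+1] m j) (m≤m+n _ _)

-- A monotone path in Pascal's triangle: `b` steps enlarge the set only, then `a` steps enlarge the
-- set and the chosen subset together.
C-steps : ∀ a b m j → m C j ≤ (a + (b + m)) C (a + j)
C-steps zero zero m j = ≤-refl
C-steps zero (suc b) m zero = ≤-trans (C-steps zero b m zero) (≤-reflexive (trans (nC0≡1 (b + m)) (sym (nC0≡1 (suc (b + m))))))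
C-steps zero (suc b) m (suc j) = ≤-trans (C-steps zero b m (suc j)) (C-up (b + m) j)
C-steps (suc a) b m j = ≤-trans (C-steps a b m j) (C-diagonal (a + (b + m)) (a + j))

1≤2kCk : ∀ k → 1 ≤ (2 * k) C k
1≤2kCk k = subst₂ (λ a b → 1 ≤ a C b) (cong (k +_) refl) (+-identityʳ k) (C-steps k k 0 0)

central-bound : ∀ k → suc k C ⌊ suc k /2⌋ ≤ (2 * k) C k
central-bound zero = ≤-refl
central-bound (suc k) = subst₂ (λ a b → suc (suc k) C suc ⌊ k /2⌋ ≤ a C b) top bottom
  -- The lower index has to rise from ⌊k/2⌋ + 1 to k + 1, which takes k - ⌊k/2⌋ diagonal steps; the
  -- remaining ⌊k/2⌋ of the k steps from k + 2 up to 2k + 2 raise the upper index alone.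
  (C-steps (k ∸ ⌊ k /2⌋) ⌊ k /2⌋ (suc (suc k)) (suc ⌊ k /2⌋))
  where
  complement : k ∸ ⌊ k /2⌋ + ⌊ k /2⌋ ≡ k
  complement = m∸n+n≡m (⌊n/2⌋≤n k)
  bottom : k ∸ ⌊ k /2⌋ + suc ⌊ k /2⌋ ≡ suc k
  bottom = trans (+-suc _ _) (cong suc complement)
  top : k ∸ ⌊ k /2⌋ + (⌊ k /2⌋ + suc (suc k)) ≡ 2 * suc k
  top = trans (sym (+-assoc (k ∸ ⌊ k /2⌋) ⌊ k /2⌋ _)) (trans (cong (_+ suc (suc k)) complement) (double k))
    where
    double : ∀ k → k + suc (suc k) ≡ 2 * suc k
    double = solve-∀

degree : ∀ k r → k + suc (suc r) ≡ k + suc (suc (suc r)) ∸ 1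
degree k r = cong (_∸ 1) (sym (+-suc k (suc (suc r))))

theorem5p4 : ((k r : ℕ) → 4 ≤ r →
    HasZ3PowerSubgroup (2 * k + 1 + 3 * r) (k + r ∸ 1) ((2 * k) C k))
    × ((k : ℕ) →
    HasZ3PowerSubgroup (2 * k + 10) (k + 2) (suc k C ⌊ suc k /2⌋))
    × ((k r : ℕ) → 3 ≤ r →
    HasElementOfOrder3 (2 * k + 1 + 3 * r) (k + r ∸ 1))
theorem5p4 =
  (λ { k (suc (suc (suc r))) (s≤s (s≤s (s≤s _))) →
    subst (λ d → HasZ3PowerSubgroup (2 * k + 1 + 3 * suc (suc (suc r))) d ((2 * k) C k)) (degree k r)
      (subgroups k r ((2 * k) C k) ≤-refl) }) ,
  (λ k → subst (λ n → HasZ3PowerSubgroup n (k + 2) (suc k C ⌊ suc k /2⌋)) (+-assoc (2 * k) 1 9)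
    (subgroups k 0 (suc k C ⌊ suc k /2⌋) (central-bound k))) ,
  (λ { k (suc (suc (suc r))) (s≤s (s≤s (s≤s _))) →
    subst (HasElementOfOrder3 (2 * k + 1 + 3 * suc (suc (suc r)))) (degree k r)
      (order-3 (subgroups k r 1 (1≤2kCk k))) })
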